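{- There is an absolute constant $c>0$ such that for every $n\ge 3$ and every $3$-uniform hypergraph $H$ on $n$ vertices with at least one hyperedge, $Q(f_H) \ge c\, n^{4/5}$.
   Context: For a fixed $3$-uniform hypergraph $H$ on vertex set $[n]$, $f_H:\{0,1\}^{\binom{n}{3}}\to\{0,1\}$ takes as input a $3$-uniform hypergraph $G$ on $[n]$, given by the $\binom n3$ hyperedge-indicator bits (one per $3$-element subset of $[n]$), and $f_H(G)=1$ iff $H$ is isomorphic to a (not necessarily induced) subhypergraph of $G$, i.e. there is a bijection $\pi:[n]\to[n]$ mapping every hyperedge of $H$ to a hyperedge of $G$. $Q(f)$ denotes the bounded-error (success probability at least $2/3$) quantum query complexity of a Boolean function $f$. -}

module Defs where

open import Algebra.Bundles.Raw using (RawMonoid)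
import Algebra.Definitions.RawMonoid as RawMonoidSum
import Algebra.Properties.CommutativeMonoid.Sum as CommutativeMonoidSum
open import Data.Bool.Base using (Bool; true; false; _xor_; if_then_else_)
import Data.Bool.Properties as Bool
open import Data.Fin.Base using (Fin)
open import Data.Fin.Permutation using (Permutation′; permutation; flip; _⟨$⟩ʳ_; _⟨$⟩ˡ_; inverseˡ; inverseʳ)
import Data.Fin.Properties as Fin
open import Data.Fin.Subset using (Subset; ∣_∣)
open import Data.Integer.Base using (+_; +[1+_]; -[1+_])
import Data.Integer.Base as ℤ
import Data.Integer.Properties as ℤ
open import Data.Nat.Base as ℕ using (ℕ; zero; suc)
open import Data.Nat.Combinatorics using (_C_; nCk+nC[k+1]≡[n+1]C[k+1])
import Data.Nat.Properties as ℕ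
open import Data.Product.Base using (Σ-syntax; ∃; ∃-syntax; _×_; _,_; proj₁; proj₂)
open import Data.Product.Properties using (≡-dec; Σ-≡,≡→≡)
open import Data.Rational.Base as ℚ using (ℚ; mkℚ; 0ℚ; 1ℚ)
import Data.Rational.Properties as ℚ
open import Data.Rational.Solver using (module +-*-Solver)
import Data.Rational.Unnormalised.Base as ℚᵘ
import Data.Rational.Unnormalised.Properties as ℚᵘ
open import Data.Sum.Base using (_⊎_; inj₁; inj₂)
open import Data.Sum.Function.Propositional using (_⊎-↔_)
open import Data.Vec.Base using (Vec; []; _∷_; lookup; tabulate)
open import Data.Vec.Properties using (lookup∘tabulate; tabulate-cong)
open import Function.Base using (_∘_)
open import Function.Bundles using (_↔_; Inverse; mk↔ₛ′)
open import Function.Construct.Composition using (_↔-∘_)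
open import Function.Construct.Symmetry using (↔-sym)
open import Level using (0ℓ)
open import Relation.Binary.PropositionalEquality
open import Relation.Nullary using (Dec; yes; no; does; contradiction)
open import Relation.Nullary.Decidable using (⌊_⌋; map′; _×-dec_; _→-dec_)

-- Real numbers are Cauchy sequences of rationals, with _≃ᴿ_ as equality

IsCauchy : (ℕ → ℚ) → Set
IsCauchy x = ∀ ε → 0ℚ ℚ.< ε →
  ∃[ N ] (∀ m n → N ℕ.≤ m → N ℕ.≤ n → ℚ.∣ x m ℚ.- x n ∣ ℚ.< ε)

record ℝ : Set where
  constructor mkℝ
  field
    seq    : ℕ → ℚ
    cauchy : IsCauchy seq

open ℝ public

infix 4 _≃ᴿ_ _≤ᴿ_ _<ᴿ_

_≃ᴿ_ : ℝ → ℝ → Set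
x ≃ᴿ y = ∀ ε → 0ℚ ℚ.< ε →
  ∃[ N ] (∀ n → N ℕ.≤ n → ℚ.∣ seq x n ℚ.- seq y n ∣ ℚ.< ε)

_≤ᴿ_ : ℝ → ℝ → Set
x ≤ᴿ y = ∀ ε → 0ℚ ℚ.< ε →
  ∃[ N ] (∀ n → N ℕ.≤ n → seq x n ℚ.≤ seq y n ℚ.+ ε)

_<ᴿ_ : ℝ → ℝ → Set
x <ᴿ y = ∃[ ε ] (0ℚ ℚ.< ε ×
  ∃[ N ] (∀ n → N ℕ.≤ n → seq x n ℚ.+ ε ℚ.≤ seq y n))

private
  open +-*-Solver

  half-pos : ∀ {ε} → 0ℚ ℚ.< ε → 0ℚ ℚ.< ε ℚ.* ℚ.½
  half-pos 0<ε = ℚ.*-monoˡ-<-pos ℚ.½ 0<ε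

  halves : ∀ ε → ε ℚ.* ℚ.½ ℚ.+ ε ℚ.* ℚ.½ ≡ ε
  halves ε = trans (sym (ℚ.*-distribˡ-+ ε ℚ.½ ℚ.½)) (ℚ.*-identityʳ ε)

  -- The moduli are abstract so that real numbers have small normal forms.
  abstract
    const-cauchy : ∀ q → IsCauchy (λ _ → q)
    const-cauchy q ε 0<ε = 0 , λ _ _ _ _ →
      subst (ℚ._< ε) (sym (cong ℚ.∣_∣ (ℚ.+-inverseʳ q))) 0<ε

  abstract
    +-cauchy : ∀ {x y} → IsCauchy x → IsCauchy y → IsCauchy (λ n → x n ℚ.+ y n)
    +-cauchy {x} {y} cx cy ε 0<ε
      with cx (ε ℚ.* ℚ.½) (half-pos 0<ε) | cy (ε ℚ.* ℚ.½) (half-pos 0<ε)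
    ... | M , hx | N , hy = M ℕ.⊔ N , λ m n p q → begin-strict
      ℚ.∣ (x m ℚ.+ y m) ℚ.- (x n ℚ.+ y n) ∣
        ≡⟨ cong ℚ.∣_∣ (solve 4 (λ a b c d → (a :+ b) :- (c :+ d) := (a :- c) :+ (b :- d))
             refl (x m) (y m) (x n) (y n)) ⟩
      ℚ.∣ (x m ℚ.- x n) ℚ.+ (y m ℚ.- y n) ∣
        ≤⟨ ℚ.∣p+q∣≤∣p∣+∣q∣ (x m ℚ.- x n) (y m ℚ.- y n) ⟩
      ℚ.∣ x m ℚ.- x n ∣ ℚ.+ ℚ.∣ y m ℚ.- y n ∣
        <⟨ ℚ.+-mono-< (hx m n (ℕ.m⊔n≤o⇒m≤o M N p) (ℕ.m⊔n≤o⇒m≤o M N q))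
                      (hy m n (ℕ.m⊔n≤o⇒n≤o M N p) (ℕ.m⊔n≤o⇒n≤o M N q)) ⟩
      ε ℚ.* ℚ.½ ℚ.+ ε ℚ.* ℚ.½
        ≡⟨ halves ε ⟩
      ε ∎
      where open ℚ.≤-Reasoning

  abstract
    neg-cauchy : ∀ {x} → IsCauchy x → IsCauchy (λ n → ℚ.- x n)
    neg-cauchy {x} cx ε 0<ε with cx ε 0<ε
    ... | N , h = N , λ m n p q → subst (ℚ._< ε)
      (trans (sym (ℚ.∣-p∣≡∣p∣ (x m ℚ.- x n)))
        (cong ℚ.∣_∣ (solve 2 (λ a b → :- (a :- b) := (:- a) :- (:- b)) refl (x m) (x n))))
      (h m n p q)

  bounded : ∀ {x} → IsCauchy x →
            ∃[ B ] (0ℚ ℚ.< B × ∃[ N ] (∀ n → N ℕ.≤ n → ℚ.∣ x n ∣ ℚ.≤ B))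
  bounded {x} cx with cx 1ℚ (ℚ.positive⁻¹ 1ℚ)
  ... | N , h = ℚ.∣ x N ∣ ℚ.+ 1ℚ , ℚ.+-mono-≤-< (ℚ.0≤∣p∣ (x N)) (ℚ.positive⁻¹ 1ℚ) , N ,
    λ n N≤n → begin
      ℚ.∣ x n ∣
        ≡⟨ cong ℚ.∣_∣ (solve 2 (λ a b → a := b :+ (a :- b)) refl (x n) (x N)) ⟩
      ℚ.∣ x N ℚ.+ (x n ℚ.- x N) ∣
        ≤⟨ ℚ.∣p+q∣≤∣p∣+∣q∣ (x N) (x n ℚ.- x N) ⟩
      ℚ.∣ x N ∣ ℚ.+ ℚ.∣ x n ℚ.- x N ∣
        ≤⟨ ℚ.+-monoʳ-≤ ℚ.∣ x N ∣ (ℚ.<⇒≤ (h n N N≤n ℕ.≤-refl)) ⟩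
      ℚ.∣ x N ∣ ℚ.+ 1ℚ ∎
    where open ℚ.≤-Reasoning

  inverse : ∀ s → 0ℚ ℚ.< s → ∃[ r ] (0ℚ ℚ.< r × s ℚ.* r ≡ 1ℚ)
  inverse s 0<s = ℚ.1/ s , ℚ.positive⁻¹ (ℚ.1/ s) {{ℚ.1/pos⇒pos s}} , ℚ.*-inverseʳ s
    where
    instance
      s-pos : ℚ.Positive s
      s-pos = ℚ.positive 0<s
      s-nonZero : ℚ.NonZero s
      s-nonZero = ℚ.pos⇒nonZero s

  *-pos : ∀ {p q} → 0ℚ ℚ.< p → 0ℚ ℚ.< q → 0ℚ ℚ.< p ℚ.* q
  *-pos {p} {q} 0<p 0<q =
    subst (ℚ._< p ℚ.* q) (ℚ.*-zeroˡ q) (ℚ.*-monoˡ-<-pos q {{ℚ.positive 0<q}} 0<p)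

  *-estimate : ∀ {A B δ} a b c d → 0ℚ ℚ.< A → 0ℚ ℚ.< B →
    ℚ.∣ a ∣ ℚ.≤ A → ℚ.∣ d ∣ ℚ.≤ B → ℚ.∣ a ℚ.- c ∣ ℚ.< δ → ℚ.∣ b ℚ.- d ∣ ℚ.< δ →
    ℚ.∣ a ℚ.* b ℚ.- c ℚ.* d ∣ ℚ.< (A ℚ.+ B) ℚ.* δ
  *-estimate {A} {B} {δ} a b c d 0<A 0<B a≤A d≤B a-c b-d = begin-strict
    ℚ.∣ a ℚ.* b ℚ.- c ℚ.* d ∣
      ≡⟨ cong ℚ.∣_∣ (solve 4 (λ a b c d →
           a :* b :- c :* d := a :* (b :- d) :+ (a :- c) :* d) refl a b c d) ⟩
    ℚ.∣ a ℚ.* (b ℚ.- d) ℚ.+ (a ℚ.- c) ℚ.* d ∣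
      ≤⟨ ℚ.∣p+q∣≤∣p∣+∣q∣ (a ℚ.* (b ℚ.- d)) ((a ℚ.- c) ℚ.* d) ⟩
    ℚ.∣ a ℚ.* (b ℚ.- d) ∣ ℚ.+ ℚ.∣ (a ℚ.- c) ℚ.* d ∣
      ≡⟨ cong₂ ℚ._+_ (ℚ.∣p*q∣≡∣p∣*∣q∣ a (b ℚ.- d)) (ℚ.∣p*q∣≡∣p∣*∣q∣ (a ℚ.- c) d) ⟩
    ℚ.∣ a ∣ ℚ.* ℚ.∣ b ℚ.- d ∣ ℚ.+ ℚ.∣ a ℚ.- c ∣ ℚ.* ℚ.∣ d ∣
      ≤⟨ ℚ.+-mono-≤
           (ℚ.*-monoʳ-≤-nonNeg ℚ.∣ b ℚ.- d ∣ {{ℚ.∣-∣-nonNeg (b ℚ.- d)}} a≤A)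
           (ℚ.*-monoˡ-≤-nonNeg ℚ.∣ a ℚ.- c ∣ {{ℚ.∣-∣-nonNeg (a ℚ.- c)}} d≤B) ⟩
    A ℚ.* ℚ.∣ b ℚ.- d ∣ ℚ.+ ℚ.∣ a ℚ.- c ∣ ℚ.* B
      <⟨ ℚ.+-mono-< (ℚ.*-monoʳ-<-pos A {{ℚ.positive 0<A}} b-d)
                    (ℚ.*-monoˡ-<-pos B {{ℚ.positive 0<B}} a-c) ⟩
    A ℚ.* δ ℚ.+ δ ℚ.* B
      ≡⟨ solve 3 (λ A B δ → A :* δ :+ δ :* B := (A :+ B) :* δ) refl A B δ ⟩
    (A ℚ.+ B) ℚ.* δ ∎
    where open ℚ.≤-Reasoning

  abstract
    *-cauchy : ∀ {x y} → IsCauchy x → IsCauchy y → IsCauchy (λ n → x n ℚ.* y n)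
    *-cauchy {x} {y} cx cy ε 0<ε =
      let A , 0<A , K , hA = bounded {x} cx
          B , 0<B , L , hB = bounded {y} cy
          r , 0<r , Sr≡1   = inverse (A ℚ.+ B) (ℚ.+-mono-< 0<A 0<B)
          M , hx           = cx (r ℚ.* ε) (*-pos 0<r 0<ε)
          N , hy           = cy (r ℚ.* ε) (*-pos 0<r 0<ε)
      in (K ℕ.⊔ L) ℕ.⊔ (M ℕ.⊔ N) , λ m n p q →
        let KL≤m = ℕ.m⊔n≤o⇒m≤o (K ℕ.⊔ L) (M ℕ.⊔ N) p
            KL≤n = ℕ.m⊔n≤o⇒m≤o (K ℕ.⊔ L) (M ℕ.⊔ N) q
            MN≤m = ℕ.m⊔n≤o⇒n≤o (K ℕ.⊔ L) (M ℕ.⊔ N) p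
            MN≤n = ℕ.m⊔n≤o⇒n≤o (K ℕ.⊔ L) (M ℕ.⊔ N) q
        in subst (ℚ.∣ x m ℚ.* y m ℚ.- x n ℚ.* y n ∣ ℚ.<_)
             (trans (sym (ℚ.*-assoc (A ℚ.+ B) r ε))
               (trans (cong (ℚ._* ε) Sr≡1) (ℚ.*-identityˡ ε)))
             (*-estimate (x m) (y m) (x n) (y n) 0<A 0<B
               (hA m (ℕ.m⊔n≤o⇒m≤o K L KL≤m))
               (hB n (ℕ.m⊔n≤o⇒n≤o K L KL≤n))
               (hx m n (ℕ.m⊔n≤o⇒m≤o M N MN≤m) (ℕ.m⊔n≤o⇒m≤o M N MN≤n))
               (hy m n (ℕ.m⊔n≤o⇒n≤o M N MN≤m) (ℕ.m⊔n≤o⇒n≤o M N MN≤n)))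

infixl 6 _+ᴿ_
infixl 7 _*ᴿ_
infix  8 -ᴿ_

fromℚ : ℚ → ℝ
fromℚ q = mkℝ (λ _ → q) (const-cauchy q)

fromℕ : ℕ → ℝ
fromℕ n = fromℚ (+ n ℚ./ 1)

0ᴿ 1ᴿ : ℝ
0ᴿ = fromℚ 0ℚ
1ᴿ = fromℚ 1ℚ

_+ᴿ_ : ℝ → ℝ → ℝ
x +ᴿ y = mkℝ (λ n → seq x n ℚ.+ seq y n) (+-cauchy {seq x} {seq y} (cauchy x) (cauchy y))

-ᴿ_ : ℝ → ℝ
-ᴿ x = mkℝ (λ n → ℚ.- seq x n) (neg-cauchy {seq x} (cauchy x))

_*ᴿ_ : ℝ → ℝ → ℝ
x *ᴿ y = mkℝ (λ n → seq x n ℚ.* seq y n) (*-cauchy {seq x} {seq y} (cauchy x) (cauchy y))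

-- ⌊ a ^ (1/p) ⌋
iroot : ℕ → ℕ → ℕ
iroot p zero    = 0
iroot p (suc a) = step (iroot p a)
  where
  step : ℕ → ℕ
  step r = if ⌊ suc r ℕ.^ p ℕ.≤? suc a ⌋ then suc r else r

iroot-lower : ∀ p .{{_ : ℕ.NonZero p}} a → iroot p a ℕ.^ p ℕ.≤ a
iroot-lower (suc p) zero = ℕ.z≤n
iroot-lower p (suc a) with suc (iroot p a) ℕ.^ p ℕ.≤? suc a
... | yes h = h
... | no  _ = ℕ.m≤n⇒m≤1+n (iroot-lower p a)

iroot-upper : ∀ p .{{_ : ℕ.NonZero p}} a → a ℕ.< suc (iroot p a) ℕ.^ p
iroot-upper p zero = ℕ.≤-reflexive (sym (ℕ.^-zeroˡ p))
iroot-upper p (suc a) with suc (iroot p a) ℕ.^ p ℕ.≤? suc a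
... | yes _ = ℕ.≤-<-trans (iroot-upper p a) (ℕ.^-monoˡ-< p (ℕ.n<1+n (suc (iroot p a))))
... | no ¬h = ℕ.≰⇒> ¬h

private
  ^-cancel-< : ∀ {a b} p → a ℕ.^ p ℕ.< b ℕ.^ p → a ℕ.< b
  ^-cancel-< {a} {b} p h with b ℕ.≤? a
  ... | yes b≤a = contradiction h (ℕ.≤⇒≯ (ℕ.^-monoˡ-≤ p b≤a))
  ... | no  b≰a = ℕ.≰⇒> b≰a

  ^-distrib-* : ∀ a b k → (a ℕ.* b) ℕ.^ k ≡ a ℕ.^ k ℕ.* b ℕ.^ k
  ^-distrib-* a b zero    = refl
  ^-distrib-* a b (suc k) = trans (cong (a ℕ.* b ℕ.*_) (^-distrib-* a b k))
    (ℕ.[m*n]*[o*p]≡[m*o]*[n*p] a b (a ℕ.^ k) (b ℕ.^ k))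

  module _ (p : ℕ) .{{_ : ℕ.NonZero p}} (a : ℕ) where
    num : ℕ → ℕ
    num k = iroot p (a ℕ.* suc k ℕ.^ p)

    approx : ℕ → ℚ
    approx k = + num k ℚ./ suc k

    cross : ∀ k l → num k ℕ.* suc l ℕ.< suc (num l) ℕ.* suc k
    cross k l = ^-cancel-< p (begin-strict
      (num k ℕ.* suc l) ℕ.^ p
        ≡⟨ ^-distrib-* (num k) (suc l) p ⟩
      num k ℕ.^ p ℕ.* suc l ℕ.^ p
        ≤⟨ ℕ.*-monoˡ-≤ (suc l ℕ.^ p) (iroot-lower p (a ℕ.* suc k ℕ.^ p)) ⟩
      a ℕ.* suc k ℕ.^ p ℕ.* suc l ℕ.^ p
        ≡⟨ trans (ℕ.*-assoc a (suc k ℕ.^ p) (suc l ℕ.^ p))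
             (trans (cong (a ℕ.*_) (ℕ.*-comm (suc k ℕ.^ p) (suc l ℕ.^ p)))
               (sym (ℕ.*-assoc a (suc l ℕ.^ p) (suc k ℕ.^ p)))) ⟩
      a ℕ.* suc l ℕ.^ p ℕ.* suc k ℕ.^ p
        <⟨ ℕ.*-monoˡ-< (suc k ℕ.^ p) {{ℕ.m^n≢0 (suc k) p}} (iroot-upper p (a ℕ.* suc l ℕ.^ p)) ⟩
      suc (num l) ℕ.^ p ℕ.* suc k ℕ.^ p
        ≡⟨ sym (^-distrib-* (suc (num l)) (suc k) p) ⟩
      (suc (num l) ℕ.* suc k) ℕ.^ p ∎)
      where open ℕ.≤-Reasoning

    /-mono-< : ∀ m q k l → m ℕ.* suc l ℕ.< q ℕ.* suc k →
               + m ℚ./ suc k ℚ.< + q ℚ./ suc l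
    /-mono-< m q k l h = ℚ.toℚᵘ-cancel-<
      (ℚᵘ.<-respˡ-≃ (ℚᵘ.≃-sym (ℚ.toℚᵘ-fromℚᵘ (ℚᵘ.mkℚᵘ (+ m) k)))
        (ℚᵘ.<-respʳ-≃ (ℚᵘ.≃-sym (ℚ.toℚᵘ-fromℚᵘ (ℚᵘ.mkℚᵘ (+ q) l)))
          (ℚᵘ.*<* (subst₂ ℤ._<_ (ℤ.pos-* m (suc l)) (ℤ.pos-* q (suc k)) (ℤ.+<+ h)))))

    /-suc : ∀ q l → + suc q ℚ./ suc l ≡ + q ℚ./ suc l ℚ.+ + 1 ℚ./ suc l
    /-suc q l = ℚ.toℚᵘ-injective (begin
      ℚ.toℚᵘ (+ suc q ℚ./ suc l)
        ≈⟨ ℚ.toℚᵘ-fromℚᵘ (ℚᵘ.mkℚᵘ (+ suc q) l) ⟩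
      ℚᵘ.mkℚᵘ (+ suc q) l
        ≈⟨ ℚᵘ.*≡* eq ⟩
      ℚᵘ.mkℚᵘ (+ q) l ℚᵘ.+ ℚᵘ.mkℚᵘ (+ 1) l
        ≈⟨ ℚᵘ.+-cong (ℚᵘ.≃-sym (ℚ.toℚᵘ-fromℚᵘ (ℚᵘ.mkℚᵘ (+ q) l)))
                     (ℚᵘ.≃-sym (ℚ.toℚᵘ-fromℚᵘ (ℚᵘ.mkℚᵘ (+ 1) l))) ⟩
      ℚ.toℚᵘ (+ q ℚ./ suc l) ℚᵘ.+ ℚ.toℚᵘ (+ 1 ℚ./ suc l)
        ≈⟨ ℚᵘ.≃-sym (ℚ.toℚᵘ-homo-+ (+ q ℚ./ suc l) (+ 1 ℚ./ suc l)) ⟩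
      ℚ.toℚᵘ (+ q ℚ./ suc l ℚ.+ + 1 ℚ./ suc l) ∎)
      where
      open ℚᵘ.≃-Reasoning
      d = + suc l
      eq : + suc q ℤ.* + (suc l ℕ.* suc l) ≡ (+ q ℤ.* d ℤ.+ + 1 ℤ.* d) ℤ.* d
      eq = trans (cong (+ suc q ℤ.*_) (ℤ.pos-* (suc l) (suc l)))
        (trans (sym (ℤ.*-assoc (+ suc q) d d))
          (cong (ℤ._* d) (trans (cong (λ z → + z ℤ.* d) (ℕ.+-comm 1 q))
            (ℤ.*-distribʳ-+ d (+ q) (+ 1)))))

    approx-< : ∀ k l → approx k ℚ.- approx l ℚ.< + 1 ℚ./ suc l
    approx-< k l = begin-strict
      approx k ℚ.- approx l
        <⟨ ℚ.+-monoˡ-< (ℚ.- approx l) (/-mono-< (num k) (suc (num l)) k l (cross k l)) ⟩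
      + suc (num l) ℚ./ suc l ℚ.- approx l
        ≡⟨ cong (ℚ._- approx l) (/-suc (num l) l) ⟩
      approx l ℚ.+ + 1 ℚ./ suc l ℚ.- approx l
        ≡⟨ solve 2 (λ x y → x :+ y :- x := y) refl (approx l) (+ 1 ℚ./ suc l) ⟩
      + 1 ℚ./ suc l ∎
      where open ℚ.≤-Reasoning

    small : ∀ ε → 0ℚ ℚ.< ε → ∃[ N ] (∀ n → N ℕ.≤ n → + 1 ℚ./ suc n ℚ.< ε)
    small ε@(mkℚ +[1+ u ] d _) _ = suc d , λ n d<n → subst (+ 1 ℚ./ suc n ℚ.<_)
      (ℚ.fromℚᵘ-toℚᵘ ε) (/-mono-< 1 (suc u) n d (begin-strict
        1 ℕ.* suc d         ≡⟨ ℕ.*-identityˡ (suc d) ⟩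
        suc d               <⟨ ℕ.s≤s d<n ⟩
        suc n               ≤⟨ ℕ.m≤n*m (suc n) (suc u) ⟩
        suc u ℕ.* suc n     ∎))
      where open ℕ.≤-Reasoning
    small (mkℚ (+ 0) _ _) (ℚ.*<* (ℤ.+<+ ()))
    small (mkℚ -[1+ _ ] _ _) (ℚ.*<* ())

    abstract
      approx-cauchy : IsCauchy approx
      approx-cauchy ε 0<ε with small ε 0<ε
      ... | N , h = N , λ m n N≤m N≤n → abs m n N≤m N≤n
        where
        abs : ∀ m n → N ℕ.≤ m → N ℕ.≤ n → ℚ.∣ approx m ℚ.- approx n ∣ ℚ.< ε
        abs m n N≤m N≤n with ℚ.∣p∣≡p∨∣p∣≡-p (approx m ℚ.- approx n)
        ... | inj₁ e = subst (ℚ._< ε) (sym e) (ℚ.<-trans (approx-< m n) (h n N≤n))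
        ... | inj₂ e = subst (ℚ._< ε)
          (trans (solve 2 (λ x y → y :- x := :- (x :- y)) refl (approx m) (approx n)) (sym e))
          (ℚ.<-trans (approx-< n m) (h m N≤m))

-- The real number a ^ (1/p), as the limit of ⌊ (a (k+1)ᵖ) ^ (1/p) ⌋ / (k+1).
nthRoot : ∀ p .{{_ : ℕ.NonZero p}} → ℕ → ℝ
nthRoot p a = mkℝ (approx p a) (approx-cauchy p a)

infix  4 _≃ᶜ_
infixl 6 _+ᶜ_
infixl 7 _*ᶜ_

record ℂ : Set where
  constructor _+i_
  field
    re im : ℝ

open ℂ public

_≃ᶜ_ : ℂ → ℂ → Set
z ≃ᶜ w = (re z ≃ᴿ re w) × (im z ≃ᴿ im w)

0ᶜ 1ᶜ : ℂ
0ᶜ = 0ᴿ +i 0ᴿ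
1ᶜ = 1ᴿ +i 0ᴿ

_+ᶜ_ : ℂ → ℂ → ℂ
z +ᶜ w = (re z +ᴿ re w) +i (im z +ᴿ im w)

_*ᶜ_ : ℂ → ℂ → ℂ
z *ᶜ w = (re z *ᴿ re w +ᴿ -ᴿ (im z *ᴿ im w)) +i (re z *ᴿ im w +ᴿ im z *ᴿ re w)

conj : ℂ → ℂ
conj z = re z +i (-ᴿ im z)

∣_∣² : ℂ → ℝ
∣ z ∣² = re z *ᴿ re z +ᴿ im z *ᴿ im z

+ᴿ-rawMonoid : RawMonoid 0ℓ 0ℓ
+ᴿ-rawMonoid = record { Carrier = ℝ ; _≈_ = _≃ᴿ_ ; _∙_ = _+ᴿ_ ; ε = 0ᴿ }

+ᶜ-rawMonoid : RawMonoid 0ℓ 0ℓ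
+ᶜ-rawMonoid = record { Carrier = ℂ ; _≈_ = _≃ᶜ_ ; _∙_ = _+ᶜ_ ; ε = 0ᶜ }

-- Labels (i , b , w) of the computational basis: query index, answer
-- qubit, and a workspace of arbitrary dimension W.
Basis : ℕ → ℕ → Set
Basis N W = Fin N × Bool × Fin W

module _ {N W : ℕ} where

  sumOver : (M : RawMonoid 0ℓ 0ℓ) → (Basis N W → RawMonoid.Carrier M) → RawMonoid.Carrier M
  sumOver M f = sum λ i → sum (λ w → f (i , false , w)) ∙ sum (λ w → f (i , true , w))
    where
    open RawMonoid M using (_∙_)
    open RawMonoidSum M using (sum)

  State : Set
  State = Basis N W → ℂ

  Matrix : Set
  Matrix = Basis N W → Basis N W → ℂ

  ket : Basis N W → State
  ket s t = if does (≡-dec Fin._≟_ (≡-dec Bool._≟_ Fin._≟_) s t) then 1ᶜ else 0ᶜ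

  identity : Matrix
  identity = ket

  _†  : Matrix → Matrix
  (U †) s t = conj (U t s)

  _·_ : Matrix → Matrix → Matrix
  (U · V) s t = sumOver +ᶜ-rawMonoid λ r → U s r *ᶜ V r t

  _$$_ : Matrix → State → State
  (U $$ ψ) s = sumOver +ᶜ-rawMonoid λ r → U s r *ᶜ ψ r

  IsUnitary : Matrix → Set
  IsUnitary U = (∀ s t → ((U †) · U) s t ≃ᶜ identity s t)
              × (∀ s t → (U · (U †)) s t ≃ᶜ identity s t)

  -- Linear extension of ∣ i , b , w ⟩ ↦ ∣ i , b ⊕ xᵢ , w ⟩; the amplitude
  -- of a label is read off at its preimage, and the map is an involution.
  oracle : (Fin N → Bool) → State → State
  oracle x ψ (i , b , w) = ψ (i , b xor x i , w)

  Unitary : Set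
  Unitary = Σ[ U ∈ Matrix ] IsUnitary U

  run : ∀ {T} → (Fin N → Bool) → Vec Unitary T → State → State
  run x []             ψ = ψ
  run x ((U , _) ∷ Us) ψ = run x Us (U $$ oracle x ψ)

  -- The probability that the label observed in ψ is mapped to a.
  outputProb : (Basis N W → Bool) → State → Bool → ℝ
  outputProb out ψ a = sumOver +ᴿ-rawMonoid λ s →
    if does (out s Bool.≟ a) then ∣ ψ s ∣² else 0ᴿ

-- Start in a basis state, apply U₀, then T times a query followed by an
-- input-independent unitary; finally measure and output a bit
-- determined by the observed label.
record Algorithm (N T : ℕ) : Set where
  field
    W      : ℕ
    start  : Basis N W
    U₀     : Unitary {N} {W}
    Us     : Vec (Unitary {N} {W}) T
    output : Basis N W → Bool

  final : (Fin N → Bool) → State {N} {W}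
  final x = run {N} {W} x Us (_$$_ {N} {W} (proj₁ U₀) (ket {N} {W} start))

  prob : (Fin N → Bool) → Bool → ℝ
  prob x a = outputProb {N} {W} output (final x) a

ComputesBoundedError : ∀ {N T} → Algorithm N T → ((Fin N → Bool) → Bool) → Set
ComputesBoundedError A f = ∀ x → fromℚ (+ 2 ℚ./ 3) ≤ᴿ Algorithm.prob A x (f x)

infix 4 _≤Q_

-- r ≤Q f says r ≤ Q(f). Q(f) is the least number of queries of an
-- algorithm computing f, so this holds iff r bounds all such numbers.
_≤Q_ : ∀ {N} → ℝ → ((Fin N → Bool) → Bool) → Set
r ≤Q f = ∀ T (A : Algorithm _ T) → ComputesBoundedError A f → r ≤ᴿ fromℕ T

KSubset : ℕ → ℕ → Set
KSubset n k = Σ[ e ∈ Subset n ] ∣ e ∣ ≡ k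

KSubset-≡ : ∀ {n k} {e e′ : KSubset n k} → proj₁ e ≡ proj₁ e′ → e ≡ e′
KSubset-≡ p = Σ-≡,≡→≡ (p , ℕ.≡-irrelevant _ _)

private
  Fin-≡ : ∀ {m n} → m ≡ n → Fin m ↔ Fin n
  Fin-≡ eq = mk↔ₛ′ (subst Fin eq) (subst Fin (sym eq))
    (λ _ → subst-subst-sym eq) (λ _ → subst-sym-subst eq)

  empty : ∀ n → KSubset n 0 ↔ Fin 1
  empty n = mk↔ₛ′ (λ _ → Fin.zero) (λ _ → none n) (λ { Fin.zero → refl ; (Fin.suc ()) }) (λ e → KSubset-≡ (uniq e))
    where
    none : ∀ n → KSubset n 0
    none zero    = [] , refl
    none (suc n) = false ∷ proj₁ (none n) , proj₂ (none n)
    uniq : ∀ {n} (e : KSubset n 0) → proj₁ (none n) ≡ proj₁ e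
    uniq ([] , _)        = refl
    uniq (false ∷ e , p) = cong (false ∷_) (uniq (e , p))

  split : ∀ n k → KSubset (suc n) (suc k) ↔ (KSubset n k ⊎ KSubset n (suc k))
  split n k = mk↔ₛ′ to from to∘from from∘to
    where
    to : KSubset (suc n) (suc k) → KSubset n k ⊎ KSubset n (suc k)
    to (true  ∷ e , p) = inj₁ (e , ℕ.suc-injective p)
    to (false ∷ e , p) = inj₂ (e , p)
    from : KSubset n k ⊎ KSubset n (suc k) → KSubset (suc n) (suc k)
    from (inj₁ (e , p)) = true  ∷ e , cong suc p
    from (inj₂ (e , p)) = false ∷ e , p
    to∘from : ∀ s → to (from s) ≡ s
    to∘from (inj₁ _) = cong inj₁ (KSubset-≡ refl)
    to∘from (inj₂ _) = refl
    from∘to : ∀ e → from (to e) ≡ e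
    from∘to (true  ∷ _ , _) = KSubset-≡ refl
    from∘to (false ∷ _ , _) = refl

index : ∀ n k → KSubset n k ↔ Fin (n C k)
index n       zero    = empty n
index zero    (suc k) = mk↔ₛ′ (λ { ([] , ()) }) (λ ()) (λ ()) (λ { ([] , ()) })
index (suc n) (suc k) =
  Fin-≡ (nCk+nC[k+1]≡[n+1]C[k+1] n k) ↔-∘
  (↔-sym Fin.+↔⊎ ↔-∘ ((index n k ⊎-↔ index n (suc k)) ↔-∘ split n k))

private
  χ : Bool → ℕ
  χ b = if b then 1 else 0

  open CommutativeMonoidSum ℕ.+-0-commutativeMonoid using (sum; sum-permute)

  ∣tabulate∣ : ∀ {n} (g : Fin n → Bool) → ∣ tabulate g ∣ ≡ sum (χ ∘ g)
  ∣tabulate∣ {zero}  g = refl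
  ∣tabulate∣ {suc n} g with g Fin.zero
  ... | true  = cong suc (∣tabulate∣ (g ∘ Fin.suc))
  ... | false = ∣tabulate∣ (g ∘ Fin.suc)

  ∣lookup∣ : ∀ {n} (e : Subset n) → ∣ e ∣ ≡ sum (χ ∘ lookup e)
  ∣lookup∣ []          = refl
  ∣lookup∣ (true  ∷ e) = cong suc (∣lookup∣ e)
  ∣lookup∣ (false ∷ e) = ∣lookup∣ e

-- The image { π v | v ∈ e }, given by v ∈ π ⟪ e ⟫ iff π⁻¹ v ∈ e.
_⟪_⟫ : ∀ {n k} → Permutation′ n → KSubset n k → KSubset n k
π ⟪ e , ∣e∣≡k ⟫ = tabulate (λ v → lookup e (π ⟨$⟩ˡ v)) ,
  trans (∣tabulate∣ (λ v → lookup e (π ⟨$⟩ˡ v)))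
    (trans (sym (sum-permute (χ ∘ lookup e) (flip π))) (trans (sym (∣lookup∣ e)) ∣e∣≡k))

Hypergraph : ℕ → Set
Hypergraph n = KSubset n 3 → Bool

HasHyperedge : ∀ {n} → Hypergraph n → Set
HasHyperedge H = ∃[ e ] H e ≡ true

infix 4 _⊑_

_⊑_ : ∀ {n} → Hypergraph n → Hypergraph n → Set
_⊑_ {n} H G = ∃[ π ] (∀ e → H e ≡ true → G (π ⟪ e ⟫) ≡ true)

private
  any-vec? : ∀ {n} m {P : Vec (Fin n) m → Set} → (∀ v → Dec (P v)) → Dec (∃ P)
  any-vec? zero    P? = map′ ([] ,_) (λ { ([] , p) → p }) (P? [])
  any-vec? (suc m) P? = map′ (λ { (i , v , p) → i ∷ v , p }) (λ { (i ∷ v , p) → i , v , p })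
    (Fin.any? λ i → any-vec? m λ v → P? (i ∷ v))

  Inverses : ∀ {n} → Vec (Fin n) n → Vec (Fin n) n → Set
  Inverses v w = (∀ i → lookup v (lookup w i) ≡ i) × (∀ i → lookup w (lookup v i) ≡ i)

  inverses? : ∀ {n} (v w : Vec (Fin n) n) → Dec (Inverses v w)
  inverses? v w = Fin.all? (λ i → lookup v (lookup w i) Fin.≟ i)
            ×-dec Fin.all? (λ i → lookup w (lookup v i) Fin.≟ i)

  fromVecs : ∀ {n} (v w : Vec (Fin n) n) → Inverses v w → Permutation′ n
  fromVecs v w (p , q) = permutation (lookup v) (lookup w) p q

  all-edges? : ∀ {n} {P : KSubset n 3 → Set} → (∀ e → Dec (P e)) → Dec (∀ e → P e)
  all-edges? {n} {P} P? = map′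
    (λ h e → subst P (Inverse.strictlyInverseʳ (index n 3) e) (h (Inverse.to (index n 3) e)))
    (λ h i → h (Inverse.from (index n 3) i))
    (Fin.all? λ i → P? (Inverse.from (index n 3) i))

  ⟪⟫-cong : ∀ {n k} (π ρ : Permutation′ n) → (∀ v → π ⟨$⟩ˡ v ≡ ρ ⟨$⟩ˡ v) →
            (e : KSubset n k) → π ⟪ e ⟫ ≡ ρ ⟪ e ⟫
  ⟪⟫-cong π ρ h (e , _) = KSubset-≡ (tabulate-cong (λ v → cong (lookup e) (h v)))

  perm? : ∀ {n} {P : Permutation′ n → Set} →
          (∀ {π ρ} → (∀ v → π ⟨$⟩ˡ v ≡ ρ ⟨$⟩ˡ v) → P π → P ρ) →
          (∀ π → Dec (P π)) → Dec (∃ P)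
  perm? {n} {P} resp P? = map′
    (λ { (v , w , i , p) → fromVecs v w i , p })
    (λ { (π , p) →
      let v = tabulate (π ⟨$⟩ʳ_)
          w = tabulate (π ⟨$⟩ˡ_)
          lv = lookup∘tabulate (π ⟨$⟩ʳ_)
          lw = lookup∘tabulate (π ⟨$⟩ˡ_)
      in v , w ,
         ( (λ i → trans (lv (lookup w i)) (trans (cong (π ⟨$⟩ʳ_) (lw i)) (inverseʳ π)))
         , (λ i → trans (lw (lookup v i)) (trans (cong (π ⟨$⟩ˡ_) (lv i)) (inverseˡ π))))
         , resp {π} (λ i → sym (lw i)) p })
    (any-vec? n λ v → any-vec? n λ w → search v w)
    where
    search : ∀ v w → Dec (Σ[ i ∈ Inverses v w ] P (fromVecs v w i))
    search v w with inverses? v w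
    ... | no ¬i = no (¬i ∘ proj₁)
    ... | yes i = map′ (i ,_) (λ { (_ , p) → resp (λ _ → refl) p }) (P? (fromVecs v w i))

_⊑?_ : ∀ {n} (H G : Hypergraph n) → Dec (H ⊑ G)
H ⊑? G = perm?
  (λ {π} {ρ} π≗ρ h e He → subst (λ e′ → G e′ ≡ true) (⟪⟫-cong π ρ π≗ρ e) (h e He))
  (λ π → all-edges? λ e → (H e Bool.≟ true) →-dec (G (π ⟪ e ⟫) Bool.≟ true))

decode : ∀ {n} → (Fin (n C 3) → Bool) → Hypergraph n
decode {n} x e = x (Inverse.to (index n 3) e)

f : ∀ {n} → Hypergraph n → (Fin (n C 3) → Bool) → Bool
f H x = ⌊ H ⊑? decode x ⌋

{-# OPTIONS --safe #-}

module Submission where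

-- By the hybrid argument, T queries leave every input with at most M = O(T²) sensitive bits. Let α be the
-- last m for which the complement of the complete hypergraph on the first m vertices contains H. Shrinking
-- that hypergraph for m = α to a minimal x that contains H, and enlarging the one for m = α + 1 to a maximal
-- y that does not, makes all hyperedges of x and all non-hyperedges of y sensitive, so there are at most M of
-- each, and the non-hyperedges lie within the first α + 1 vertices. If M is of smaller order than n^(8/5),
-- some permutation maps no non-hyperedge of y to a hyperedge of x, whence y contains x and therefore H, a
-- contradiction: the few vertices of high degree are placed first, at vertices of low degree in x, and the
-- rest by Rosenfeld's counting argument. Hence n^(8/5) = O(M) = O(T²).

open import Defs
open import Data.Nat.Base using (ℕ; _≤_; _^_)
open import Data.Product.Base using (∃-syntax; _×_)

open import Algebra.Bundles using (CommutativeRing)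
import Algebra.Properties.Semiring.Sum as SemiringSum
open import Data.Bool.Base using (Bool; true; false; not; _∧_; _∨_; _xor_; if_then_else_)
open import Data.Fin.Base using (Fin; zero; suc; toℕ; fromℕ<)
import Data.Fin.Properties as Fin
open import Data.Nat.Base as ℕ using (suc)
open import Data.Product.Base using (∃; _,_; proj₁; proj₂)
open import Function.Base using (_∘_)
open import Level using (0ℓ)
open import Relation.Binary.PropositionalEquality as ≡ using (_≡_; _≢_; cong; cong₂; subst; subst₂)

-- Rosenfeld's argument guarantees each vertex g of the n positions, where g is below n/3, and
-- pairwise penalties at a vertex may total at most g². Injectivity is itself a pairwise penalty, of
-- total |J| n for a vertex set J, so only about n/9 vertices can be embedded in this way. This
-- forces two cases. If α is small, all the first α + 1 vertices are embedded. If α is large, one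
-- vertex p among them is sent to vertex α and the other α into the first α vertices. Every
-- hyperedge of x leaves the first α vertices, so a non-hyperedge of y that avoids p does no harm:
-- only the link of p must avoid the link of vertex α, and p is chosen of low degree, with few
-- neighbours. A vertex of high degree may violate the bounds on penalties, which is why it is
-- placed beforehand. High-degree vertices go to positions no two of which share a hyperedge of x,
-- so a conflict involves at most one of them and becomes a penalty on fewer vertices. Their
-- positions also have low degree in x, so that these new penalties stay small.

-- Sums over the computational basis in a commutative ring.

module BasisSum (R : CommutativeRing 0ℓ 0ℓ) {N W : ℕ} where
  open CommutativeRing R hiding (zero) renaming (Carrier to C)
  open SemiringSum semiring
  open import Relation.Binary.Reasoning.Setoid setoid

  sum-δ : ∀ {n} (h : Fin n → C) i → (∀ j → j ≢ i → h j ≈ 0#) → sum h ≈ h i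
  sum-δ {suc n} h zero h≈0 = begin
    h zero + sum (h ∘ suc)        ≈⟨ +-congˡ (sum-cong-≋ λ j → h≈0 (suc j) λ ()) ⟩
    h zero + sum {n} (λ _ → 0#)   ≈⟨ +-congˡ (sum-replicate-zero n) ⟩
    h zero + 0#                   ≈⟨ +-identityʳ (h zero) ⟩
    h zero                        ∎
  sum-δ {suc n} h (suc i) h≈0 = begin
    h zero + sum (h ∘ suc)  ≈⟨ +-cong (h≈0 zero λ ()) (sum-δ (h ∘ suc) i λ j j≢i → h≈0 (suc j) (j≢i ∘ Fin.suc-injective)) ⟩
    0# + h (suc i)          ≈⟨ +-identityˡ (h (suc i)) ⟩
    h (suc i)               ∎

  +-interchange : ∀ a b c d → (a + b) + (c + d) ≈ (a + c) + (b + d)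
  +-interchange a b c d = begin
    (a + b) + (c + d)  ≈⟨ +-assoc a b (c + d) ⟩
    a + (b + (c + d))  ≈⟨ +-congˡ (sym (+-assoc b c d)) ⟩
    a + ((b + c) + d)  ≈⟨ +-congˡ (+-congʳ (+-comm b c)) ⟩
    a + ((c + b) + d)  ≈⟨ +-congˡ (+-assoc c b d) ⟩
    a + (c + (b + d))  ≈⟨ sym (+-assoc a c (b + d)) ⟩
    (a + c) + (b + d)  ∎

  opaque
    -- The part of a basis sum with query index `i`. Oracles of inputs that differ only at `i` act
    -- differently only on this part, so the hybrid argument is carried out block by block.
    block : Fin N → (Basis N W → C) → C
    block i f = sum (λ w → f (i , false , w)) + sum (λ w → f (i , true , w))

    Σᴮ : (Basis N W → C) → C
    Σᴮ f = sum λ i → block i f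

    Σᴮ-unfold : ∀ f → Σᴮ f ≡ sum (λ i → sum (λ w → f (i , false , w)) + sum (λ w → f (i , true , w)))
    Σᴮ-unfold f = ≡.refl

    block-unfold : ∀ i f → block i f ≡ sum (λ w → f (i , false , w)) + sum (λ w → f (i , true , w))
    block-unfold i f = ≡.refl

    Σᴮ-blocks : ∀ f → Σᴮ f ≡ sum (λ i → block i f)
    Σᴮ-blocks f = ≡.refl

    block-cong : ∀ i f g → (∀ b w → f (i , b , w) ≈ g (i , b , w)) → block i f ≈ block i g
    block-cong i f g f≈g = +-cong (sum-cong-≋ (f≈g false)) (sum-cong-≋ (f≈g true))

    Σ-cong : ∀ {f g} → (∀ s → f s ≈ g s) → Σᴮ f ≈ Σᴮ g
    Σ-cong {f} {g} f≈g = sum-cong-≋ λ i → block-cong i f g λ b w → f≈g (i , b , w)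

    block-+ : ∀ i f g → block i (λ s → f s + g s) ≈ block i f + block i g
    block-+ i f g = trans
      (+-cong (∑-distrib-+ (λ w → f (i , false , w)) (λ w → g (i , false , w)))
              (∑-distrib-+ (λ w → f (i , true , w)) (λ w → g (i , true , w))))
      (+-interchange _ _ _ _)

    block-*ˡ : ∀ i x f → x * block i f ≈ block i (λ s → x * f s)
    block-*ˡ i x f = trans (distribˡ x _ _)
      (+-cong (*-distribˡ-sum x (λ w → f (i , false , w))) (*-distribˡ-sum x (λ w → f (i , true , w))))

    Σ-*ˡ : ∀ x f → x * Σᴮ f ≈ Σᴮ (λ s → x * f s)
    Σ-*ˡ x f = trans (*-distribˡ-sum x (λ i → block i f)) (sum-cong-≋ λ i → block-*ˡ i x f)

    Σ-*ʳ : ∀ x f → Σᴮ f * x ≈ Σᴮ (λ s → f s * x)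
    Σ-*ʳ x f = trans (*-comm _ x) (trans (Σ-*ˡ x f) (Σ-cong λ s → *-comm x (f s)))

    Σ-+ : ∀ f g → Σᴮ (λ s → f s + g s) ≈ Σᴮ f + Σᴮ g
    Σ-+ f g = trans (sum-cong-≋ λ i → block-+ i f g) (∑-distrib-+ (λ i → block i f) (λ i → block i g))

    Σ-sum : ∀ {n} (F : Basis N W → Fin n → C) → Σᴮ (λ s → sum (F s)) ≈ sum (λ j → Σᴮ (λ s → F s j))
    Σ-sum F = trans
      (sum-cong-≋ λ i → trans
        (+-cong (∑-comm (λ w → F (i , false , w))) (∑-comm (λ w → F (i , true , w))))
        (sym (∑-distrib-+ (λ j → sum (λ w → F (i , false , w) j)) (λ j → sum (λ w → F (i , true , w) j)))))
      (∑-comm (λ i j → block i (λ s → F s j)))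

    Σ-comm : ∀ (F : Basis N W → Basis N W → C) → Σᴮ (λ s → Σᴮ (F s)) ≈ Σᴮ (λ t → Σᴮ (λ s → F s t))
    Σ-comm F = trans (Σ-sum (λ s i → block i (F s))) (sum-cong-≋ λ i →
      trans (Σ-+ (λ s → sum (λ w → F s (i , false , w))) (λ s → sum (λ w → F s (i , true , w))))
            (+-cong (Σ-sum (λ s w → F s (i , false , w))) (Σ-sum (λ s w → F s (i , true , w)))))

    Σ-δ : ∀ h s → (∀ t → t ≢ s → h t ≈ 0#) → Σᴮ h ≈ h s
    Σ-δ h (i , b , w) h≈0 = trans (sum-δ (λ j → block j h) i block≈0) (onBit b h≈0)
      where
      sum≈0 : (g : Fin W → C) → (∀ w → g w ≈ 0#) → sum g ≈ 0#
      sum≈0 g g≈0 = trans (sum-cong-≋ g≈0) (sum-replicate-zero W)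
      block≈0 : ∀ j → j ≢ i → block j h ≈ 0#
      block≈0 j j≢i = trans
        (+-cong (sum≈0 (λ v → h (j , false , v)) λ v → h≈0 _ (j≢i ∘ cong proj₁))
                (sum≈0 (λ v → h (j , true , v)) λ v → h≈0 _ (j≢i ∘ cong proj₁)))
        (+-identityˡ 0#)
      onBit : ∀ b → (∀ t → t ≢ (i , b , w) → h t ≈ 0#) → block i h ≈ h (i , b , w)
      onBit false h≈0 = trans
        (+-cong (sum-δ (λ w → h (i , false , w)) w λ v v≢w → h≈0 _ (v≢w ∘ cong (proj₂ ∘ proj₂)))
                (sum≈0 (λ v → h (i , true , v)) λ v → h≈0 _ λ ()))
        (+-identityʳ _)
      onBit true h≈0 = trans
        (+-cong (sum≈0 (λ v → h (i , false , v)) λ v → h≈0 _ λ ())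
                (sum-δ (λ w → h (i , true , w)) w λ v v≢w → h≈0 _ (v≢w ∘ cong (proj₂ ∘ proj₂))))
        (+-identityˡ _)

    -- A query shifts the answer bit by a constant within a block: it either fixes or exchanges the
    -- two halves of the sum.
    block-xor : ∀ i b (f : Basis N W → C) →
      sum (λ w → f (i , false xor b , w)) + sum (λ w → f (i , true xor b , w)) ≈ block i f
    block-xor i false f = refl
    block-xor i true  f = +-comm _ _

  module Involution (conj : C → C)
    (conj-cong : ∀ {x y} → x ≈ y → conj x ≈ conj y)
    (conj-0 : conj 0# ≈ 0#)
    (conj-+ : ∀ x y → conj (x + y) ≈ conj x + conj y)
    (conj-* : ∀ x y → conj (x * y) ≈ conj x * conj y) where

    conj-sum : ∀ {n} (f : Fin n → C) → conj (sum f) ≈ sum (conj ∘ f)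
    conj-sum {ℕ.zero}  f = conj-0
    conj-sum {suc n} f = trans (conj-+ (f zero) _) (+-congˡ (conj-sum (f ∘ suc)))

    opaque
      unfolding Σᴮ
      conj-Σ : ∀ f → conj (Σᴮ f) ≈ Σᴮ (conj ∘ f)
      conj-Σ f = trans (conj-sum (λ i → block i f)) (sum-cong-≋ λ i →
        trans (conj-+ _ _) (+-cong (conj-sum (λ w → f (i , false , w))) (conj-sum (λ w → f (i , true , w)))))

    ⟨_∣_⟩ : (ψ φ : Basis N W → C) → C
    ⟨ ψ ∣ φ ⟩ = Σᴮ λ s → conj (ψ s) * φ s

    -- Once both factors are expanded and the sum over `s` is moved inside, the coefficient of
    -- `conj (ψ r) * φ t` is the entry (r, t) of U†U. The identity matrix `I` enters only through
    -- its action on vectors.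
    ⟨⟩-isometry : ∀ (U I : Basis N W → Basis N W → C) →
      (∀ s t → Σᴮ (λ r → conj (U r s) * U r t) ≈ I s t) →
      (∀ s (g : Basis N W → C) → Σᴮ (λ t → I s t * g t) ≈ g s) →
      ∀ ψ φ → ⟨ (λ s → Σᴮ λ r → U s r * ψ r) ∣ (λ s → Σᴮ λ r → U s r * φ r) ⟩ ≈ ⟨ ψ ∣ φ ⟩
    ⟨⟩-isometry U I U†U Ig ψ φ = begin
      Σᴮ (λ s → conj (Σᴮ λ r → U s r * ψ r) * Σᴮ (λ t → U s t * φ t))
        ≈⟨ Σ-cong (λ s → *-congʳ (trans (conj-Σ _) (Σ-cong λ r → conj-* (U s r) (ψ r)))) ⟩
      Σᴮ (λ s → Σᴮ (λ r → conj (U s r) * conj (ψ r)) * Σᴮ (λ t → U s t * φ t))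
        ≈⟨ Σ-cong (λ s → trans (Σ-*ʳ _ _) (Σ-cong λ r → Σ-*ˡ _ _)) ⟩
      Σᴮ (λ s → Σᴮ λ r → Σᴮ λ t → conj (U s r) * conj (ψ r) * (U s t * φ t))
        ≈⟨ Σ-comm _ ⟩
      Σᴮ (λ r → Σᴮ λ s → Σᴮ λ t → conj (U s r) * conj (ψ r) * (U s t * φ t))
        ≈⟨ Σ-cong (λ r → Σ-comm _) ⟩
      Σᴮ (λ r → Σᴮ λ t → Σᴮ λ s → conj (U s r) * conj (ψ r) * (U s t * φ t))
        ≈⟨ Σ-cong (λ r → Σ-cong λ t → Σ-cong λ s → rearrange (conj (U s r)) (conj (ψ r)) (U s t) (φ t)) ⟩
      Σᴮ (λ r → Σᴮ λ t → Σᴮ λ s → conj (ψ r) * (conj (U s r) * U s t * φ t))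
        ≈⟨ Σ-cong (λ r → Σ-cong λ t → sym (Σ-*ˡ _ _)) ⟩
      Σᴮ (λ r → Σᴮ λ t → conj (ψ r) * Σᴮ λ s → conj (U s r) * U s t * φ t)
        ≈⟨ Σ-cong (λ r → Σ-cong λ t → *-congˡ (sym (Σ-*ʳ _ _))) ⟩
      Σᴮ (λ r → Σᴮ λ t → conj (ψ r) * (Σᴮ (λ s → conj (U s r) * U s t) * φ t))
        ≈⟨ Σ-cong (λ r → Σ-cong λ t → *-congˡ (*-congʳ (U†U r t))) ⟩
      Σᴮ (λ r → Σᴮ λ t → conj (ψ r) * (I r t * φ t))
        ≈⟨ Σ-cong (λ r → sym (Σ-*ˡ _ _)) ⟩
      Σᴮ (λ r → conj (ψ r) * Σᴮ λ t → I r t * φ t)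
        ≈⟨ Σ-cong (λ r → *-congˡ (Ig r φ)) ⟩
      ⟨ ψ ∣ φ ⟩ ∎
      where
      rearrange : ∀ a b c d → a * b * (c * d) ≈ b * (a * c * d)
      rearrange a b c d = begin
        a * b * (c * d)     ≈⟨ *-congʳ (*-comm a b) ⟩
        b * a * (c * d)     ≈⟨ *-assoc b a (c * d) ⟩
        b * (a * (c * d))   ≈⟨ *-congˡ (sym (*-assoc a c d)) ⟩
        b * (a * c * d)     ∎

import Data.Bool.Properties as Bool
open import Data.Empty using (⊥)
open import Data.Fin.Permutation using (Permutation′; flip; _⟨$⟩ʳ_; _⟨$⟩ˡ_; inverseˡ; inverseʳ; _∘ₚ_)
import Data.Fin.Permutation as Perm
import Data.Fin.Permutation.Components as PC
open import Data.Fin.Subset using (∣_∣)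
import Data.Integer.Base as ℤ
import Data.Integer.Properties as ℤ
open import Data.Nat.Base using (zero; _+_; _*_; _<_; z≤n; s≤s)
open import Data.Nat.DivMod using (_/_; _%_; m≡m%n+[m/n]*n; m%n<n)
import Data.Nat.Properties as ℕ
open import Data.Nat.Tactic.RingSolver using (solve-∀)
open import Data.Product.Properties using (≡-dec)
open import Data.Rational.Base as ℚ using (ℚ; 0ℚ; 1ℚ; ½)
import Data.Rational.Properties as ℚ
open import Data.Rational.Solver using (module +-*-Solver)
import Data.Rational.Unnormalised.Base as ℚᵘ
import Data.Rational.Unnormalised.Properties as ℚᵘ
open import Data.Sum.Base using (_⊎_; inj₁; inj₂)
open import Data.Unit.Base using (tt)
open import Data.Vec.Base using (Vec; []; _∷_; lookup; _[_]≔_)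
open import Data.Vec.Properties using (lookup∘tabulate; lookup∘updateAt′; tabulate-cong)
open import Function.Bundles using (Equivalence; Inverse)
open import Relation.Binary.Bundles using (Preorder)
import Relation.Binary.Reasoning.Preorder
import Relation.Binary.Reasoning.Setoid
open import Relation.Binary.PropositionalEquality using (refl; sym; trans)
open import Relation.Nullary using (Dec; yes; no; contradiction; does; ¬_)
open import Relation.Nullary.Decidable using (_×-dec_; _→-dec_; ¬?; dec-true; dec-false; isYes≗does)

-- Cauchy reals as an ordered commutative ring, and the complex numbers over them.

module Reals where

  open +-*-Solver using (solve; _:+_; _:*_; _:-_; :-_; _:=_; con)

  -- `x ≃ᴿ y` unfolds to this property of the difference. Congruence of the ring operations is then
  -- the fact that null sequences form an ideal among the Cauchy sequences.
  Null : (ℕ → ℚ) → Set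
  Null u = ∀ ε → 0ℚ ℚ.< ε → ∃[ N ] (∀ n → N ℕ.≤ n → ℚ.∣ u n ∣ ℚ.< ε)

  *-pos : ∀ {p q} → 0ℚ ℚ.< p → 0ℚ ℚ.< q → 0ℚ ℚ.< p ℚ.* q
  *-pos {p} {q} 0<p 0<q =
    subst (ℚ._< p ℚ.* q) (ℚ.*-zeroˡ q) (ℚ.*-monoˡ-<-pos q {{ℚ.positive 0<q}} 0<p)

  ½-pos : ∀ {ε} → 0ℚ ℚ.< ε → 0ℚ ℚ.< ε ℚ.* ½
  ½-pos 0<ε = *-pos 0<ε (ℚ.positive⁻¹ ½)

  ½+½ : ∀ ε → ε ℚ.* ½ ℚ.+ ε ℚ.* ½ ≡ ε
  ½+½ ε = trans (sym (ℚ.*-distribˡ-+ ε ½ ½)) (ℚ.*-identityʳ ε)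

  reciprocal : ∀ {s} → 0ℚ ℚ.< s → ∃[ r ] (0ℚ ℚ.< r × s ℚ.* r ≡ 1ℚ)
  reciprocal {s} 0<s = ℚ.1/ s , ℚ.positive⁻¹ (ℚ.1/ s) {{ℚ.1/pos⇒pos s}} , ℚ.*-inverseʳ s
    where
    instance
      s-pos : ℚ.Positive s
      s-pos = ℚ.positive 0<s
      s-nonZero : ℚ.NonZero s
      s-nonZero = ℚ.pos⇒nonZero s

  scale-cancel : ∀ s r → s ℚ.* r ≡ 1ℚ → ∀ ε → s ℚ.* (r ℚ.* ε) ≡ ε
  scale-cancel s r sr≡1 ε =
    trans (sym (ℚ.*-assoc s r ε)) (trans (cong (ℚ._* ε) sr≡1) (ℚ.*-identityˡ ε))

  null-resp : ∀ {u v} → (∀ n → u n ≡ v n) → Null u → Null v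
  null-resp u≗v nu ε 0<ε with nu ε 0<ε
  ... | N , h = N , λ n p → subst (λ q → ℚ.∣ q ∣ ℚ.< ε) (u≗v n) (h n p)

  null-0 : Null (λ _ → 0ℚ)
  null-0 ε 0<ε = 0 , λ _ _ → 0<ε

  null-neg : ∀ {u} → Null u → Null (λ n → ℚ.- u n)
  null-neg {u} nu ε 0<ε with nu ε 0<ε
  ... | N , h = N , λ n p → subst (ℚ._< ε) (sym (ℚ.∣-p∣≡∣p∣ (u n))) (h n p)

  null-+ : ∀ {u v} → Null u → Null v → Null (λ n → u n ℚ.+ v n)
  null-+ {u} {v} nu nv ε 0<ε with nu (ε ℚ.* ½) (½-pos 0<ε) | nv (ε ℚ.* ½) (½-pos 0<ε)
  ... | M , g | N , h = M ℕ.⊔ N , λ n p → begin-strict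
    ℚ.∣ u n ℚ.+ v n ∣            ≤⟨ ℚ.∣p+q∣≤∣p∣+∣q∣ (u n) (v n) ⟩
    ℚ.∣ u n ∣ ℚ.+ ℚ.∣ v n ∣      <⟨ ℚ.+-mono-< (g n (ℕ.m⊔n≤o⇒m≤o M N p)) (h n (ℕ.m⊔n≤o⇒n≤o M N p)) ⟩
    ε ℚ.* ½ ℚ.+ ε ℚ.* ½          ≡⟨ ½+½ ε ⟩
    ε                            ∎
    where open ℚ.≤-Reasoning

  -- Cauchy sequences are eventually bounded, which is all that a product needs.
  eventually-bounded : ∀ x → ∃[ B ] (0ℚ ℚ.< B × ∃[ N ] (∀ n → N ℕ.≤ n → ℚ.∣ seq x n ∣ ℚ.≤ B))
  eventually-bounded x with cauchy x 1ℚ (ℚ.positive⁻¹ 1ℚ)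
  ... | N , h = ℚ.∣ seq x N ∣ ℚ.+ 1ℚ , ℚ.+-mono-≤-< (ℚ.0≤∣p∣ (seq x N)) (ℚ.positive⁻¹ 1ℚ) , N , λ n p → begin
    ℚ.∣ seq x n ∣
      ≡⟨ cong ℚ.∣_∣ (solve 2 (λ a b → a := b :+ (a :- b)) refl (seq x n) (seq x N)) ⟩
    ℚ.∣ seq x N ℚ.+ (seq x n ℚ.- seq x N) ∣
      ≤⟨ ℚ.∣p+q∣≤∣p∣+∣q∣ (seq x N) (seq x n ℚ.- seq x N) ⟩
    ℚ.∣ seq x N ∣ ℚ.+ ℚ.∣ seq x n ℚ.- seq x N ∣
      ≤⟨ ℚ.+-monoʳ-≤ ℚ.∣ seq x N ∣ (ℚ.<⇒≤ (h n N p ℕ.≤-refl)) ⟩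
    ℚ.∣ seq x N ∣ ℚ.+ 1ℚ ∎
    where open ℚ.≤-Reasoning

  null-* : ∀ x {u} → Null u → Null (λ n → seq x n ℚ.* u n)
  null-* x {u} nu ε 0<ε =
    let B , 0<B , M , b = eventually-bounded x
        r , 0<r , Br≡1  = reciprocal 0<B
        N , h           = nu (r ℚ.* ε) (*-pos 0<r 0<ε)
    in M ℕ.⊔ N , λ n p → begin-strict
      ℚ.∣ seq x n ℚ.* u n ∣
        ≡⟨ ℚ.∣p*q∣≡∣p∣*∣q∣ (seq x n) (u n) ⟩
      ℚ.∣ seq x n ∣ ℚ.* ℚ.∣ u n ∣
        ≤⟨ ℚ.*-monoʳ-≤-nonNeg ℚ.∣ u n ∣ {{ℚ.∣-∣-nonNeg (u n)}} (b n (ℕ.m⊔n≤o⇒m≤o M N p)) ⟩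
      B ℚ.* ℚ.∣ u n ∣
        <⟨ ℚ.*-monoʳ-<-pos B {{ℚ.positive 0<B}} (h n (ℕ.m⊔n≤o⇒n≤o M N p)) ⟩
      B ℚ.* (r ℚ.* ε)
        ≡⟨ scale-cancel B r Br≡1 ε ⟩
      ε ∎
    where open ℚ.≤-Reasoning

  -- Records, unlike the functions _≃ᴿ_ and _≤ᴿ_ that they wrap, let their arguments be inferred.
  infix 4 _≈_ _≲_

  record _≈_ (x y : ℝ) : Set where
    constructor mk≈
    field un≈ : x ≃ᴿ y

  record _≲_ (x y : ℝ) : Set where
    constructor mk≲
    field un≲ : x ≤ᴿ y

  -- The ring laws hold termwise in ℚ, so they follow from this without any choice of modulus.
  ≗⇒≈ : ∀ {x y} → (∀ n → seq x n ≡ seq y n) → x ≈ y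
  ≗⇒≈ {x} {y} h = mk≈ (null-resp (λ n → sym (trans (cong (ℚ._- seq y n) (h n)) (ℚ.+-inverseʳ (seq y n)))) null-0)

  ≈-refl : ∀ {x} → x ≈ x
  ≈-refl = ≗⇒≈ (λ _ → refl)

  ≈-sym : ∀ {x y} → x ≈ y → y ≈ x
  ≈-sym {x} {y} (mk≈ h) = mk≈ (null-resp
    (λ n → solve 2 (λ a b → :- (a :- b) := b :- a) refl (seq x n) (seq y n)) (null-neg h))

  ≈-trans : ∀ {x y z} → x ≈ y → y ≈ z → x ≈ z
  ≈-trans {x} {y} {z} (mk≈ g) (mk≈ h) = mk≈ (null-resp
    (λ n → solve 3 (λ a b c → (a :- b) :+ (b :- c) := a :- c) refl (seq x n) (seq y n) (seq z n)) (null-+ g h))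

  +ᴿ-cong : ∀ {x x′ y y′} → x ≈ x′ → y ≈ y′ → x +ᴿ y ≈ x′ +ᴿ y′
  +ᴿ-cong {x} {x′} {y} {y′} (mk≈ g) (mk≈ h) = mk≈ (null-resp
    (λ n → solve 4 (λ a b c d → (a :- b) :+ (c :- d) := (a :+ c) :- (b :+ d)) refl
      (seq x n) (seq x′ n) (seq y n) (seq y′ n)) (null-+ g h))

  *ᴿ-cong : ∀ {x x′ y y′} → x ≈ x′ → y ≈ y′ → x *ᴿ y ≈ x′ *ᴿ y′
  *ᴿ-cong {x} {x′} {y} {y′} (mk≈ g) (mk≈ h) = mk≈ (null-resp
    (λ n → solve 4 (λ a b c d → d :* (a :- b) :+ a :* (c :- d) := a :* c :- b :* d) refl
      (seq x n) (seq x′ n) (seq y n) (seq y′ n)) (null-+ (null-* y′ g) (null-* x h)))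

  -ᴿ-cong : ∀ {x y} → x ≈ y → -ᴿ x ≈ -ᴿ y
  -ᴿ-cong {x} {y} (mk≈ h) = mk≈ (null-resp
    (λ n → solve 2 (λ a b → :- (a :- b) := (:- a) :- (:- b)) refl (seq x n) (seq y n)) (null-neg h))

  ℝ-commutativeRing : CommutativeRing 0ℓ 0ℓ
  ℝ-commutativeRing = record
    { Carrier = ℝ ; _≈_ = _≈_ ; _+_ = _+ᴿ_ ; _*_ = _*ᴿ_ ; -_ = -ᴿ_ ; 0# = 0ᴿ ; 1# = 1ᴿ
    ; isCommutativeRing = record
      { isRing = record
        { +-isAbelianGroup = record
          { isGroup = record
            { isMonoid = record
              { isSemigroup = record
                { isMagma = record
                  { isEquivalence = record { refl = ≈-refl ; sym = ≈-sym ; trans = ≈-trans }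
                  ; ∙-cong = +ᴿ-cong }
                ; assoc = λ x y z → ≗⇒≈ λ n → ℚ.+-assoc (seq x n) (seq y n) (seq z n) }
              ; identity = (λ x → ≗⇒≈ λ n → ℚ.+-identityˡ (seq x n)) , (λ x → ≗⇒≈ λ n → ℚ.+-identityʳ (seq x n)) }
            ; inverse = (λ x → ≗⇒≈ λ n → ℚ.+-inverseˡ (seq x n)) , (λ x → ≗⇒≈ λ n → ℚ.+-inverseʳ (seq x n))
            ; ⁻¹-cong = -ᴿ-cong }
          ; comm = λ x y → ≗⇒≈ λ n → ℚ.+-comm (seq x n) (seq y n) }
        ; *-cong = *ᴿ-cong
        ; *-assoc = λ x y z → ≗⇒≈ λ n → ℚ.*-assoc (seq x n) (seq y n) (seq z n)
        ; *-identity = (λ x → ≗⇒≈ λ n → ℚ.*-identityˡ (seq x n)) , (λ x → ≗⇒≈ λ n → ℚ.*-identityʳ (seq x n))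
        ; distrib = (λ x y z → ≗⇒≈ λ n → ℚ.*-distribˡ-+ (seq x n) (seq y n) (seq z n))
                  , (λ x y z → ≗⇒≈ λ n → ℚ.*-distribʳ-+ (seq x n) (seq y n) (seq z n)) }
      ; *-comm = λ x y → ≗⇒≈ λ n → ℚ.*-comm (seq x n) (seq y n) } }

  ≗⇒≲ : ∀ {x y} → (∀ n → seq x n ℚ.≤ seq y n) → x ≲ y
  ≗⇒≲ {x} {y} h = mk≲ λ ε 0<ε → 0 , λ n _ → begin
    seq x n             ≤⟨ h n ⟩
    seq y n             ≡⟨ sym (ℚ.+-identityʳ (seq y n)) ⟩
    seq y n ℚ.+ 0ℚ      ≤⟨ ℚ.+-monoʳ-≤ (seq y n) (ℚ.<⇒≤ 0<ε) ⟩
    seq y n ℚ.+ ε       ∎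
    where open ℚ.≤-Reasoning

  ≲-refl : ∀ {x} → x ≲ x
  ≲-refl = ≗⇒≲ λ _ → ℚ.≤-refl

  p≤∣p∣ : ∀ p → p ℚ.≤ ℚ.∣ p ∣
  p≤∣p∣ p with ℚ.∣p∣≡p∨∣p∣≡-p p
  ... | inj₁ e = ℚ.≤-reflexive (sym e)
  ... | inj₂ e = ℚ.≤-trans p≤0 (ℚ.0≤∣p∣ p)
    where
    p≤0 : p ℚ.≤ 0ℚ
    p≤0 = subst₂ ℚ._≤_ (trans (cong ℚ.-_ e) (solve 1 (λ a → :- (:- a) := a) refl p)) refl
      (ℚ.neg-antimono-≤ (ℚ.0≤∣p∣ p))

  ≈⇒≲ : ∀ {x y} → x ≈ y → x ≲ y
  ≈⇒≲ {x} {y} (mk≈ h) = mk≲ bound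
    where
    open ℚ.≤-Reasoning
    bound : x ≤ᴿ y
    bound ε 0<ε with h ε 0<ε
    ... | N , g = N , λ n p → begin
      seq x n                            ≡⟨ solve 2 (λ a b → a := b :+ (a :- b)) refl (seq x n) (seq y n) ⟩
      seq y n ℚ.+ (seq x n ℚ.- seq y n)  ≤⟨ ℚ.+-monoʳ-≤ (seq y n) (ℚ.≤-trans (p≤∣p∣ (seq x n ℚ.- seq y n)) (ℚ.<⇒≤ (g n p))) ⟩
      seq y n ℚ.+ ε                      ∎

  +ᴿ-mono : ∀ {x x′ y y′} → x ≲ x′ → y ≲ y′ → x +ᴿ y ≲ x′ +ᴿ y′
  +ᴿ-mono {x} {x′} {y} {y′} (mk≲ g) (mk≲ h) = mk≲ bound
    where
    open ℚ.≤-Reasoning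
    bound : x +ᴿ y ≤ᴿ x′ +ᴿ y′
    bound ε 0<ε with g (ε ℚ.* ½) (½-pos 0<ε) | h (ε ℚ.* ½) (½-pos 0<ε)
    ... | M , g′ | N , h′ = M ℕ.⊔ N , λ n p → begin
      seq x n ℚ.+ seq y n
        ≤⟨ ℚ.+-mono-≤ (g′ n (ℕ.m⊔n≤o⇒m≤o M N p)) (h′ n (ℕ.m⊔n≤o⇒n≤o M N p)) ⟩
      (seq x′ n ℚ.+ ε ℚ.* ½) ℚ.+ (seq y′ n ℚ.+ ε ℚ.* ½)
        ≡⟨ solve 4 (λ a b c d → (a :+ b) :+ (c :+ d) := (a :+ c) :+ (b :+ d)) refl (seq x′ n) (ε ℚ.* ½) (seq y′ n) (ε ℚ.* ½) ⟩
      (seq x′ n ℚ.+ seq y′ n) ℚ.+ (ε ℚ.* ½ ℚ.+ ε ℚ.* ½)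
        ≡⟨ cong (seq x′ n ℚ.+ seq y′ n ℚ.+_) (½+½ ε) ⟩
      (seq x′ n ℚ.+ seq y′ n) ℚ.+ ε ∎

  ≲-trans : ∀ {x y z} → x ≲ y → y ≲ z → x ≲ z
  ≲-trans {x} {y} {z} (mk≲ g) (mk≲ h) = mk≲ bound
    where
    open ℚ.≤-Reasoning
    bound : x ≤ᴿ z
    bound ε 0<ε with g (ε ℚ.* ½) (½-pos 0<ε) | h (ε ℚ.* ½) (½-pos 0<ε)
    ... | M , g′ | N , h′ = M ℕ.⊔ N , λ n p → begin
      seq x n                                   ≤⟨ g′ n (ℕ.m⊔n≤o⇒m≤o M N p) ⟩
      seq y n ℚ.+ ε ℚ.* ½                       ≤⟨ ℚ.+-monoˡ-≤ (ε ℚ.* ½) (h′ n (ℕ.m⊔n≤o⇒n≤o M N p)) ⟩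
      seq z n ℚ.+ ε ℚ.* ½ ℚ.+ ε ℚ.* ½           ≡⟨ ℚ.+-assoc (seq z n) (ε ℚ.* ½) (ε ℚ.* ½) ⟩
      seq z n ℚ.+ (ε ℚ.* ½ ℚ.+ ε ℚ.* ½)         ≡⟨ cong (seq z n ℚ.+_) (½+½ ε) ⟩
      seq z n ℚ.+ ε                             ∎

  *ᴿ-monoʳ-pos : ∀ q → 0ℚ ℚ.< q → ∀ {x y} → x ≲ y → fromℚ q *ᴿ x ≲ fromℚ q *ᴿ y
  *ᴿ-monoʳ-pos q 0<q {x} {y} (mk≲ h) = mk≲ λ ε 0<ε →
    let r , 0<r , qr≡1 = reciprocal 0<q
        N , g = h (r ℚ.* ε) (*-pos 0<r 0<ε)
    in N , λ n p → begin
      q ℚ.* seq x n                        ≤⟨ ℚ.*-monoˡ-≤-nonNeg q {{ℚ.pos⇒nonNeg q {{ℚ.positive 0<q}}}} (g n p) ⟩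
      q ℚ.* (seq y n ℚ.+ r ℚ.* ε)          ≡⟨ ℚ.*-distribˡ-+ q (seq y n) (r ℚ.* ε) ⟩
      q ℚ.* seq y n ℚ.+ q ℚ.* (r ℚ.* ε)    ≡⟨ cong (q ℚ.* seq y n ℚ.+_) (scale-cancel q r qr≡1 ε) ⟩
      q ℚ.* seq y n ℚ.+ ε                  ∎
    where open ℚ.≤-Reasoning

  -- The order on reals tolerates every positive error, in particular half of a supposed gap between
  -- `p` and `q`.
  fromℚ-cancel-≲ : ∀ {p q} → fromℚ p ≲ fromℚ q → p ℚ.≤ q
  fromℚ-cancel-≲ {p} {q} (mk≲ h) with p ℚ.≤? q
  ... | yes p≤q = p≤q
  ... | no p≰q = contradiction (ℚ.≤-<-trans (proj₂ (h ε 0<ε) (proj₁ (h ε 0<ε)) ℕ.≤-refl) q+ε<p) (ℚ.<-irrefl refl)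
    where
    δ = p ℚ.- q
    ε = δ ℚ.* ½
    0<δ : 0ℚ ℚ.< δ
    0<δ = subst (ℚ._< δ) (ℚ.+-inverseʳ q) (ℚ.+-monoˡ-< (ℚ.- q) (ℚ.≰⇒> p≰q))
    0<ε = ½-pos 0<δ
    q+ε<p : q ℚ.+ ε ℚ.< p
    q+ε<p = begin-strict
      q ℚ.+ ε               ≡⟨ sym (ℚ.+-identityʳ (q ℚ.+ ε)) ⟩
      q ℚ.+ ε ℚ.+ 0ℚ        <⟨ ℚ.+-monoʳ-< (q ℚ.+ ε) 0<ε ⟩
      q ℚ.+ ε ℚ.+ ε         ≡⟨ trans (ℚ.+-assoc q ε ε) (cong (q ℚ.+_) (½+½ δ)) ⟩
      q ℚ.+ δ               ≡⟨ solve 2 (λ a b → b :+ (a :- b) := a) refl p q ⟩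
      p                     ∎
      where open ℚ.≤-Reasoning

  infix 4 _≈ᶜ_

  record _≈ᶜ_ (z w : ℂ) : Set where
    constructor mk≈ᶜ
    field
      re≈ : re z ≈ re w
      im≈ : im z ≈ im w

  open _≈ᶜ_

  ≃ᶜ⇒≈ᶜ : ∀ {z w} → z ≃ᶜ w → z ≈ᶜ w
  ≃ᶜ⇒≈ᶜ (p , q) = mk≈ᶜ (mk≈ p) (mk≈ q)

  ℂ-commutativeRing : CommutativeRing 0ℓ 0ℓ
  ℂ-commutativeRing = record
    { Carrier = ℂ ; _≈_ = _≈ᶜ_ ; _+_ = _+ᶜ_ ; _*_ = _*ᶜ_ ; -_ = λ z → (-ᴿ re z) +i (-ᴿ im z) ; 0# = 0ᶜ ; 1# = 1ᶜ
    ; isCommutativeRing = record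
      { isRing = record
        { +-isAbelianGroup = record
          { isGroup = record
            { isMonoid = record
              { isSemigroup = record
                { isMagma = record
                  { isEquivalence = record
                    { refl = mk≈ᶜ R.refl R.refl
                    ; sym = λ (mk≈ᶜ p q) → mk≈ᶜ (R.sym p) (R.sym q)
                    ; trans = λ (mk≈ᶜ p q) (mk≈ᶜ r s) → mk≈ᶜ (R.trans p r) (R.trans q s) }
                  ; ∙-cong = λ (mk≈ᶜ p q) (mk≈ᶜ r s) → mk≈ᶜ (R.+-cong p r) (R.+-cong q s) }
                ; assoc = λ x y z → mk≈ᶜ (R.+-assoc (re x) (re y) (re z)) (R.+-assoc (im x) (im y) (im z)) }
              ; identity = (λ x → mk≈ᶜ (R.+-identityˡ (re x)) (R.+-identityˡ (im x)))
                         , (λ x → mk≈ᶜ (R.+-identityʳ (re x)) (R.+-identityʳ (im x))) }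
            ; inverse = (λ x → mk≈ᶜ (R.-‿inverseˡ (re x)) (R.-‿inverseˡ (im x)))
                      , (λ x → mk≈ᶜ (R.-‿inverseʳ (re x)) (R.-‿inverseʳ (im x)))
            ; ⁻¹-cong = λ (mk≈ᶜ p q) → mk≈ᶜ (R.-‿cong p) (R.-‿cong q) }
          ; comm = λ x y → mk≈ᶜ (R.+-comm (re x) (re y)) (R.+-comm (im x) (im y)) }
        ; *-cong = λ (mk≈ᶜ p q) (mk≈ᶜ r s) → mk≈ᶜ
            (R.+-cong (R.*-cong p r) (R.-‿cong (R.*-cong q s))) (R.+-cong (R.*-cong p s) (R.*-cong q r))
        ; *-assoc = λ x y z → mk≈ᶜ
            (≗⇒≈ λ n → solve 6 (λ a b c d e f →
              (a :* c :+ :- (b :* d)) :* e :+ :- ((a :* d :+ b :* c) :* f)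
              := a :* (c :* e :+ :- (d :* f)) :+ :- (b :* (c :* f :+ d :* e))) refl
              (seq (re x) n) (seq (im x) n) (seq (re y) n) (seq (im y) n) (seq (re z) n) (seq (im z) n))
            (≗⇒≈ λ n → solve 6 (λ a b c d e f →
              (a :* c :+ :- (b :* d)) :* f :+ (a :* d :+ b :* c) :* e
              := a :* (c :* f :+ d :* e) :+ b :* (c :* e :+ :- (d :* f))) refl
              (seq (re x) n) (seq (im x) n) (seq (re y) n) (seq (im y) n) (seq (re z) n) (seq (im z) n))
        ; *-identity =
            (λ x → mk≈ᶜ
              (≗⇒≈ λ n → solve 2 (λ a b → con 1ℚ :* a :+ :- (con 0ℚ :* b) := a) refl (seq (re x) n) (seq (im x) n))
              (≗⇒≈ λ n → solve 2 (λ a b → con 1ℚ :* b :+ con 0ℚ :* a := b) refl (seq (re x) n) (seq (im x) n)))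
          , (λ x → mk≈ᶜ
              (≗⇒≈ λ n → solve 2 (λ a b → a :* con 1ℚ :+ :- (b :* con 0ℚ) := a) refl (seq (re x) n) (seq (im x) n))
              (≗⇒≈ λ n → solve 2 (λ a b → a :* con 0ℚ :+ b :* con 1ℚ := b) refl (seq (re x) n) (seq (im x) n)))
        ; distrib =
            (λ x y z → mk≈ᶜ
              (≗⇒≈ λ n → solve 6 (λ a b c d e f →
                a :* (c :+ e) :+ :- (b :* (d :+ f)) := (a :* c :+ :- (b :* d)) :+ (a :* e :+ :- (b :* f))) refl
                (seq (re x) n) (seq (im x) n) (seq (re y) n) (seq (im y) n) (seq (re z) n) (seq (im z) n))
              (≗⇒≈ λ n → solve 6 (λ a b c d e f →
                a :* (d :+ f) :+ b :* (c :+ e) := (a :* d :+ b :* c) :+ (a :* f :+ b :* e)) refl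
                (seq (re x) n) (seq (im x) n) (seq (re y) n) (seq (im y) n) (seq (re z) n) (seq (im z) n)))
          , (λ x y z → mk≈ᶜ
              (≗⇒≈ λ n → solve 6 (λ a b c d e f →
                (c :+ e) :* a :+ :- ((d :+ f) :* b) := (c :* a :+ :- (d :* b)) :+ (e :* a :+ :- (f :* b))) refl
                (seq (re x) n) (seq (im x) n) (seq (re y) n) (seq (im y) n) (seq (re z) n) (seq (im z) n))
              (≗⇒≈ λ n → solve 6 (λ a b c d e f →
                (c :+ e) :* b :+ (d :+ f) :* a := (c :* b :+ d :* a) :+ (e :* b :+ f :* a)) refl
                (seq (re x) n) (seq (im x) n) (seq (re y) n) (seq (im y) n) (seq (re z) n) (seq (im z) n))) }
      ; *-comm = λ x y → mk≈ᶜ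
          (≗⇒≈ λ n → solve 4 (λ a b c d → a :* c :+ :- (b :* d) := c :* a :+ :- (d :* b)) refl
            (seq (re x) n) (seq (im x) n) (seq (re y) n) (seq (im y) n))
          (≗⇒≈ λ n → solve 4 (λ a b c d → a :* d :+ b :* c := c :* b :+ d :* a) refl
            (seq (re x) n) (seq (im x) n) (seq (re y) n) (seq (im y) n)) } }
    where module R = CommutativeRing ℝ-commutativeRing

open Reals

-- Invariance of the inner product of states under unitaries.

module InnerProducts where

  open +-*-Solver using (solve; _:+_; _:*_; :-_; _:=_)
  module _ {N W : ℕ} where

    private
      module ℂR = CommutativeRing ℂ-commutativeRing
      module ΣC = BasisSum ℂ-commutativeRing {N} {W}

    conj-* : ∀ z w → conj (z *ᶜ w) ≈ᶜ conj z *ᶜ conj w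
    conj-* z w = mk≈ᶜ
      (≗⇒≈ λ n → solve 4 (λ a b c d → a :* c :+ :- (b :* d) := a :* c :+ :- ((:- b) :* (:- d))) refl
        (seq (re z) n) (seq (im z) n) (seq (re w) n) (seq (im w) n))
      (≗⇒≈ λ n → solve 4 (λ a b c d → :- (a :* d :+ b :* c) := a :* (:- d) :+ (:- b) :* c) refl
        (seq (re z) n) (seq (im z) n) (seq (re w) n) (seq (im w) n))

    conj-+ : ∀ z w → conj (z +ᶜ w) ≈ᶜ conj z +ᶜ conj w
    conj-+ z w = mk≈ᶜ ≈-refl (≗⇒≈ λ n → ℚ.neg-distrib-+ (seq (im z) n) (seq (im w) n))

    module Inner = ΣC.Involution conj (λ (mk≈ᶜ p q) → mk≈ᶜ p (-ᴿ-cong q)) (mk≈ᶜ ≈-refl (≗⇒≈ λ _ → refl)) conj-+ conj-*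

    Σ-ket : ∀ s (g : State {N} {W}) → ΣC.Σᴮ (λ t → ket {N} {W} s t *ᶜ g t) ≈ᶜ g s
    Σ-ket s g = ℂR.trans (ΣC.Σ-δ (λ t → ket {N} {W} s t *ᶜ g t) s off) on
      where
      on : ket {N} {W} s s *ᶜ g s ≈ᶜ g s
      on with ≡-dec Fin._≟_ (≡-dec Bool._≟_ Fin._≟_) s s
      ... | yes _  = ℂR.*-identityˡ (g s)
      ... | no s≢s = contradiction refl s≢s
      off : ∀ t → t ≢ s → ket {N} {W} s t *ᶜ g t ≈ᶜ 0ᶜ
      off t t≢s with ≡-dec Fin._≟_ (≡-dec Bool._≟_ Fin._≟_) s t
      ... | yes s≡t = contradiction (sym s≡t) t≢s
      ... | no  _   = ℂR.zeroˡ (g t)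

    ⟨_∣_⟩ : State {N} {W} → State {N} {W} → ℂ
    ⟨_∣_⟩ = Inner.⟨_∣_⟩

    ⟨⟩-cong : ∀ {ψ ψ′ φ φ′ : State {N} {W}} → (∀ s → ψ s ≡ ψ′ s) → (∀ s → φ s ≡ φ′ s) → ⟨ ψ ∣ φ ⟩ ≈ᶜ ⟨ ψ′ ∣ φ′ ⟩
    ⟨⟩-cong p q = ΣC.Σ-cong λ s → ℂR.reflexive (cong₂ (λ z w → conj z *ᶜ w) (p s) (q s))

    ⟨⟩-unitary : ∀ (U : Unitary {N} {W}) ψ φ →
      ⟨ _$$_ {N} {W} (proj₁ U) ψ ∣ _$$_ {N} {W} (proj₁ U) φ ⟩ ≈ᶜ ⟨ ψ ∣ φ ⟩
    ⟨⟩-unitary (U , U†U , _) ψ φ = ℂR.trans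
      (⟨⟩-cong (λ s → sym (ΣC.Σᴮ-unfold _)) (λ s → sym (ΣC.Σᴮ-unfold _)))
      (Inner.⟨⟩-isometry U (ket {N} {W}) isometry Σ-ket ψ φ)
      where
      isometry : ∀ s t → ΣC.Σᴮ (λ r → conj (U r s) *ᶜ U r t) ≈ᶜ ket {N} {W} s t
      isometry s t = ℂR.trans (ℂR.reflexive (ΣC.Σᴮ-unfold _)) (≃ᶜ⇒≈ᶜ (U†U s t))

open InnerProducts

-- Order on sums, norms and real inner products of states.

module States where

  open +-*-Solver using (solve; _:+_; _:*_; :-_; _:=_)
  open _≈ᶜ_

  open CommutativeRing ℝ-commutativeRing using () renaming
    ( semiring to ℝ-semiring ; +-identityˡ to +ᴿ-identityˡ ; +-identityʳ to +ᴿ-identityʳ ;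
    reflexive to ≈-reflexive )
  open SemiringSum ℝ-semiring using (sum; sum-cong-≋; sum-replicate-zero)

  ≲-preorder : Preorder 0ℓ 0ℓ 0ℓ
  ≲-preorder = record
    { Carrier = ℝ ; _≈_ = _≈_ ; _≲_ = _≲_
    ; isPreorder = record
      { isEquivalence = CommutativeRing.isEquivalence ℝ-commutativeRing ; reflexive = ≈⇒≲ ; trans = ≲-trans } }

  module ≲-Reasoning = Relation.Binary.Reasoning.Preorder ≲-preorder

  sum-mono : ∀ {n} {f g : Fin n → ℝ} → (∀ i → f i ≲ g i) → sum f ≲ sum g
  sum-mono {zero}  f≲g = ≲-refl
  sum-mono {suc n} f≲g = +ᴿ-mono (f≲g zero) (sum-mono (f≲g ∘ suc))

  sum-nonNeg : ∀ {n} {f : Fin n → ℝ} → (∀ i → 0ᴿ ≲ f i) → 0ᴿ ≲ sum f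
  sum-nonNeg {n} 0≲f = ≲-trans (≈⇒≲ (≈-sym (sum-replicate-zero n))) (sum-mono 0≲f)

  x≲x+y : ∀ {x y} → 0ᴿ ≲ y → x ≲ x +ᴿ y
  x≲x+y {x} 0≲y = ≲-trans (≈⇒≲ (≈-sym (+ᴿ-identityʳ x))) (+ᴿ-mono ≲-refl 0≲y)

  y≲x+y : ∀ {x y} → 0ᴿ ≲ x → y ≲ x +ᴿ y
  y≲x+y {x} {y} 0≲x = ≲-trans (≈⇒≲ (≈-sym (+ᴿ-identityˡ y))) (+ᴿ-mono 0≲x ≲-refl)

  term≲sum : ∀ {n} {f : Fin n → ℝ} → (∀ i → 0ᴿ ≲ f i) → ∀ i → f i ≲ sum f
  term≲sum 0≲f zero    = x≲x+y (sum-nonNeg (0≲f ∘ suc))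
  term≲sum 0≲f (suc i) = ≲-trans (term≲sum (0≲f ∘ suc) i) (y≲x+y (0≲f zero))

  0≤p*p : ∀ p → 0ℚ ℚ.≤ p ℚ.* p
  0≤p*p p with ℚ.≤-total 0ℚ p
  ... | inj₁ 0≤p = subst (ℚ._≤ p ℚ.* p) (ℚ.*-zeroˡ p) (ℚ.*-monoʳ-≤-nonNeg p {{ℚ.nonNegative 0≤p}} 0≤p)
  ... | inj₂ p≤0 = subst (ℚ._≤ p ℚ.* p) (ℚ.*-zeroˡ p) (ℚ.*-monoʳ-≤-nonPos p {{ℚ.nonPositive p≤0}} p≤0)

  -- The form in which inequalities between quadratic forms are certified: the difference is
  -- exhibited as a sum of two squares, and the identity is left to the ring solver.
  ≤-from-squares : ∀ {p q} u v → p ℚ.+ (u ℚ.* u ℚ.+ v ℚ.* v) ≡ q → p ℚ.≤ q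
  ≤-from-squares {p} {q} u v eq = subst₂ ℚ._≤_ (ℚ.+-identityʳ p) eq
    (ℚ.+-monoʳ-≤ p (ℚ.+-mono-≤ (0≤p*p u) (0≤p*p v)))

  ∣∣²-nonNeg : ∀ z → 0ᴿ ≲ ∣ z ∣²
  ∣∣²-nonNeg z = ≗⇒≲ λ n → ℚ.+-mono-≤ (0≤p*p (seq (re z) n)) (0≤p*p (seq (im z) n))

  flipAt : ∀ {N} → Fin N → (Fin N → Bool) → Fin N → Bool
  flipAt i x j = if does (i Fin.≟ j) then not (x j) else x j

  flipAt-≢ : ∀ {N} {i j : Fin N} x → j ≢ i → flipAt i x j ≡ x j
  flipAt-≢ {i = i} {j} x j≢i with i Fin.≟ j
  ... | yes i≡j = contradiction (sym i≡j) j≢i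
  ... | no  _   = refl

  module _ {N W : ℕ} where
    private
      module ΣC = BasisSum ℂ-commutativeRing {N} {W}
      St = State {N} {W}
    module ΣR = BasisSum ℝ-commutativeRing {N} {W}
    open ΣR using (block; Σᴮ)

    block-mono : ∀ i {f g} → (∀ s → f s ≲ g s) → block i f ≲ block i g
    block-mono i {f} {g} f≲g rewrite ΣR.block-unfold i f | ΣR.block-unfold i g =
      +ᴿ-mono (sum-mono λ w → f≲g (i , false , w)) (sum-mono λ w → f≲g (i , true , w))

    Σ-mono : ∀ {f g} → (∀ s → f s ≲ g s) → Σᴮ f ≲ Σᴮ g
    Σ-mono {f} {g} f≲g rewrite ΣR.Σᴮ-blocks f | ΣR.Σᴮ-blocks g = sum-mono λ i → block-mono i f≲g

    block-nonNeg : ∀ i {f} → (∀ s → 0ᴿ ≲ f s) → 0ᴿ ≲ block i f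
    block-nonNeg i {f} 0≲f rewrite ΣR.block-unfold i f =
      ≲-trans (x≲x+y ≲-refl) (+ᴿ-mono (sum-nonNeg λ w → 0≲f (i , false , w)) (sum-nonNeg λ w → 0≲f (i , true , w)))

    block≲Σ : ∀ i {f} → (∀ s → 0ᴿ ≲ f s) → block i f ≲ Σᴮ f
    block≲Σ i {f} 0≲f rewrite ΣR.Σᴮ-blocks f = term≲sum (λ j → block-nonNeg j 0≲f) i

    -- Only the real part of the inner product is followed: it is additive over blocks, and bounded
    -- error already forces it away from 1.
    cross : St → St → Basis N W → ℝ
    cross ψ φ s = re (conj (ψ s) *ᶜ φ s)

    rip : St → St → ℝ
    rip ψ φ = Σᴮ (cross ψ φ)

    normSq : St → ℝ
    normSq ψ = Σᴮ λ s → ∣ ψ s ∣²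

    normSq≈rip : ∀ ψ → normSq ψ ≈ rip ψ ψ
    normSq≈rip ψ = ΣR.Σ-cong λ s → ≗⇒≈ λ n →
      solve 2 (λ a b → a :* a :+ b :* b := a :* a :+ :- ((:- b) :* b)) refl (seq (re (ψ s)) n) (seq (im (ψ s)) n)

    re-sum : ∀ {n} (f : Fin n → ℂ) → re (SemiringSum.sum (CommutativeRing.semiring ℂ-commutativeRing) f) ≡ sum (re ∘ f)
    re-sum {zero}  f = refl
    re-sum {suc n} f = cong (re (f zero) +ᴿ_) (re-sum (f ∘ suc))

    re-⟨⟩ : ∀ ψ φ → re ⟨ ψ ∣ φ ⟩ ≈ rip ψ φ
    re-⟨⟩ ψ φ = ≈-trans (≈-reflexive (cong re (ΣC.Σᴮ-unfold h)))
      (≈-trans (≈-reflexive (re-sum (λ i → g i false +ᶜ g i true)))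
        (≈-trans (sum-cong-≋ λ i → +ᴿ-cong (≈-reflexive (re-sum (λ w → h (i , false , w)))) (≈-reflexive (re-sum (λ w → h (i , true , w)))))
          (≈-reflexive (sym (ΣR.Σᴮ-unfold (cross ψ φ))))))
      where
      h : Basis N W → ℂ
      h s = conj (ψ s) *ᶜ φ s
      g : Fin N → Bool → ℂ
      g i b = SemiringSum.sum (CommutativeRing.semiring ℂ-commutativeRing) λ w → h (i , b , w)

    rip-unitary : ∀ (U : Unitary {N} {W}) ψ φ → rip (_$$_ {N} {W} (proj₁ U) ψ) (_$$_ {N} {W} (proj₁ U) φ) ≈ rip ψ φ
    rip-unitary U ψ φ = ≈-trans (≈-sym (re-⟨⟩ _ _)) (≈-trans (re≈ (⟨⟩-unitary U ψ φ)) (re-⟨⟩ ψ φ))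

    -- If `x i ≡ y i`, both oracles permute the block in the same way, so the sum of any joint
    -- function `G` of the two amplitudes is merely reordered. With `x` and `y` equal it shows that
    -- a query preserves the norm of each block.
    block-oracle : ∀ i (x y : Fin N → Bool) (ψ φ : St) (G : ℂ → ℂ → ℝ) → x i ≡ y i →
      block i (λ s → G (oracle {N} {W} x ψ s) (oracle {N} {W} y φ s)) ≈ block i (λ s → G (ψ s) (φ s))
    block-oracle i x y ψ φ G xi≡yi = ≈-trans
      (≈-trans (ΣR.block-cong i _ (λ (j , b , w) → G (ψ (j , b xor x i , w)) (φ (j , b xor x i , w)))
                  (λ b w → ≈-reflexive (cong (λ c → G (ψ (i , b xor x i , w)) (φ (i , b xor c , w))) (sym xi≡yi))))
               (≈-reflexive (ΣR.block-unfold i _)))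
      (ΣR.block-xor i (x i) (λ s → G (ψ s) (φ s)))

open States

-- The hybrid argument: how much one query can change the overlaps.

module Queries where

  open +-*-Solver using (solve; _:+_; _:*_; _:-_; :-_; _:=_; con)
  open CommutativeRing ℝ-commutativeRing using () renaming
    ( setoid to ℝ-setoid ; semiring to ℝ-semiring ; reflexive to ≈-reflexive ;
    *-congˡ to *ᴿ-congˡ ; *-identityʳ to *ᴿ-identityʳ )
  open SemiringSum ℝ-semiring using (sum; sum-cong-≋; ∑-distrib-+; *-distribˡ-sum)

  if-≡ : ∀ {A : Set} {N} {i j : Fin N} (x y : A) → i ≡ j → (if does (i Fin.≟ j) then x else y) ≡ x
  if-≡ {i = i} {j} x y i≡j with i Fin.≟ j
  ... | yes _  = refl
  ... | no i≢j = contradiction i≡j i≢j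

  if-≢ : ∀ {A : Set} {N} {i j : Fin N} (x y : A) → i ≢ j → (if does (i Fin.≟ j) then x else y) ≡ y
  if-≢ {i = i} {j} x y i≢j with i Fin.≟ j
  ... | yes i≡j = contradiction i≡j i≢j
  ... | no _    = refl

  sum-≈ : ∀ {n} (f g : Fin n → ℝ) → (∀ i → f i ≈ g i) → sum f ≈ sum g
  sum-≈ f g = sum-cong-≋

  -- For z = a + bi and w = c + di this is 2p Re(z̄w) ≤ p²|z|² + |w|², as the difference is |pz -
  -- w|². The next lemma is the bound for -2p Re(z̄w), with |pz + w|².
  amgm⁺-ℚ : ∀ p a b c d → (p ℚ.+ p) ℚ.* (a ℚ.* c ℚ.+ ℚ.- ((ℚ.- b) ℚ.* d)) ℚ.≤
    (p ℚ.* p) ℚ.* (a ℚ.* a ℚ.+ b ℚ.* b) ℚ.+ (c ℚ.* c ℚ.+ d ℚ.* d)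
  amgm⁺-ℚ p a b c d = ≤-from-squares (p ℚ.* a ℚ.- c) (p ℚ.* b ℚ.- d)
    (solve 5 (λ p a b c d →
      (p :+ p) :* (a :* c :+ :- ((:- b) :* d)) :+ ((p :* a :- c) :* (p :* a :- c) :+ (p :* b :- d) :* (p :* b :- d))
      := (p :* p) :* (a :* a :+ b :* b) :+ (c :* c :+ d :* d)) refl p a b c d)

  amgm⁻-ℚ : ∀ p a b c d → 0ℚ ℚ.≤
    (p ℚ.+ p) ℚ.* (a ℚ.* c ℚ.+ ℚ.- ((ℚ.- b) ℚ.* d)) ℚ.+ ((p ℚ.* p) ℚ.* (a ℚ.* a ℚ.+ b ℚ.* b) ℚ.+ (c ℚ.* c ℚ.+ d ℚ.* d))
  amgm⁻-ℚ p a b c d = ≤-from-squares (p ℚ.* a ℚ.+ c) (p ℚ.* b ℚ.+ d)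
    (solve 5 (λ p a b c d →
      con 0ℚ :+ ((p :* a :+ c) :* (p :* a :+ c) :+ (p :* b :+ d) :* (p :* b :+ d))
      := (p :+ p) :* (a :* c :+ :- ((:- b) :* d)) :+ ((p :* p) :* (a :* a :+ b :* b) :+ (c :* c :+ d :* d))) refl p a b c d)

  p²∣∣²-nonNeg : ∀ p a b → 0ℚ ℚ.≤ (p ℚ.* p) ℚ.* (a ℚ.* a ℚ.+ b ℚ.* b)
  p²∣∣²-nonNeg p a b = ≤-from-squares (p ℚ.* a) (p ℚ.* b) (solve 3 (λ p a b →
    con 0ℚ :+ ((p :* a) :* (p :* a) :+ (p :* b) :* (p :* b)) := (p :* p) :* (a :* a :+ b :* b)) refl p a b)

  module _ {N W : ℕ} where
    private
      St = State {N} {W}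
    open BasisSum ℝ-commutativeRing {N} {W} using (block; Σᴮ; Σ-*ˡ; block-+; block-*ˡ; Σᴮ-blocks; sum-δ)

    -- `τ` is the weight in the arithmetic-geometric mean inequality, left free for later
    -- optimisation. It balances the single state of the base input, whose norm is shared among all
    -- blocks, against the states of the flipped inputs, each charged with its own norm.
    module Hybrid (τ : ℕ) (S : Fin N → Bool) where

      t K : ℝ
      t = fromℕ τ
      K = t +ᴿ t

      energy : St → St → Basis N W → ℝ
      energy ψ φ s = (t *ᴿ t) *ᴿ ∣ ψ s ∣² +ᴿ ∣ φ s ∣²

      amgm⁺ : ∀ z w → K *ᴿ re (conj z *ᶜ w) ≲ (t *ᴿ t) *ᴿ ∣ z ∣² +ᴿ ∣ w ∣²
      amgm⁺ z w = ≗⇒≲ λ n → amgm⁺-ℚ (ℤ.+ τ ℚ./ 1) (seq (re z) n) (seq (im z) n) (seq (re w) n) (seq (im w) n)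

      amgm⁻ : ∀ z w → 0ᴿ ≲ K *ᴿ re (conj z *ᶜ w) +ᴿ ((t *ᴿ t) *ᴿ ∣ z ∣² +ᴿ ∣ w ∣²)
      amgm⁻ z w = ≗⇒≲ λ n → amgm⁻-ℚ (ℤ.+ τ ℚ./ 1) (seq (re z) n) (seq (im z) n) (seq (re w) n) (seq (im w) n)

      module _ (x y : Fin N → Bool) (ψ φ : St) where
        private
          ψ′ φ′ : St
          ψ′ = oracle {N} {W} x ψ
          φ′ = oracle {N} {W} y φ

        block-energy : ∀ i → block i (energy ψ′ φ′) ≈ block i (energy ψ φ)
        block-energy i = begin
          block i (energy ψ′ φ′)
            ≈⟨ block-+ i _ _ ⟩
          block i (λ s → (t *ᴿ t) *ᴿ ∣ ψ′ s ∣²) +ᴿ block i (λ s → ∣ φ′ s ∣²)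
            ≈⟨ +ᴿ-cong (block-oracle i x x ψ ψ (λ z _ → (t *ᴿ t) *ᴿ ∣ z ∣²) refl)
                       (block-oracle i y y φ φ (λ z _ → ∣ z ∣²) refl) ⟩
          block i (λ s → (t *ᴿ t) *ᴿ ∣ ψ s ∣²) +ᴿ block i (λ s → ∣ φ s ∣²)
            ≈⟨ ≈-sym (block-+ i _ _) ⟩
          block i (energy ψ φ) ∎
          where open import Relation.Binary.Reasoning.Setoid ℝ-setoid

        block-agree : ∀ j → x j ≡ y j → K *ᴿ block j (cross ψ φ) ≈ K *ᴿ block j (cross ψ′ φ′)
        block-agree j xj≡yj = *ᴿ-congˡ (≈-sym (block-oracle j x y ψ φ (λ z w → re (conj z *ᶜ w)) xj≡yj))

        -- The scaled overlap in the block is at most the energy before the query and at least minus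
        -- the energy after it. The oracles permute each state within its block, so both energies
        -- are equal and the loss is at most twice that energy.
        block-differ : ∀ i → K *ᴿ block i (cross ψ φ) ≲
          K *ᴿ block i (cross ψ′ φ′) +ᴿ (block i (energy ψ φ) +ᴿ block i (energy ψ φ))
        block-differ i = begin
          K *ᴿ block i (cross ψ φ)                                 ≈⟨ block-*ˡ i K (cross ψ φ) ⟩
          block i (λ s → K *ᴿ cross ψ φ s)                         ≲⟨ block-mono i (λ s → amgm⁺ (ψ s) (φ s)) ⟩
          block i (energy ψ φ)                                     ≲⟨ y≲x+y 0≲ ⟩
          (K *ᴿ block i (cross ψ′ φ′) +ᴿ e) +ᴿ e                    ≈⟨ CommutativeRing.+-assoc ℝ-commutativeRing _ _ _ ⟩
          K *ᴿ block i (cross ψ′ φ′) +ᴿ (e +ᴿ e)                    ∎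
          where
          open ≲-Reasoning
          e = block i (energy ψ φ)
          0≲ : 0ᴿ ≲ K *ᴿ block i (cross ψ′ φ′) +ᴿ e
          0≲ = begin
            0ᴿ                                                              ≲⟨ block-nonNeg i (λ s → amgm⁻ (ψ′ s) (φ′ s)) ⟩
            block i (λ s → K *ᴿ cross ψ′ φ′ s +ᴿ energy ψ′ φ′ s)             ≈⟨ block-+ i _ _ ⟩
            block i (λ s → K *ᴿ cross ψ′ φ′ s) +ᴿ block i (energy ψ′ φ′)     ≈⟨ +ᴿ-cong (≈-sym (block-*ˡ i K (cross ψ′ φ′))) (block-energy i) ⟩
            K *ᴿ block i (cross ψ′ φ′) +ᴿ e                                 ∎

        rip-step : ∀ i → (∀ j → j ≢ i → x j ≡ y j) →
          K *ᴿ rip ψ φ ≲ K *ᴿ rip ψ′ φ′ +ᴿ (block i (energy ψ φ) +ᴿ block i (energy ψ φ))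
        rip-step i agree = begin
          K *ᴿ rip ψ φ                                ≈⟨ scaled ψ φ ⟩
          sum before                                  ≲⟨ sum-mono {f = before} {g = λ j → after j +ᴿ loss j} perBlock ⟩
          sum (λ j → after j +ᴿ loss j)               ≈⟨ ∑-distrib-+ after loss ⟩
          sum after +ᴿ sum loss                       ≈⟨ +ᴿ-cong (≈-sym (scaled ψ′ φ′)) (≈-trans (sum-δ loss i loss-off) loss-on) ⟩
          K *ᴿ rip ψ′ φ′ +ᴿ e                         ∎
          where
          open ≲-Reasoning
          before after : Fin N → ℝ
          before j = K *ᴿ block j (cross ψ φ)
          after j = K *ᴿ block j (cross ψ′ φ′)
          e = block i (energy ψ φ) +ᴿ block i (energy ψ φ)
          loss : Fin N → ℝ
          loss j = if does (i Fin.≟ j) then e else 0ᴿ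
          scaled : ∀ ψ φ → K *ᴿ rip ψ φ ≈ sum (λ j → K *ᴿ block j (cross ψ φ))
          scaled ψ φ = ≈-trans (≈-reflexive (cong (K *ᴿ_) (Σᴮ-blocks (cross ψ φ)))) (*-distribˡ-sum K (λ j → block j (cross ψ φ)))
          loss-on : loss i ≈ e
          loss-on = ≈-reflexive (if-≡ {i = i} {j = i} e 0ᴿ refl)
          loss-off : ∀ j → j ≢ i → loss j ≈ 0ᴿ
          loss-off j j≢i = ≈-reflexive (if-≢ {i = i} {j = j} e 0ᴿ (j≢i ∘ sym))
          perBlock : ∀ j → before j ≲ after j +ᴿ loss j
          perBlock j = cases (i Fin.≟ j)
            where
            cases : Dec (i ≡ j) → before j ≲ after j +ᴿ loss j
            cases (yes refl) = ≲-trans (block-differ i) (+ᴿ-mono {x = after i} {x′ = after i} {y = e} {y′ = loss i} ≲-refl (≈⇒≲ (≈-sym loss-on)))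
            cases (no i≢j)   = ≲-trans (≈⇒≲ (block-agree j (agree j (i≢j ∘ sym))))
              (≲-trans (x≲x+y ≲-refl) (+ᴿ-mono {x = after j} {x′ = after j} {y = 0ᴿ} {y′ = loss j} ≲-refl (≈⇒≲ (≈-sym (loss-off j (i≢j ∘ sym))))))

      weigh : Bool → ℝ → ℝ
      weigh b r = if b then r else 0ᴿ

      progress : St → (Fin N → St) → ℝ
      progress ψ φ = sum λ i → weigh (S i) (rip ψ (φ i))

      -- `C` bounds the loss of scaled progress in one query. The blocks of ψ are disjoint and have
      -- total energy τ²; each of the σ selected states φ contributes at most its whole norm, 1; the
      -- factor 2 comes from `block-differ`.
      σ C : ℝ
      σ = sum λ i → weigh (S i) 1ᴿ
      C = (t *ᴿ t +ᴿ σ) +ᴿ (t *ᴿ t +ᴿ σ)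

      progress-step : ∀ x ψ φ → normSq ψ ≈ 1ᴿ → (∀ i → normSq (φ i) ≈ 1ᴿ) →
        K *ᴿ progress ψ φ ≲ K *ᴿ progress (oracle {N} {W} x ψ) (λ i → oracle {N} {W} (flipAt i x) (φ i)) +ᴿ C
      progress-step x ψ φ ∥ψ∥ ∥φ∥ = begin
        K *ᴿ progress ψ φ
          ≈⟨ *-distribˡ-sum K (λ i → weigh (S i) (rip ψ (φ i))) ⟩
        sum (λ i → K *ᴿ weigh (S i) (rip ψ (φ i)))
          ≲⟨ sum-mono perIndex ⟩
        sum (λ i → K *ᴿ weigh (S i) (rip′ i) +ᴿ (e i +ᴿ e i))
          ≈⟨ ∑-distrib-+ (λ i → K *ᴿ weigh (S i) (rip′ i)) (λ i → e i +ᴿ e i) ⟩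
        sum (λ i → K *ᴿ weigh (S i) (rip′ i)) +ᴿ sum (λ i → e i +ᴿ e i)
          ≈⟨ +ᴿ-cong (≈-sym (*-distribˡ-sum K (λ i → weigh (S i) (rip′ i)))) (≈-trans (∑-distrib-+ e e) (+ᴿ-cong sum-e sum-e)) ⟩
        K *ᴿ progress (oracle {N} {W} x ψ) (λ i → oracle {N} {W} (flipAt i x) (φ i)) +ᴿ C ∎
        where
        open ≲-Reasoning
        rip′ : Fin N → ℝ
        rip′ i = rip (oracle {N} {W} x ψ) (oracle {N} {W} (flipAt i x) (φ i))
        mass : Basis N W → ℝ
        mass s = (t *ᴿ t) *ᴿ ∣ ψ s ∣²
        mass-nonNeg : ∀ s → 0ᴿ ≲ mass s
        mass-nonNeg s = ≗⇒≲ λ n → p²∣∣²-nonNeg (ℤ.+ τ ℚ./ 1) (seq (re (ψ s)) n) (seq (im (ψ s)) n)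
        e : Fin N → ℝ
        e i = block i mass +ᴿ weigh (S i) 1ᴿ
        sum-e : sum e ≈ t *ᴿ t +ᴿ σ
        sum-e = ≈-trans (∑-distrib-+ (λ i → block i mass) (λ i → weigh (S i) 1ᴿ)) (+ᴿ-cong
          (≈-trans (≈-reflexive (sym (Σᴮ-blocks mass)))
            (≈-trans (≈-sym (Σ-*ˡ (t *ᴿ t) (λ s → ∣ ψ s ∣²))) (≈-trans (*ᴿ-congˡ ∥ψ∥) (*ᴿ-identityʳ (t *ᴿ t)))))
          ≈-refl)
        block-energy≲ : ∀ i → block i (energy ψ (φ i)) ≲ block i mass +ᴿ 1ᴿ
        block-energy≲ i = begin
          block i (energy ψ (φ i))                        ≈⟨ block-+ i _ _ ⟩
          block i mass +ᴿ block i (λ s → ∣ φ i s ∣²)      ≲⟨ +ᴿ-mono ≲-refl (block≲Σ i (λ s → ∣∣²-nonNeg (φ i s))) ⟩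
          block i mass +ᴿ normSq (φ i)                    ≈⟨ +ᴿ-cong ≈-refl (∥φ∥ i) ⟩
          block i mass +ᴿ 1ᴿ                              ∎
        e-nonNeg : ∀ i → 0ᴿ ≲ block i mass +ᴿ 0ᴿ
        e-nonNeg i = ≲-trans (block-nonNeg i mass-nonNeg) (x≲x+y ≲-refl)
        cases : ∀ i b → K *ᴿ weigh b (rip ψ (φ i)) ≲
          K *ᴿ weigh b (rip′ i) +ᴿ ((block i mass +ᴿ weigh b 1ᴿ) +ᴿ (block i mass +ᴿ weigh b 1ᴿ))
        cases i true  = ≲-trans (rip-step x (flipAt i x) ψ (φ i) i (λ j j≢i → sym (flipAt-≢ x j≢i)))
          (+ᴿ-mono ≲-refl (+ᴿ-mono (block-energy≲ i) (block-energy≲ i)))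
        -- An index outside `S` keeps its nonnegative share of the mass of ψ, so that the masses of
        -- all blocks add up to exactly τ².
        cases i false = x≲x+y (≲-trans (x≲x+y ≲-refl) (+ᴿ-mono (e-nonNeg i) (e-nonNeg i)))
        perIndex : ∀ i → K *ᴿ weigh (S i) (rip ψ (φ i)) ≲ K *ᴿ weigh (S i) (rip′ i) +ᴿ (e i +ᴿ e i)
        perIndex i = cases i (S i)

      times : ℕ → ℝ → ℝ
      times zero    r = 0ᴿ
      times (suc n) r = r +ᴿ times n r

      normSq-oracle : ∀ x ψ → normSq (oracle {N} {W} x ψ) ≈ normSq ψ
      normSq-oracle x ψ = ≈-trans (≈-reflexive (Σᴮ-blocks (λ s → ∣ oracle {N} {W} x ψ s ∣²)))
        (≈-trans (sum-≈ (λ i → block i (λ s → ∣ oracle {N} {W} x ψ s ∣²)) (λ i → block i (λ s → ∣ ψ s ∣²))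
                   λ i → block-oracle i x x ψ ψ (λ z _ → ∣ z ∣²) refl)
          (≈-reflexive (sym (Σᴮ-blocks (λ s → ∣ ψ s ∣²)))))

      apply : Unitary {N} {W} → St → St
      apply U = _$$_ {N} {W} (proj₁ U)

      query : (Fin N → Bool) → St → St
      query = oracle {N} {W}

      normSq-unitary : ∀ (U : Unitary {N} {W}) ψ → normSq (apply U ψ) ≈ normSq ψ
      normSq-unitary U ψ = ≈-trans {y = rip (apply U ψ) (apply U ψ)} (normSq≈rip (apply U ψ))
        (≈-trans {y = rip ψ ψ} (rip-unitary U ψ ψ) (≈-sym (normSq≈rip ψ)))

      normSq-run : ∀ {T} x (Us : Vec (Unitary {N} {W}) T) ψ → normSq (run {N} {W} x Us ψ) ≈ normSq ψ
      normSq-run x []       ψ = ≈-refl {normSq ψ}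
      normSq-run x (U ∷ Us) ψ = ≈-trans {normSq (run {N} {W} x (U ∷ Us) ψ)} {normSq (apply U (query x ψ))} {normSq ψ}
        (normSq-run x Us (apply U (query x ψ)))
        (≈-trans {y = normSq (query x ψ)} (normSq-unitary U (query x ψ)) (normSq-oracle x ψ))

      progress-unitary : ∀ (U : Unitary {N} {W}) ψ φ →
        progress (_$$_ {N} {W} (proj₁ U) ψ) (λ i → _$$_ {N} {W} (proj₁ U) (φ i)) ≈ progress ψ φ
      progress-unitary U ψ φ = sum-≈ (λ i → weigh (S i) (rip (_$$_ {N} {W} (proj₁ U) ψ) (_$$_ {N} {W} (proj₁ U) (φ i)))) (λ i → weigh (S i) (rip ψ (φ i))) λ i → cases i (S i)
        where
        cases : ∀ i b → weigh b (rip (_$$_ {N} {W} (proj₁ U) ψ) (_$$_ {N} {W} (proj₁ U) (φ i))) ≈ weigh b (rip ψ (φ i))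
        cases i true  = rip-unitary U ψ (φ i)
        cases i false = ≈-refl

      norm-step : ∀ (U : Unitary {N} {W}) x ψ → normSq ψ ≈ 1ᴿ → normSq (apply U (query x ψ)) ≈ 1ᴿ
      norm-step U x ψ ∥ψ∥ = ≈-trans {normSq (apply U (query x ψ))} {normSq (query x ψ)} {1ᴿ} (normSq-unitary U (query x ψ))
        (≈-trans {y = normSq ψ} (normSq-oracle x ψ) ∥ψ∥)

      progress-run : ∀ {T} x (Us : Vec (Unitary {N} {W}) T) ψ φ → normSq ψ ≈ 1ᴿ → (∀ i → normSq (φ i) ≈ 1ᴿ) →
        K *ᴿ progress ψ φ ≲ K *ᴿ progress (run {N} {W} x Us ψ) (λ i → run {N} {W} (flipAt i x) Us (φ i)) +ᴿ times T C
      progress-run x [] ψ φ ∥ψ∥ ∥φ∥ = x≲x+y {K *ᴿ progress ψ φ} ≲-refl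
      progress-run {suc T} x (U ∷ Us) ψ φ ∥ψ∥ ∥φ∥ =
        ≲-trans {K *ᴿ progress ψ φ} {K *ᴿ progress ψ′ φ′ +ᴿ C} {K *ᴿ final +ᴿ (C +ᴿ times T C)}
          (progress-step x ψ φ ∥ψ∥ ∥φ∥)
          (≲-trans {y = K *ᴿ progress ψ″ φ″ +ᴿ C}
            (≈⇒≲ (+ᴿ-cong {K *ᴿ progress ψ′ φ′} {K *ᴿ progress ψ″ φ″} {C} {C} (*ᴿ-congˡ (≈-sym (progress-unitary U ψ′ φ′))) ≈-refl))
            (≲-trans {y = (K *ᴿ final +ᴿ times T C) +ᴿ C}
              (+ᴿ-mono {K *ᴿ progress ψ″ φ″} {K *ᴿ final +ᴿ times T C} {C} {C}
                (progress-run x Us ψ″ φ″ (norm-step U x ψ ∥ψ∥) (λ i → norm-step U (flipAt i x) (φ i) (∥φ∥ i))) ≲-refl)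
              (≈⇒≲ (regroup (K *ᴿ final) (times T C) C))))
        where
        ψ′ ψ″ : St
        ψ′ = query x ψ
        ψ″ = apply U ψ′
        φ′ φ″ : Fin N → St
        φ′ i = query (flipAt i x) (φ i)
        φ″ i = apply U (φ′ i)
        final : ℝ
        final = progress (run {N} {W} x Us ψ″) (λ i → run {N} {W} (flipAt i x) Us (φ″ i))
        regroup : ∀ a b c → (a +ᴿ b) +ᴿ c ≈ a +ᴿ (c +ᴿ b)
        regroup a b c = ≗⇒≈ λ n →
          solve 3 (λ a b c → (a :+ b) :+ c := a :+ (c :+ b)) refl (seq a n) (seq b n) (seq c n)

open Queries

-- Sums of natural numbers and Rosenfeld's counting argument.

module Counting where

  open SemiringSum ℕ.+-*-semiring using () renaming
    ( sum to ∑; sum-cong-≋ to ∑-cong; *-distribˡ-sum to *-distribˡ-∑; *-distribʳ-sum to *-distribʳ-∑; ∑-comm to ∑-comm; ∑-distrib-+ to ∑-+ ) public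

  ∑-mono : ∀ {n} {f g : Fin n → ℕ} → (∀ i → f i ≤ g i) → ∑ f ≤ ∑ g
  ∑-mono {zero}  f≤g = z≤n
  ∑-mono {suc n} f≤g = ℕ.+-mono-≤ (f≤g zero) (∑-mono (f≤g ∘ suc))

  ∑-mono-< : ∀ {n} {f g : Fin n → ℕ} → (∀ i → f i ≤ g i) → ∀ i → f i < g i → ∑ f < ∑ g
  ∑-mono-< f≤g zero    fi<gi = ℕ.+-mono-<-≤ fi<gi (∑-mono (f≤g ∘ suc))
  ∑-mono-< f≤g (suc i) fi<gi = ℕ.+-mono-≤-< (f≤g zero) (∑-mono-< (f≤g ∘ suc) i fi<gi)

  term≤∑ : ∀ {n} (f : Fin n → ℕ) i → f i ≤ ∑ f
  term≤∑ f zero    = ℕ.m≤m+n (f zero) _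
  term≤∑ f (suc i) = ℕ.≤-trans (term≤∑ (f ∘ suc) i) (ℕ.m≤n+m _ (f zero))

  ∑≡0 : ∀ {n} (f : Fin n → ℕ) → ∑ f ≡ 0 → ∀ i → f i ≡ 0
  ∑≡0 f ∑f≡0 i = ℕ.n≤0⇒n≡0 (subst (f i ≤_) ∑f≡0 (term≤∑ f i))

  ∑-const : ∀ n c → ∑ {n} (λ _ → c) ≡ n * c
  ∑-const zero    c = refl
  ∑-const (suc n) c = cong (c +_) (∑-const n c)

  ∑-pos : ∀ {n} (f : Fin n → ℕ) → 0 < ∑ f → ∃[ i ] 0 < f i
  ∑-pos {suc n} f 0<∑ with f zero in eq
  ... | suc k = zero , subst (0 <_) (sym eq) (s≤s z≤n)
  ... | zero  with ∑-pos (f ∘ suc) 0<∑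
  ...   | i , 0<fi = suc i , 0<fi

  χ : Bool → ℕ
  χ b = if b then 1 else 0

  module _ {n : ℕ} where

    ∑ⱽ : ∀ {m} → (Vec (Fin n) m → ℕ) → ℕ
    ∑ⱽ {zero}  F = F []
    ∑ⱽ {suc m} F = ∑ λ a → ∑ⱽ λ φ → F (a ∷ φ)

    ∑ⱽ-cong : ∀ {m} {F G : Vec (Fin n) m → ℕ} → (∀ φ → F φ ≡ G φ) → ∑ⱽ F ≡ ∑ⱽ G
    ∑ⱽ-cong {zero}  F≡G = F≡G []
    ∑ⱽ-cong {suc m} F≡G = ∑-cong λ a → ∑ⱽ-cong λ φ → F≡G (a ∷ φ)

    ∑ⱽ-mono : ∀ {m} {F G : Vec (Fin n) m → ℕ} → (∀ φ → F φ ≤ G φ) → ∑ⱽ F ≤ ∑ⱽ G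
    ∑ⱽ-mono {zero}  F≤G = F≤G []
    ∑ⱽ-mono {suc m} F≤G = ∑-mono λ a → ∑ⱽ-mono λ φ → F≤G (a ∷ φ)

    ∑ⱽ-+ : ∀ {m} (F G : Vec (Fin n) m → ℕ) → ∑ⱽ (λ φ → F φ + G φ) ≡ ∑ⱽ F + ∑ⱽ G
    ∑ⱽ-+ {zero}  F G = refl
    ∑ⱽ-+ {suc m} F G = trans (∑-cong λ a → ∑ⱽ-+ (λ φ → F (a ∷ φ)) (λ φ → G (a ∷ φ)))
      (∑-+ (λ a → ∑ⱽ λ φ → F (a ∷ φ)) (λ a → ∑ⱽ λ φ → G (a ∷ φ)))

    ∑ⱽ-*ʳ : ∀ {m} (F : Vec (Fin n) m → ℕ) c → ∑ⱽ (λ φ → F φ * c) ≡ ∑ⱽ F * c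
    ∑ⱽ-*ʳ {zero}  F c = refl
    ∑ⱽ-*ʳ {suc m} F c = trans (∑-cong λ a → ∑ⱽ-*ʳ (λ φ → F (a ∷ φ)) c) (sym (*-distribʳ-∑ c (λ a → ∑ⱽ λ φ → F (a ∷ φ))))

    ∑ⱽ-∑ : ∀ {m k} (F : Vec (Fin n) m → Fin k → ℕ) → ∑ⱽ (λ φ → ∑ (F φ)) ≡ ∑ (λ j → ∑ⱽ λ φ → F φ j)
    ∑ⱽ-∑ {zero}  F = refl
    ∑ⱽ-∑ {suc m} F = trans (∑-cong λ a → ∑ⱽ-∑ (λ φ → F (a ∷ φ))) (∑-comm λ a j → ∑ⱽ λ φ → F (a ∷ φ) j)

    ∑ⱽ-pos : ∀ {m} (F : Vec (Fin n) m → ℕ) → 0 < ∑ⱽ F → ∃[ φ ] 0 < F φ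
    ∑ⱽ-pos {zero}  F 0<F = [] , 0<F
    ∑ⱽ-pos {suc m} F 0<F with ∑-pos _ 0<F
    ... | a , 0<Fa with ∑ⱽ-pos (λ φ → F (a ∷ φ)) 0<Fa
    ...   | φ , 0<Fφ = a ∷ φ , 0<Fφ

    ∑ⱽ-1-pos : ∀ m → 0 < n → 0 < ∑ⱽ {m} (λ _ → 1)
    ∑ⱽ-1-pos zero    0<n = s≤s z≤n
    ∑ⱽ-1-pos (suc m) 0<n = subst (0 <_) (sym (∑-const n _)) (ℕ.*-mono-< 0<n (∑ⱽ-1-pos m 0<n))

    -- A coordinate on which the summand depends only through c may be averaged over.
    resample : ∀ {m} (v : Fin m) (F : Vec (Fin n) m → Fin n → ℕ) → (∀ φ a c → F (φ [ v ]≔ a) c ≡ F φ c) →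
      n * ∑ⱽ (λ φ → F φ (lookup φ v)) ≡ ∑ λ c → ∑ⱽ λ φ → F φ c
    resample zero F inv = sym (begin
      ∑ (λ c → ∑ λ a → ∑ⱽ λ φ → F (a ∷ φ) c)  ≡⟨ ∑-cong (λ c → ∑-cong λ a → ∑ⱽ-cong λ φ → sym (inv (a ∷ φ) c c)) ⟩
      ∑ (λ c → ∑ {n} λ a → ∑ⱽ λ φ → F (c ∷ φ) c)  ≡⟨ ∑-cong (λ c → ∑-const n (∑ⱽ λ φ → F (c ∷ φ) c)) ⟩
      ∑ (λ c → n * ∑ⱽ λ φ → F (c ∷ φ) c)      ≡⟨ sym (*-distribˡ-∑ n (λ c → ∑ⱽ λ φ → F (c ∷ φ) c)) ⟩
      n * ∑ (λ c → ∑ⱽ λ φ → F (c ∷ φ) c)      ∎)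
      where open ≡.≡-Reasoning
    resample (suc v) F inv = begin
      n * ∑ (λ a → ∑ⱽ λ φ → F (a ∷ φ) (lookup φ v))    ≡⟨ *-distribˡ-∑ n (λ a → ∑ⱽ λ φ → F (a ∷ φ) (lookup φ v)) ⟩
      ∑ (λ a → n * ∑ⱽ λ φ → F (a ∷ φ) (lookup φ v))    ≡⟨ ∑-cong (λ a → resample v (λ φ → F (a ∷ φ)) λ φ → inv (a ∷ φ)) ⟩
      ∑ (λ a → ∑ λ c → ∑ⱽ λ φ → F (a ∷ φ) c)           ≡⟨ ∑-comm (λ a c → ∑ⱽ λ φ → F (a ∷ φ) c) ⟩
      ∑ (λ c → ∑ λ a → ∑ⱽ λ φ → F (a ∷ φ) c)           ∎
      where open ≡.≡-Reasoning

    indicator : ∀ {P : Set} → Dec P → ℕ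
    indicator P? = χ (does P?)

    indicator-mono : ∀ {P Q : Set} (P? : Dec P) (Q? : Dec Q) → (P → Q) → indicator P? ≤ indicator Q?
    indicator-mono (no  _) Q?      P⇒Q = z≤n
    indicator-mono (yes p) (yes _) P⇒Q = ℕ.≤-refl
    indicator-mono (yes p) (no ¬q) P⇒Q = contradiction (P⇒Q p) ¬q

    -- The union bound: an assignment with `P` but without `Q` pays a penalty `k` of at least 1.
    indicator-split : ∀ {P Q : Set} (P? : Dec P) (Q? : Dec Q) k → (P → k ≡ 0 → Q) →
      indicator P? ≤ indicator Q? + indicator P? * k
    indicator-split (no  _) Q?      k h = z≤n
    indicator-split (yes p) (yes _) k h = s≤s z≤n
    indicator-split (yes p) (no ¬q) k h = subst (1 ≤_) (sym (ℕ.*-identityˡ k)) (ℕ.n≢0⇒n>0 (¬q ∘ h p))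

    -- The counting argument of Rosenfeld: if every vertex v is involved in few penalties, then each
    -- further vertex multiplies the number of penalty-free assignments by at least g.
    module Assignments {m : ℕ}
      (P₁ : Fin m → Fin n → ℕ)
      (P₂ : Fin m → Fin m → Fin n → Fin n → ℕ)
      (P₃ : Fin m → Fin m → Fin m → Fin n → Fin n → Fin n → ℕ)
      (P₂-sym : ∀ v w c d → P₂ v w c d ≡ P₂ w v d c)
      (P₃-sym₁ : ∀ u v w c d e → P₃ u v w c d e ≡ P₃ v u w d c e)
      (P₃-sym₂ : ∀ u v w c d e → P₃ u v w c d e ≡ P₃ u w v c e d)
      where

      Subset = Fin m → Bool

      Valid : Subset → Vec (Fin n) m → Set
      Valid S φ = (∀ v → S v ≡ true → P₁ v (lookup φ v) ≡ 0)
        × (∀ v w → S v ≡ true → S w ≡ true → v ≢ w → P₂ v w (lookup φ v) (lookup φ w) ≡ 0)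
        × (∀ u v w → S u ≡ true → S v ≡ true → S w ≡ true → u ≢ v → u ≢ w → v ≢ w →
            P₃ u v w (lookup φ u) (lookup φ v) (lookup φ w) ≡ 0)

      opaque
        valid? : ∀ S φ → Dec (Valid S φ)
        valid? S φ =
          Fin.all? (λ v → (S v Bool.≟ true) →-dec (P₁ v (lookup φ v) ℕ.≟ 0))
          ×-dec Fin.all? (λ v → Fin.all? λ w → (S v Bool.≟ true) →-dec ((S w Bool.≟ true) →-dec
            (¬? (v Fin.≟ w) →-dec (P₂ v w (lookup φ v) (lookup φ w) ℕ.≟ 0))))
          ×-dec Fin.all? (λ u → Fin.all? λ v → Fin.all? λ w →
            (S u Bool.≟ true) →-dec ((S v Bool.≟ true) →-dec ((S w Bool.≟ true) →-dec
            (¬? (u Fin.≟ v) →-dec (¬? (u Fin.≟ w) →-dec (¬? (v Fin.≟ w) →-dec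
            (P₃ u v w (lookup φ u) (lookup φ v) (lookup φ w) ℕ.≟ 0)))))))

      _⊆_ : Subset → Subset → Set
      S ⊆ T = ∀ v → S v ≡ true → T v ≡ true

      Valid-⊆ : ∀ S T φ → S ⊆ T → Valid T φ → Valid S φ
      Valid-⊆ S T φ S⊆T (p , q , r) =
        (λ v Sv → p v (S⊆T v Sv)) , (λ v w Sv Sw → q v w (S⊆T v Sv) (S⊆T w Sw)) ,
        (λ u v w Su Sv Sw → r u v w (S⊆T u Su) (S⊆T v Sv) (S⊆T w Sw))

      Valid-local : ∀ S φ ψ → (∀ v → S v ≡ true → lookup φ v ≡ lookup ψ v) → Valid S φ → Valid S ψ
      Valid-local S φ ψ φ≈ψ (p , q , r) =
        (λ v Sv → subst (λ c → P₁ v c ≡ 0) (φ≈ψ v Sv) (p v Sv)) ,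
        (λ v w Sv Sw v≢w → subst₂ (λ c d → P₂ v w c d ≡ 0) (φ≈ψ v Sv) (φ≈ψ w Sw) (q v w Sv Sw v≢w)) ,
        (λ u v w Su Sv Sw u≢v u≢w v≢w → subst (λ c → P₃ u v w c (lookup ψ v) (lookup ψ w) ≡ 0) (φ≈ψ u Su)
          (subst₂ (λ d e → P₃ u v w (lookup φ u) d e ≡ 0) (φ≈ψ v Sv) (φ≈ψ w Sw) (r u v w Su Sv Sw u≢v u≢w v≢w)))

      valid : Subset → Vec (Fin n) m → ℕ
      valid S φ = indicator (valid? S φ)

      valid-update : ∀ S v → S v ≡ false → ∀ φ a → valid S (φ [ v ]≔ a) ≡ valid S φ
      valid-update S v Sv φ a = ℕ.≤-antisym
        (indicator-mono (valid? S (φ [ v ]≔ a)) (valid? S φ) (Valid-local S (φ [ v ]≔ a) φ unchanged))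
        (indicator-mono (valid? S φ) (valid? S (φ [ v ]≔ a)) (Valid-local S φ (φ [ v ]≔ a) λ w Sw → sym (unchanged w Sw)))
        where
        unchanged : ∀ w → S w ≡ true → lookup (φ [ v ]≔ a) w ≡ lookup φ w
        unchanged w Sw = lookup∘updateAt′ w v (λ { refl → contradiction (trans (sym Sw) Sv) λ () }) φ

      _∖_ _∪_ : Subset → Fin m → Subset
      (S ∖ v) w = S w ∧ not (does (w Fin.≟ v))
      (S ∪ v) w = S w ∨ does (w Fin.≟ v)

      v∉S∖v : ∀ S v → (S ∖ v) v ≡ false
      v∉S∖v S v with v Fin.≟ v
      ... | yes _  = Bool.∧-zeroʳ (S v)
      ... | no v≢v = contradiction refl v≢v

      S∖v⊆S : ∀ S v → (S ∖ v) ⊆ S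
      S∖v⊆S S v w p with S w
      ... | true = refl

      S⊆S∖v∪v : ∀ S v → S ⊆ ((S ∖ v) ∪ v)
      S⊆S∖v∪v S v w Sw with w Fin.≟ v
      ... | yes _ = Bool.∨-zeroʳ _
      ... | no _  = trans (Bool.∨-identityʳ _) (trans (Bool.∧-identityʳ _) Sw)

      ∈∪ : ∀ S v w → (S ∪ v) w ≡ true → S w ≡ true ⊎ w ≡ v
      ∈∪ S v w p with w Fin.≟ v
      ... | yes w≡v = inj₂ w≡v
      ... | no  _   = inj₁ (trans (sym (Bool.∨-identityʳ _)) p)

      size : Subset → ℕ
      size S = ∑ λ v → χ (S v)

      size-∖ : ∀ S v → S v ≡ true → size (S ∖ v) < size S
      size-∖ S v Sv = ∑-mono-< le v lt
        where
        le : ∀ w → χ ((S ∖ v) w) ≤ χ (S w)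
        le w with S w | does (w Fin.≟ v)
        ... | true  | true  = z≤n
        ... | true  | false = ℕ.≤-refl
        ... | false | _     = ℕ.≤-refl
        lt : χ ((S ∖ v) v) < χ (S v)
        lt = subst₂ (λ a b → χ a < χ b) (sym (v∉S∖v S v)) (sym Sv) (s≤s z≤n)

      -- Complete assignments are counted, so each vertex outside `S` contributes a free factor n.
      -- Growth of the number of partial assignments by a factor g therefore reads
      -- `g * count S ≤ n * count (S ∪ v)`.
      count : Subset → ℕ
      count S = ∑ⱽ (valid S)

      count-⊆ : ∀ {S T} → S ⊆ T → count T ≤ count S
      count-⊆ {S} {T} S⊆T = ∑ⱽ-mono λ φ → indicator-mono (valid? T φ) (valid? S φ) (Valid-⊆ S T φ S⊆T)

      -- Divided by n, n² and n³, these are the expected penalties at a vertex under uniform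
      -- independent values.
      A₁ A₂ A₃ : Fin m → ℕ
      A₁ v = ∑ λ c → P₁ v c
      A₂ v = ∑ λ w → ∑ λ c → ∑ λ d → P₂ v w c d
      A₃ u = ∑ λ v → ∑ λ w → ∑ λ c → ∑ λ d → ∑ λ e → P₃ u v w c d e

      module Step (S : Subset) (v : Fin m) (Sv : S v ≡ false) where

        pen₂ : Fin m → Vec (Fin n) m → ℕ
        pen₂ w φ = χ (S w) * P₂ v w (lookup φ v) (lookup φ w)

        -- Equal partners `q` and `r` are left out because the averaging in `B₃-bound` needs three
        -- distinct coordinates.
        pen₃ : Fin m → Fin m → Vec (Fin n) m → ℕ
        pen₃ q r φ = χ (S q ∧ (S r ∧ not (does (r Fin.≟ q)))) * P₃ v q r (lookup φ v) (lookup φ q) (lookup φ r)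

        penalty : Vec (Fin n) m → ℕ
        penalty φ = P₁ v (lookup φ v) + (∑ (λ w → pen₂ w φ) + ∑ (λ q → ∑ (λ r → pen₃ q r φ)))

        extend : ∀ φ → Valid S φ → penalty φ ≡ 0 → Valid (S ∪ v) φ
        extend φ (p , q , r) pen≡0 = p′ , q′ , r′
          where
          zero₁ : P₁ v (lookup φ v) ≡ 0
          zero₁ = ℕ.m+n≡0⇒m≡0 _ pen≡0
          zero₂₃ = ℕ.m+n≡0⇒n≡0 (P₁ v (lookup φ v)) pen≡0
          zero₂ : ∀ w → S w ≡ true → P₂ v w (lookup φ v) (lookup φ w) ≡ 0
          zero₂ w Sw = trans (sym (ℕ.*-identityˡ _)) (subst (λ b → χ b * P₂ v w (lookup φ v) (lookup φ w) ≡ 0) Sw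
            (∑≡0 _ (ℕ.m+n≡0⇒m≡0 _ zero₂₃) w))
          zero₃ : ∀ q r → S q ≡ true → S r ≡ true → q ≢ r → P₃ v q r (lookup φ v) (lookup φ q) (lookup φ r) ≡ 0
          zero₃ q r Sq Sr q≢r = trans (sym (ℕ.*-identityˡ _)) (subst (λ b → χ b * P₃ v q r (lookup φ v) (lookup φ q) (lookup φ r) ≡ 0)
            sel (∑≡0 _ (∑≡0 _ (ℕ.m+n≡0⇒n≡0 (∑ (λ w → pen₂ w φ)) zero₂₃) q) r))
            where
            sel : S q ∧ (S r ∧ not (does (r Fin.≟ q))) ≡ true
            sel rewrite Sq | Sr with r Fin.≟ q
            ... | yes r≡q = contradiction (sym r≡q) q≢r
            ... | no _    = refl
          p′ : ∀ w → (S ∪ v) w ≡ true → P₁ w (lookup φ w) ≡ 0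
          p′ w w∈ with ∈∪ S v w w∈
          ... | inj₁ Sw   = p w Sw
          ... | inj₂ refl = zero₁
          q′ : ∀ w x → (S ∪ v) w ≡ true → (S ∪ v) x ≡ true → w ≢ x → P₂ w x (lookup φ w) (lookup φ x) ≡ 0
          q′ w x w∈ x∈ w≢x with ∈∪ S v w w∈ | ∈∪ S v x x∈
          ... | inj₁ Sw   | inj₁ Sx   = q w x Sw Sx w≢x
          ... | inj₁ Sw   | inj₂ refl = trans (P₂-sym w v _ _) (zero₂ w Sw)
          ... | inj₂ refl | inj₁ Sx   = zero₂ x Sx
          ... | inj₂ refl | inj₂ refl = contradiction refl w≢x
          r′ : ∀ w x y → (S ∪ v) w ≡ true → (S ∪ v) x ≡ true → (S ∪ v) y ≡ true → w ≢ x → w ≢ y → x ≢ y →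
            P₃ w x y (lookup φ w) (lookup φ x) (lookup φ y) ≡ 0
          r′ w x y w∈ x∈ y∈ w≢x w≢y x≢y with ∈∪ S v w w∈ | ∈∪ S v x x∈ | ∈∪ S v y y∈
          ... | inj₁ Sw   | inj₁ Sx   | inj₁ Sy   = r w x y Sw Sx Sy w≢x w≢y x≢y
          ... | inj₂ refl | inj₁ Sx   | inj₁ Sy   = zero₃ x y Sx Sy x≢y
          ... | inj₁ Sw   | inj₂ refl | inj₁ Sy   = trans (P₃-sym₁ w v y _ _ _) (zero₃ w y Sw Sy w≢y)
          ... | inj₁ Sw   | inj₁ Sx   | inj₂ refl =
            trans (P₃-sym₂ w x v _ _ _) (trans (P₃-sym₁ w v x _ _ _) (zero₃ w x Sw Sx w≢x))
          ... | inj₂ refl | inj₂ refl | _         = contradiction refl w≢x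
          ... | inj₂ refl | inj₁ _    | inj₂ refl = contradiction refl w≢y
          ... | inj₁ _    | inj₂ refl | inj₂ refl = contradiction refl x≢y

        valid≤ : ∀ φ → valid S φ ≤ valid (S ∪ v) φ + valid S φ * penalty φ
        valid≤ φ = indicator-split (valid? S φ) (valid? (S ∪ v) φ) (penalty φ) (extend φ)

        B₁ : ℕ
        B₁ = ∑ⱽ λ φ → valid S φ * P₁ v (lookup φ v)

        B₂ : Fin m → ℕ
        B₂ w = ∑ⱽ λ φ → valid S φ * pen₂ w φ

        B₃ : Fin m → Fin m → ℕ
        B₃ q r = ∑ⱽ λ φ → valid S φ * pen₃ q r φ

        ∑ⱽ-zero : (F G : Vec (Fin n) m → ℕ) → ∑ⱽ (λ φ → F φ * (0 * G φ)) ≡ 0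
        ∑ⱽ-zero F G = trans (∑ⱽ-*ʳ F 0) (ℕ.*-zeroʳ (∑ⱽ F))

        B₂-off : ∀ w → S w ≡ false → B₂ w ≡ 0
        B₂-off w Sw = trans (∑ⱽ-cong λ φ → cong (λ b → valid S φ * (χ b * P₂ v w (lookup φ v) (lookup φ w))) Sw)
          (∑ⱽ-zero (valid S) λ φ → P₂ v w (lookup φ v) (lookup φ w))

        B₃-off : ∀ q r → S q ∧ (S ∖ q) r ≡ false → B₃ q r ≡ 0
        B₃-off q r sel = trans (∑ⱽ-cong λ φ → cong (λ b → valid S φ * (χ b * P₃ v q r (lookup φ v) (lookup φ q) (lookup φ r))) sel)
          (∑ⱽ-zero (valid S) λ φ → P₃ v q r (lookup φ v) (lookup φ q) (lookup φ r))

        count≤ : count S ≤ count (S ∪ v) + (B₁ + (∑ B₂ + ∑ λ q → ∑ (B₃ q)))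
        count≤ = begin
          count S                                                             ≤⟨ ∑ⱽ-mono valid≤ ⟩
          ∑ⱽ (λ φ → valid (S ∪ v) φ + valid S φ * penalty φ)                  ≡⟨ ∑ⱽ-+ (valid (S ∪ v)) (λ φ → valid S φ * penalty φ) ⟩
          count (S ∪ v) + ∑ⱽ (λ φ → valid S φ * penalty φ)                    ≡⟨ cong (count (S ∪ v) +_) split ⟩
          count (S ∪ v) + (B₁ + (∑ B₂ + ∑ λ q → ∑ (B₃ q)))                    ∎
          where
          open ℕ.≤-Reasoning
          expand : ∀ φ → valid S φ * penalty φ ≡
            valid S φ * P₁ v (lookup φ v) + (∑ (λ w → valid S φ * pen₂ w φ) + ∑ (λ q → ∑ (λ r → valid S φ * pen₃ q r φ)))
          expand φ = trans (ℕ.*-distribˡ-+ (valid S φ) (P₁ v (lookup φ v)) _) (cong (valid S φ * P₁ v (lookup φ v) +_)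
            (trans (ℕ.*-distribˡ-+ (valid S φ) (∑ (λ w → pen₂ w φ)) _) (cong₂ _+_
              (*-distribˡ-∑ (valid S φ) (λ w → pen₂ w φ))
              (trans (*-distribˡ-∑ (valid S φ) (λ q → ∑ (λ r → pen₃ q r φ)))
                (∑-cong λ q → *-distribˡ-∑ (valid S φ) (λ r → pen₃ q r φ))))))
          split : ∑ⱽ (λ φ → valid S φ * penalty φ) ≡ B₁ + (∑ B₂ + ∑ λ q → ∑ (B₃ q))
          split = trans (∑ⱽ-cong expand) (trans (∑ⱽ-+ (λ φ → valid S φ * P₁ v (lookup φ v)) _) (cong (B₁ +_)
            (trans (∑ⱽ-+ (λ φ → ∑ (λ w → valid S φ * pen₂ w φ)) _) (cong₂ _+_
              (∑ⱽ-∑ (λ φ w → valid S φ * pen₂ w φ))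
              (trans (∑ⱽ-∑ (λ φ q → ∑ (λ r → valid S φ * pen₃ q r φ)))
                (∑-cong λ q → ∑ⱽ-∑ (λ φ r → valid S φ * pen₃ q r φ)))))))

        B₁-bound : n * B₁ ≡ count S * A₁ v
        B₁-bound = trans
          (resample v (λ φ c → valid S φ * P₁ v c) (λ φ a c → cong (_* P₁ v c) (valid-update S v Sv φ a)))
          (trans (∑-cong λ c → ∑ⱽ-*ʳ (valid S) (P₁ v c)) (sym (*-distribˡ-∑ (count S) (P₁ v))))

        a₂ : Fin m → ℕ
        a₂ w = ∑ λ c → ∑ λ d → P₂ v w c d

        -- Validity on `S` still depends on the value at `w`. Weakening it to validity on `S ∖ w`
        -- frees both coordinates of the penalty for averaging; the larger count that results is
        -- paid for by `drop`. For triples, `B₃-bound` frees two vertices of `S` likewise.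
        B₂-bound : ∀ w → S w ≡ true → n * (n * B₂ w) ≤ count (S ∖ w) * a₂ w
        B₂-bound w Sw = begin
          n * (n * B₂ w)
            ≤⟨ ℕ.*-monoʳ-≤ n (ℕ.*-monoʳ-≤ n (∑ⱽ-mono λ φ → ℕ.*-mono-≤
                 (indicator-mono (valid? S φ) (valid? (S ∖ w) φ) (Valid-⊆ (S ∖ w) S φ (S∖v⊆S S w)))
                 (ℕ.≤-reflexive (trans (cong (λ b → χ b * _) Sw) (ℕ.*-identityˡ _))))) ⟩
          n * (n * ∑ⱽ (λ φ → F φ * P₂ v w (lookup φ v) (lookup φ w)))
            ≡⟨ cong (n *_) (resample w (λ φ d → F φ * P₂ v w (lookup φ v) d) λ φ a d →
                 cong₂ (λ x c → x * P₂ v w c d) (valid-update (S ∖ w) w (v∉S∖v S w) φ a) (lookup∘updateAt′ v w v≢w φ)) ⟩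
          n * ∑ (λ d → ∑ⱽ λ φ → F φ * P₂ v w (lookup φ v) d)
            ≡⟨ *-distribˡ-∑ n (λ d → ∑ⱽ λ φ → F φ * P₂ v w (lookup φ v) d) ⟩
          ∑ (λ d → n * ∑ⱽ λ φ → F φ * P₂ v w (lookup φ v) d)
            ≡⟨ ∑-cong (λ d → trans
                 (resample v (λ φ c → F φ * P₂ v w c d) (λ φ a c → cong (_* P₂ v w c d) (valid-update (S ∖ w) v v∉S∖w φ a)))
                 (trans (∑-cong λ c → ∑ⱽ-*ʳ F (P₂ v w c d)) (sym (*-distribˡ-∑ (count (S ∖ w)) (λ c → P₂ v w c d))))) ⟩
          ∑ (λ d → count (S ∖ w) * ∑ λ c → P₂ v w c d)
            ≡⟨ sym (*-distribˡ-∑ (count (S ∖ w)) (λ d → ∑ λ c → P₂ v w c d)) ⟩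
          count (S ∖ w) * ∑ (λ d → ∑ λ c → P₂ v w c d)
            ≡⟨ cong (count (S ∖ w) *_) (∑-comm (λ d c → P₂ v w c d)) ⟩
          count (S ∖ w) * a₂ w ∎
          where
          open ℕ.≤-Reasoning
          F = valid (S ∖ w)
          v≢w : v ≢ w
          v≢w refl = contradiction (trans (sym Sw) Sv) λ ()
          v∉S∖w : (S ∖ w) v ≡ false
          v∉S∖w = cong (_∧ _) Sv

        a₃ : Fin m → Fin m → ℕ
        a₃ q r = ∑ λ c → ∑ λ d → ∑ λ e → P₃ v q r c d e

        B₃-bound : ∀ q r → S q ≡ true → (S ∖ q) r ≡ true → n * (n * (n * B₃ q r)) ≤ count ((S ∖ q) ∖ r) * a₃ q r
        B₃-bound q r Sq Sr = begin
          n * (n * (n * B₃ q r))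
            ≤⟨ ℕ.*-monoʳ-≤ n (ℕ.*-monoʳ-≤ n (ℕ.*-monoʳ-≤ n (∑ⱽ-mono λ φ → ℕ.*-mono-≤
                 (indicator-mono (valid? S φ) (valid? S″ φ) (Valid-⊆ S″ S φ (λ u → S∖v⊆S S q u ∘ S∖v⊆S (S ∖ q) r u)))
                 (ℕ.≤-reflexive (trans (cong (λ b → χ b * _) (trans (cong (_∧ (S r ∧ not (does (r Fin.≟ q)))) Sq) Sr)) (ℕ.*-identityˡ _)))))) ⟩
          n * (n * (n * ∑ⱽ (λ φ → F φ * P₃ v q r (lookup φ v) (lookup φ q) (lookup φ r))))
            ≡⟨ cong (λ x → n * (n * x)) (resample r (λ φ e → F φ * P₃ v q r (lookup φ v) (lookup φ q) e) λ φ a e →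
                 cong₂ (λ x y → x * y) (valid-update S″ r (v∉S∖v (S ∖ q) r) φ a)
                   (cong₂ (λ c d → P₃ v q r c d e) (lookup∘updateAt′ v r v≢r φ) (lookup∘updateAt′ q r q≢r φ))) ⟩
          n * (n * ∑ (λ e → ∑ⱽ λ φ → F φ * P₃ v q r (lookup φ v) (lookup φ q) e))
            ≡⟨ cong (n *_) (trans (*-distribˡ-∑ n (λ e → ∑ⱽ λ φ → F φ * P₃ v q r (lookup φ v) (lookup φ q) e)) (∑-cong λ e →
                 resample q (λ φ d → F φ * P₃ v q r (lookup φ v) d e) λ φ a d →
                 cong₂ (λ x c → x * P₃ v q r c d e) (valid-update S″ q q∉S″ φ a) (lookup∘updateAt′ v q v≢q φ))) ⟩
          n * ∑ (λ e → ∑ λ d → ∑ⱽ λ φ → F φ * P₃ v q r (lookup φ v) d e)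
            ≡⟨ trans (*-distribˡ-∑ n (λ e → ∑ λ d → ∑ⱽ λ φ → F φ * P₃ v q r (lookup φ v) d e)) (∑-cong λ e →
               trans (*-distribˡ-∑ n (λ d → ∑ⱽ λ φ → F φ * P₃ v q r (lookup φ v) d e)) (∑-cong λ d → trans
                 (resample v (λ φ c → F φ * P₃ v q r c d e) (λ φ a c → cong (_* P₃ v q r c d e) (valid-update S″ v v∉S″ φ a)))
                 (trans (∑-cong λ c → ∑ⱽ-*ʳ F (P₃ v q r c d e)) (sym (*-distribˡ-∑ (count S″) (λ c → P₃ v q r c d e)))))) ⟩
          ∑ (λ e → ∑ λ d → count S″ * ∑ λ c → P₃ v q r c d e)
            ≡⟨ trans (∑-cong λ e → sym (*-distribˡ-∑ (count S″) (λ d → ∑ λ c → P₃ v q r c d e)))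
                 (sym (*-distribˡ-∑ (count S″) (λ e → ∑ λ d → ∑ λ c → P₃ v q r c d e))) ⟩
          count S″ * ∑ (λ e → ∑ λ d → ∑ λ c → P₃ v q r c d e)
            ≡⟨ cong (count S″ *_) (trans (∑-cong λ e → ∑-comm (λ d c → P₃ v q r c d e))
                 (trans (∑-comm (λ e c → ∑ λ d → P₃ v q r c d e)) (∑-cong λ c → ∑-comm (λ e d → P₃ v q r c d e)))) ⟩
          count S″ * a₃ q r ∎
          where
          open ℕ.≤-Reasoning
          S″ = (S ∖ q) ∖ r
          F = valid S″
          v≢q : v ≢ q
          v≢q refl = contradiction (trans (sym Sq) Sv) λ ()
          v≢r : v ≢ r
          v≢r refl = contradiction (trans (sym (S∖v⊆S S q v Sr)) Sv) λ ()
          q≢r : q ≢ r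
          q≢r refl = contradiction (trans (sym Sr) (v∉S∖v S q)) λ ()
          q∉S″ : S″ q ≡ false
          q∉S″ = cong (_∧ _) (v∉S∖v S q)
          v∉S″ : S″ v ≡ false
          v∉S″ = cong (λ b → (b ∧ _) ∧ _) Sv

      -- Up to the factor g², which keeps everything in ℕ: nX ≤ nY + X(a₁ + a₂/g + a₃/g²) ≤ nY +
      -- X(a₁ + 2g) ≤ nY + X(n - g). Of the 3g set aside, two parts absorb pairs and triples and the
      -- third is the growth rate.
      growth-arith : ∀ g X Y b₁ b₂ b₃ a₁ a₂ a₃ → 0 < g → X ≤ Y + (b₁ + (b₂ + b₃)) →
        n * b₁ ≡ X * a₁ → n * (g * b₂) ≤ X * a₂ → n * (g * (g * b₃)) ≤ X * a₃ →
        a₁ + 3 * g ≤ n → a₂ ≤ g * g → a₃ ≤ g * g * g → g * X ≤ n * Y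
      growth-arith g X Y b₁ b₂ b₃ a₁ a₂ a₃ 0<g X≤ e₁ e₂ e₃ h₁ h₂ h₃ =
        ℕ.*-cancelˡ-≤ (g * g) {{ℕ.>-nonZero (ℕ.*-mono-< 0<g 0<g)}} (ℕ.+-cancelʳ-≤ K (g * g * (g * X)) (g * g * (n * Y)) (begin
          g * g * (g * X) + K
            ≡⟨ solve₁ g X a₁ ⟩
          (a₁ + 3 * g) * (g * g * X)
            ≤⟨ ℕ.*-monoˡ-≤ (g * g * X) h₁ ⟩
          n * (g * g * X)
            ≤⟨ ℕ.*-monoʳ-≤ n (ℕ.*-monoʳ-≤ (g * g) X≤) ⟩
          n * (g * g * (Y + (b₁ + (b₂ + b₃))))
            ≡⟨ solve₂ n g Y b₁ b₂ b₃ ⟩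
          g * g * (n * Y) + (g * g * (n * b₁) + (g * (n * (g * b₂)) + n * (g * (g * b₃))))
            ≤⟨ ℕ.+-monoʳ-≤ (g * g * (n * Y)) (ℕ.+-mono-≤ (ℕ.≤-reflexive (cong (g * g *_) e₁))
                 (ℕ.+-mono-≤ (ℕ.*-monoʳ-≤ g (ℕ.≤-trans e₂ (ℕ.*-monoʳ-≤ X h₂))) (ℕ.≤-trans e₃ (ℕ.*-monoʳ-≤ X h₃)))) ⟩
          g * g * (n * Y) + K ∎))
        where
        open ℕ.≤-Reasoning
        K = g * g * (X * a₁) + (g * (X * (g * g)) + X * (g * g * g))
        solve₁ : ∀ g X a → g * g * (g * X) + (g * g * (X * a) + (g * (X * (g * g)) + X * (g * g * g))) ≡ (a + 3 * g) * (g * g * X)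
        solve₁ = solve-∀
        solve₂ : ∀ n g Y b₁ b₂ b₃ → n * (g * g * (Y + (b₁ + (b₂ + b₃)))) ≡
          g * g * (n * Y) + (g * g * (n * b₁) + (g * (n * (g * b₂)) + n * (g * (g * b₃))))
        solve₂ = solve-∀

      module _ (g : ℕ) (0<g : 0 < g) (0<n : 0 < n) (T : Subset)
        (h₁ : ∀ v → T v ≡ true → A₁ v + 3 * g ≤ n)
        (h₂ : ∀ v → T v ≡ true → A₂ v ≤ g * g)
        (h₃ : ∀ v → T v ≡ true → A₃ v ≤ g * g * g) where

        private instance
          n-nonZero : ℕ.NonZero n
          n-nonZero = ℕ.>-nonZero 0<n

        -- Induction on a size bound, mutual with `drop`: the penalties at the new vertex are
        -- compared with counts over `S` less one or two vertices, and each such removal is a growth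
        -- step from a smaller set.
        grow : ∀ k S v → size S ≤ k → S ⊆ T → T v ≡ true → S v ≡ false → g * count S ≤ n * count (S ∪ v)

        drop : ∀ k S w → size S ≤ k → S ⊆ T → S w ≡ true → g * count (S ∖ w) ≤ n * count S
        drop zero    S w size≤ S⊆T Sw = contradiction (ℕ.<-≤-trans (size-∖ S w Sw) size≤) λ ()
        drop (suc k) S w size≤ S⊆T Sw = ℕ.≤-trans
          (grow k (S ∖ w) w (ℕ.s≤s⁻¹ (ℕ.<-≤-trans (size-∖ S w Sw) size≤)) (λ u → S⊆T u ∘ S∖v⊆S S w u) (S⊆T w Sw) (v∉S∖v S w))
          (ℕ.*-monoʳ-≤ n (count-⊆ {S} {(S ∖ w) ∪ w} (S⊆S∖v∪v S w)))

        grow k S v size≤ S⊆T Tv Sv =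
          growth-arith g (count S) (count (S ∪ v)) B₁ (∑ B₂) (∑ λ q → ∑ (B₃ q)) (A₁ v) (A₂ v) (A₃ v)
            0<g count≤ B₁-bound bound₂ bound₃ (h₁ v Tv) (h₂ v Tv) (h₃ v Tv)
          where
          open Step S v Sv
          open ℕ.≤-Reasoning
          X = count S

          each₂ : ∀ w → n * (g * B₂ w) ≤ X * a₂ w
          each₂ w = cases (S w) refl
            where
            arith₁ : ∀ n g b → n * (n * (g * b)) ≡ g * (n * (n * b))
            arith₁ = solve-∀
            cases : ∀ b → S w ≡ b → n * (g * B₂ w) ≤ X * a₂ w
            cases false Sw = subst (λ b → n * (g * b) ≤ X * a₂ w) (sym (B₂-off w Sw))
              (subst (_≤ X * a₂ w) (sym (trans (cong (n *_) (ℕ.*-zeroʳ g)) (ℕ.*-zeroʳ n))) z≤n)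
            cases true Sw = ℕ.*-cancelˡ-≤ n (begin
              n * (n * (g * B₂ w))             ≡⟨ arith₁ n g (B₂ w) ⟩
              g * (n * (n * B₂ w))             ≤⟨ ℕ.*-monoʳ-≤ g (B₂-bound w Sw) ⟩
              g * (count (S ∖ w) * a₂ w)       ≡⟨ sym (ℕ.*-assoc g _ _) ⟩
              g * count (S ∖ w) * a₂ w         ≤⟨ ℕ.*-monoˡ-≤ (a₂ w) (drop k S w size≤ S⊆T Sw) ⟩
              n * X * a₂ w                     ≡⟨ ℕ.*-assoc n X (a₂ w) ⟩
              n * (X * a₂ w)                   ∎)

          bound₂ : n * (g * ∑ B₂) ≤ X * A₂ v
          bound₂ = begin
            n * (g * ∑ B₂)               ≡⟨ trans (cong (n *_) (*-distribˡ-∑ g B₂)) (*-distribˡ-∑ n (λ w → g * B₂ w)) ⟩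
            ∑ (λ w → n * (g * B₂ w))     ≤⟨ ∑-mono each₂ ⟩
            ∑ (λ w → X * a₂ w)           ≡⟨ sym (*-distribˡ-∑ X a₂) ⟩
            X * A₂ v                     ∎

          each₃ : ∀ q r → n * (g * (g * B₃ q r)) ≤ X * a₃ q r
          each₃ q r = cases (S q) ((S ∖ q) r) refl refl
            where
            arith₂ : ∀ n g b → n * (n * (n * (g * (g * b)))) ≡ g * (g * (n * (n * (n * b))))
            arith₂ = solve-∀
            arith₃ : ∀ g n c a → g * (n * c * a) ≡ n * (g * c * a)
            arith₃ = solve-∀
            unselected : S q ∧ (S ∖ q) r ≡ false → n * (g * (g * B₃ q r)) ≤ X * a₃ q r
            unselected sel = subst (λ b → n * (g * (g * b)) ≤ X * a₃ q r) (sym (B₃-off q r sel))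
              (subst (_≤ X * a₃ q r) (sym (trans (cong (λ b → n * (g * b)) (ℕ.*-zeroʳ g))
                (trans (cong (n *_) (ℕ.*-zeroʳ g)) (ℕ.*-zeroʳ n)))) z≤n)
            cases : ∀ a b → S q ≡ a → (S ∖ q) r ≡ b → n * (g * (g * B₃ q r)) ≤ X * a₃ q r
            cases false b     Sq Sr = unselected (cong (_∧ (S ∖ q) r) Sq)
            cases true  false Sq Sr = unselected (cong₂ _∧_ Sq Sr)
            cases true  true  Sq Sr = ℕ.*-cancelˡ-≤ n (ℕ.*-cancelˡ-≤ n (begin
              n * (n * (n * (g * (g * B₃ q r))))        ≡⟨ arith₂ n g (B₃ q r) ⟩
              g * (g * (n * (n * (n * B₃ q r))))        ≤⟨ ℕ.*-monoʳ-≤ g (ℕ.*-monoʳ-≤ g (B₃-bound q r Sq Sr)) ⟩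
              g * (g * (count ((S ∖ q) ∖ r) * a₃ q r))  ≡⟨ cong (g *_) (sym (ℕ.*-assoc g _ _)) ⟩
              g * (g * count ((S ∖ q) ∖ r) * a₃ q r)    ≤⟨ ℕ.*-monoʳ-≤ g (ℕ.*-monoˡ-≤ (a₃ q r) (drop k (S ∖ q) r
                (ℕ.≤-trans (ℕ.<⇒≤ (size-∖ S q Sq)) size≤) (λ u → S⊆T u ∘ S∖v⊆S S q u) Sr)) ⟩
              g * (n * count (S ∖ q) * a₃ q r)          ≡⟨ arith₃ g n (count (S ∖ q)) (a₃ q r) ⟩
              n * (g * count (S ∖ q) * a₃ q r)          ≤⟨ ℕ.*-monoʳ-≤ n (ℕ.*-monoˡ-≤ (a₃ q r) (drop k S q size≤ S⊆T Sq)) ⟩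
              n * (n * X * a₃ q r)                      ≡⟨ cong (n *_) (ℕ.*-assoc n X (a₃ q r)) ⟩
              n * (n * (X * a₃ q r))                    ∎))

          bound₃ : n * (g * (g * ∑ λ q → ∑ (B₃ q))) ≤ X * A₃ v
          bound₃ = begin
            n * (g * (g * ∑ λ q → ∑ (B₃ q)))
              ≡⟨ trans (cong (λ b → n * (g * b)) (*-distribˡ-∑ g (λ q → ∑ (B₃ q))))
                   (trans (cong (n *_) (*-distribˡ-∑ g (λ q → g * ∑ (B₃ q)))) (trans (*-distribˡ-∑ n (λ q → g * (g * ∑ (B₃ q))))
                     (∑-cong λ q → trans (cong (λ b → n * (g * b)) (*-distribˡ-∑ g (B₃ q)))
                       (trans (cong (n *_) (*-distribˡ-∑ g (λ r → g * B₃ q r))) (*-distribˡ-∑ n (λ r → g * (g * B₃ q r))))))) ⟩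
            ∑ (λ q → ∑ λ r → n * (g * (g * B₃ q r)))
              ≤⟨ ∑-mono (λ q → ∑-mono (each₃ q)) ⟩
            ∑ (λ q → ∑ λ r → X * a₃ q r)
              ≡⟨ trans (∑-cong λ q → sym (*-distribˡ-∑ X (a₃ q))) (sym (*-distribˡ-∑ X (λ q → ∑ (a₃ q)))) ⟩
            X * A₃ v ∎

        -- The empty set admits all n^m assignments, and by `drop` a positive count stays positive
        -- with each vertex added.
        count-pos : ∀ k S → size S ≤ k → S ⊆ T → 0 < count S
        count-pos k S size≤ S⊆T with Fin.any? (λ w → S w Bool.≟ true)
        count-pos zero S size≤ S⊆T | yes (w , Sw) = contradiction (ℕ.<-≤-trans (size-∖ S w Sw) size≤) λ ()
        count-pos (suc k) S size≤ S⊆T | yes (w , Sw) = ℕ.n≢0⇒n>0 λ count≡0 → contradiction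
          (ℕ.<-≤-trans (ℕ.*-mono-< 0<g (count-pos k (S ∖ w) (ℕ.s≤s⁻¹ (ℕ.<-≤-trans (size-∖ S w Sw) size≤)) (λ u → S⊆T u ∘ S∖v⊆S S w u)))
            (subst (g * count (S ∖ w) ≤_) (trans (cong (n *_) count≡0) (ℕ.*-zeroʳ n)) (drop (suc k) S w size≤ S⊆T Sw))) λ ()
        count-pos k S size≤ S⊆T | no ∄w = ℕ.<-≤-trans (∑ⱽ-1-pos m 0<n) (∑ⱽ-mono λ φ →
          indicator-mono (yes tt) (valid? S φ) λ _ →
            (λ v Sv → contradiction (v , Sv) ∄w) , (λ v w Sv → contradiction (v , Sv) ∄w) , (λ u v w Su → contradiction (u , Su) ∄w))

        penalty-free : ∃[ φ ] Valid T φ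
        penalty-free with ∑ⱽ-pos (valid T) (count-pos (size T) T ℕ.≤-refl (λ _ p → p))
        ... | φ , 0<valid = φ , indicator-pos (valid? T φ) 0<valid
          where
          indicator-pos : ∀ {P : Set} (P? : Dec P) → 0 < indicator P? → P
          indicator-pos (yes p) _ = p

open Counting

-- Bounded error separates final states.

module Measurements where

  open +-*-Solver using (solve; _:+_; _:*_; _:-_; :-_; _:=_; con)
  open CommutativeRing ℝ-commutativeRing using () renaming
    ( semiring to ℝ-semiring ; reflexive to ≈-reflexive ; *-congˡ to *ᴿ-congˡ )
  open SemiringSum ℝ-semiring using (sum)

  ι : ℕ → ℚ
  ι k = ℤ.+ k ℚ./ 1

  ι-toℚᵘ : ∀ k → ℚ.toℚᵘ (ι k) ℚᵘ.≃ ℚᵘ.mkℚᵘ (ℤ.+ k) 0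
  ι-toℚᵘ k = ℚ.toℚᵘ-fromℚᵘ (ℚᵘ.mkℚᵘ (ℤ.+ k) 0)

  ι-+ : ∀ a b → ι (a ℕ.+ b) ≡ ι a ℚ.+ ι b
  ι-+ a b = ℚ.toℚᵘ-injective (begin
    ℚ.toℚᵘ (ι (a ℕ.+ b))                        ≈⟨ ι-toℚᵘ (a ℕ.+ b) ⟩
    ℚᵘ.mkℚᵘ (ℤ.+ (a ℕ.+ b)) 0                     ≈⟨ ℚᵘ.*≡* (cong (ℤ._* ℤ.+ 1) (sym (cong₂ ℤ._+_ (ℤ.*-identityʳ (ℤ.+ a)) (ℤ.*-identityʳ (ℤ.+ b))))) ⟩
    ℚᵘ.mkℚᵘ (ℤ.+ a) 0 ℚᵘ.+ ℚᵘ.mkℚᵘ (ℤ.+ b) 0         ≈⟨ ℚᵘ.+-cong (ℚᵘ.≃-sym (ι-toℚᵘ a)) (ℚᵘ.≃-sym (ι-toℚᵘ b)) ⟩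
    ℚ.toℚᵘ (ι a) ℚᵘ.+ ℚ.toℚᵘ (ι b)              ≈⟨ ℚᵘ.≃-sym (ℚ.toℚᵘ-homo-+ (ι a) (ι b)) ⟩
    ℚ.toℚᵘ (ι a ℚ.+ ι b)                        ∎)
    where open ℚᵘ.≃-Reasoning

  ι-* : ∀ a b → ι (a ℕ.* b) ≡ ι a ℚ.* ι b
  ι-* a b = ℚ.toℚᵘ-injective (begin
    ℚ.toℚᵘ (ι (a ℕ.* b))                        ≈⟨ ι-toℚᵘ (a ℕ.* b) ⟩
    ℚᵘ.mkℚᵘ (ℤ.+ (a ℕ.* b)) 0                     ≈⟨ ℚᵘ.*≡* (cong (ℤ._* ℤ.+ 1) (ℤ.pos-* a b)) ⟩
    ℚᵘ.mkℚᵘ (ℤ.+ a) 0 ℚᵘ.* ℚᵘ.mkℚᵘ (ℤ.+ b) 0         ≈⟨ ℚᵘ.*-cong (ℚᵘ.≃-sym (ι-toℚᵘ a)) (ℚᵘ.≃-sym (ι-toℚᵘ b)) ⟩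
    ℚ.toℚᵘ (ι a) ℚᵘ.* ℚ.toℚᵘ (ι b)              ≈⟨ ℚᵘ.≃-sym (ℚ.toℚᵘ-homo-* (ι a) (ι b)) ⟩
    ℚ.toℚᵘ (ι a ℚ.* ι b)                        ∎)
    where open ℚᵘ.≃-Reasoning

  ι-cancel-≤ : ∀ a b → ι a ℚ.≤ ι b → a ℕ.≤ b
  ι-cancel-≤ a b h with ℚᵘ.≤-respˡ-≃ (ι-toℚᵘ a) (ℚᵘ.≤-respʳ-≃ (ι-toℚᵘ b) (ℚ.toℚᵘ-mono-≤ h))
  ... | ℚᵘ.*≤* p = ℤ.drop‿+≤+ (subst₂ ℤ._≤_ (ℤ.*-identityʳ (ℤ.+ a)) (ℤ.*-identityʳ (ℤ.+ b)) p)

  ι-pos : ∀ k → 0ℚ ℚ.< ι (suc k)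
  ι-pos k = ℚ.toℚᵘ-cancel-< (ℚᵘ.<-respʳ-≃ (ℚᵘ.≃-sym (ι-toℚᵘ (suc k))) (ℚᵘ.*<* (ℤ.+<+ (ℕ.s≤s ℕ.z≤n))))

  ≤-from-nonNeg : ∀ {p q} r → 0ℚ ℚ.≤ r → p ℚ.+ r ≡ q → p ℚ.≤ q
  ≤-from-nonNeg {p} {q} r 0≤r eq = subst₂ ℚ._≤_ (ℚ.+-identityʳ p) eq (ℚ.+-monoʳ-≤ p 0≤r)

  -- For z = a + bi and w = c + di the difference of the sides is 3|2z - 3w|². At the extreme output
  -- probabilities 2/3 and 1/3 the amplitudes have ratio √2, for which 3/2 is the rational
  -- substitute; `weighted₂` is the other outcome.
  weighted₁ : ∀ a b c d → ι 36 ℚ.* (a ℚ.* c ℚ.+ ℚ.- ((ℚ.- b) ℚ.* d)) ℚ.+ ι 15 ℚ.* ((a ℚ.* a ℚ.+ b ℚ.* b) ℚ.+ 0ℚ) ℚ.≤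
    ι 27 ℚ.* ((a ℚ.* a ℚ.+ b ℚ.* b) ℚ.+ (c ℚ.* c ℚ.+ d ℚ.* d))
  weighted₁ a b c d = ≤-from-nonNeg (r ℚ.+ (r ℚ.+ r)) (ℚ.+-mono-≤ 0≤r (ℚ.+-mono-≤ 0≤r 0≤r))
    (solve 4 (λ a b c d →
      let u = con (ι 2) :* a :- con (ι 3) :* c ; v = con (ι 2) :* b :- con (ι 3) :* d ; r = u :* u :+ v :* v in
      con (ι 36) :* (a :* c :+ :- ((:- b) :* d)) :+ con (ι 15) :* ((a :* a :+ b :* b) :+ con 0ℚ) :+ (r :+ (r :+ r))
      := con (ι 27) :* ((a :* a :+ b :* b) :+ (c :* c :+ d :* d))) refl a b c d)
    where
    u = ι 2 ℚ.* a ℚ.- ι 3 ℚ.* c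
    v = ι 2 ℚ.* b ℚ.- ι 3 ℚ.* d
    r = u ℚ.* u ℚ.+ v ℚ.* v
    0≤r = ℚ.+-mono-≤ (0≤p*p u) (0≤p*p v)

  weighted₂ : ∀ a b c d → ι 36 ℚ.* (a ℚ.* c ℚ.+ ℚ.- ((ℚ.- b) ℚ.* d)) ℚ.+ ι 15 ℚ.* (0ℚ ℚ.+ (c ℚ.* c ℚ.+ d ℚ.* d)) ℚ.≤
    ι 27 ℚ.* ((a ℚ.* a ℚ.+ b ℚ.* b) ℚ.+ (c ℚ.* c ℚ.+ d ℚ.* d))
  weighted₂ a b c d = ≤-from-nonNeg (r ℚ.+ (r ℚ.+ r)) (ℚ.+-mono-≤ 0≤r (ℚ.+-mono-≤ 0≤r 0≤r))
    (solve 4 (λ a b c d →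
      let u = con (ι 3) :* a :- con (ι 2) :* c ; v = con (ι 3) :* b :- con (ι 2) :* d ; r = u :* u :+ v :* v in
      con (ι 36) :* (a :* c :+ :- ((:- b) :* d)) :+ con (ι 15) :* (con 0ℚ :+ (c :* c :+ d :* d)) :+ (r :+ (r :+ r))
      := con (ι 27) :* ((a :* a :+ b :* b) :+ (c :* c :+ d :* d))) refl a b c d)
    where
    u = ι 3 ℚ.* a ℚ.- ι 2 ℚ.* c
    v = ι 3 ℚ.* b ℚ.- ι 2 ℚ.* d
    r = u ℚ.* u ℚ.+ v ℚ.* v
    0≤r = ℚ.+-mono-≤ (0≤p*p u) (0≤p*p v)

  sum-weigh : ∀ {N} (S : Fin N → Bool) → sum (λ i → if S i then 1ᴿ else 0ᴿ) ≈ fromℕ (∑ (λ i → χ (S i)))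
  sum-weigh {zero}  S = ≗⇒≈ λ _ → refl
  sum-weigh {suc N} S = ≈-trans (+ᴿ-cong {y = sum (λ i → if S (suc i) then 1ᴿ else 0ᴿ)} (head (S zero)) (sum-weigh (S ∘ suc)))
    (≗⇒≈ λ _ → sym (ι-+ (χ (S zero)) (∑ (λ i → χ (S (suc i))))))
    where
    head : ∀ b → (if b then 1ᴿ else 0ᴿ) ≈ fromℕ (χ b)
    head true  = ≗⇒≈ λ _ → refl
    head false = ≗⇒≈ λ _ → refl

  module _ {N W : ℕ} where
    private
      St = State {N} {W}
    open BasisSum ℝ-commutativeRing {N} {W} using (Σᴮ; Σ-+; Σ-*ˡ; Σ-δ; Σᴮ-unfold)

    normSq-ket : ∀ s → normSq (ket {N} {W} s) ≈ 1ᴿ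
    normSq-ket s = ≈-trans (Σ-δ (λ t → ∣ ket {N} {W} s t ∣²) s off) on
      where
      _≟ᴮ_ = ≡-dec Fin._≟_ (≡-dec Bool._≟_ (Fin._≟_ {W}))
      on : ∣ ket {N} {W} s s ∣² ≈ 1ᴿ
      on = ≈-trans (≈-reflexive (cong (λ b → ∣ (if b then 1ᶜ else 0ᶜ) ∣²) (dec-true (s ≟ᴮ s) refl))) (≗⇒≈ λ _ → refl)
      off : ∀ t → t ≢ s → ∣ ket {N} {W} s t ∣² ≈ 0ᴿ
      off t t≢s = ≈-trans (≈-reflexive (cong (λ b → ∣ (if b then 1ᶜ else 0ᶜ) ∣²) (dec-false (s ≟ᴮ t) (t≢s ∘ sym)))) (≗⇒≈ λ _ → refl)

    module _ (out : Basis N W → Bool) where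

      part : Bool → St → Basis N W → ℝ
      part a ψ s = if does (out s Bool.≟ a) then ∣ ψ s ∣² else 0ᴿ

      outputProb-Σ : ∀ ψ a → outputProb {N} {W} out ψ a ≡ Σᴮ (part a ψ)
      outputProb-Σ ψ a = sym (Σᴮ-unfold (part a ψ))

      36ᴿ 15ᴿ 27ᴿ : ℝ
      36ᴿ = fromℕ 36
      15ᴿ = fromℕ 15
      27ᴿ = fromℕ 27

      pointwise : ∀ a ψ φ s → 36ᴿ *ᴿ cross ψ φ s +ᴿ 15ᴿ *ᴿ (part a ψ s +ᴿ part (not a) φ s) ≲ 27ᴿ *ᴿ (∣ ψ s ∣² +ᴿ ∣ φ s ∣²)
      pointwise a ψ φ s = cases a (out s)
        where
        cases : ∀ a b → 36ᴿ *ᴿ cross ψ φ s +ᴿ 15ᴿ *ᴿ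
          ((if does (b Bool.≟ a) then ∣ ψ s ∣² else 0ᴿ) +ᴿ (if does (b Bool.≟ not a) then ∣ φ s ∣² else 0ᴿ))
          ≲ 27ᴿ *ᴿ (∣ ψ s ∣² +ᴿ ∣ φ s ∣²)
        cases true  true  = ≗⇒≲ λ n → weighted₁ (seq (re (ψ s)) n) (seq (im (ψ s)) n) (seq (re (φ s)) n) (seq (im (φ s)) n)
        cases false false = ≗⇒≲ λ n → weighted₁ (seq (re (ψ s)) n) (seq (im (ψ s)) n) (seq (re (φ s)) n) (seq (im (φ s)) n)
        cases true  false = ≗⇒≲ λ n → weighted₂ (seq (re (ψ s)) n) (seq (im (ψ s)) n) (seq (re (φ s)) n) (seq (im (φ s)) n)
        cases false true  = ≗⇒≲ λ n → weighted₂ (seq (re (ψ s)) n) (seq (im (ψ s)) n) (seq (re (φ s)) n) (seq (im (φ s)) n)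

      -- Summing `pointwise` over the basis gives 36 Re⟨ψ|φ⟩ + 15 (p + p′) ≤ 54, and p + p′ is at
      -- least 4/3. The resulting bound 17/18 on the overlap is barely weaker than the sharp value
      -- 2√2/3.
      rip-separated : ∀ a ψ φ → normSq ψ ≈ 1ᴿ → normSq φ ≈ 1ᴿ →
        fromℚ (ℤ.+ 2 ℚ./ 3) ≤ᴿ outputProb {N} {W} out ψ a → fromℚ (ℤ.+ 2 ℚ./ 3) ≤ᴿ outputProb {N} {W} out φ (not a) →
        36ᴿ *ᴿ rip ψ φ ≲ fromℕ 34
      rip-separated a ψ φ ∥ψ∥ ∥φ∥ pψ pφ =
        ≲-trans {y = (36ᴿ *ᴿ rip ψ φ +ᴿ fromℕ 20) +ᴿ fromℚ (ℚ.- ι 20)}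
          (≈⇒≲ (cancel (36ᴿ *ᴿ rip ψ φ)))
          (≲-trans {y = fromℕ 54 +ᴿ fromℚ (ℚ.- ι 20)} (+ᴿ-mono (≲-trans {y = 36ᴿ *ᴿ rip ψ φ +ᴿ 15ᴿ *ᴿ (p +ᴿ p′)}
            (+ᴿ-mono {x = 36ᴿ *ᴿ rip ψ φ} ≲-refl lower) upper) ≲-refl) (≈⇒≲ (≗⇒≈ λ _ → refl)))
        where
        p p′ : ℝ
        p = Σᴮ (part a ψ)
        p′ = Σᴮ (part (not a) φ)
        cancel : ∀ x → x ≈ (x +ᴿ fromℕ 20) +ᴿ fromℚ (ℚ.- ι 20)
        cancel x = ≗⇒≈ λ n → solve 2 (λ a b → a := (a :+ b) :+ :- b) refl (seq x n) (ι 20)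
        lower : fromℕ 20 ≲ 15ᴿ *ᴿ (p +ᴿ p′)
        lower = ≲-trans {y = 15ᴿ *ᴿ (fromℚ (ℤ.+ 2 ℚ./ 3) +ᴿ fromℚ (ℤ.+ 2 ℚ./ 3))} (≈⇒≲ (≗⇒≈ λ _ → refl))
          (*ᴿ-monoʳ-pos (ι 15) (ι-pos 14) (+ᴿ-mono
            (subst (fromℚ (ℤ.+ 2 ℚ./ 3) ≲_) (outputProb-Σ ψ a) (mk≲ pψ))
            (subst (fromℚ (ℤ.+ 2 ℚ./ 3) ≲_) (outputProb-Σ φ (not a)) (mk≲ pφ))))
        left right : Basis N W → ℝ
        left s = 36ᴿ *ᴿ cross ψ φ s +ᴿ 15ᴿ *ᴿ (part a ψ s +ᴿ part (not a) φ s)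
        right s = 27ᴿ *ᴿ (∣ ψ s ∣² +ᴿ ∣ φ s ∣²)
        left-Σ : Σᴮ left ≈ 36ᴿ *ᴿ rip ψ φ +ᴿ 15ᴿ *ᴿ (p +ᴿ p′)
        left-Σ = ≈-trans (Σ-+ (λ s → 36ᴿ *ᴿ cross ψ φ s) (λ s → 15ᴿ *ᴿ (part a ψ s +ᴿ part (not a) φ s)))
          (+ᴿ-cong (≈-sym (Σ-*ˡ 36ᴿ (cross ψ φ)))
            (≈-trans (≈-sym (Σ-*ˡ 15ᴿ (λ s → part a ψ s +ᴿ part (not a) φ s))) (*ᴿ-congˡ (Σ-+ (part a ψ) (part (not a) φ)))))
        right-Σ : Σᴮ right ≈ fromℕ 54
        right-Σ = ≈-trans (≈-sym (Σ-*ˡ 27ᴿ (λ s → ∣ ψ s ∣² +ᴿ ∣ φ s ∣²)))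
          (≈-trans (*ᴿ-congˡ (≈-trans (Σ-+ (λ s → ∣ ψ s ∣²) (λ s → ∣ φ s ∣²)) (+ᴿ-cong ∥ψ∥ ∥φ∥))) (≗⇒≈ λ _ → refl))
        upper : 36ᴿ *ᴿ rip ψ φ +ᴿ 15ᴿ *ᴿ (p +ᴿ p′) ≲ fromℕ 54
        upper = ≲-trans {y = Σᴮ left} (≈⇒≲ (≈-sym left-Σ))
          (≲-trans {y = Σᴮ right} (Σ-mono {f = left} {g = right} (pointwise a ψ φ)) (≈⇒≲ right-Σ))

open Measurements

-- The number of sensitive bits is at most 1369 T².

module Sensitivity where

  open +-*-Solver using (solve; _:+_; _:*_; _:=_; con)
  open CommutativeRing ℝ-commutativeRing using () renaming
    ( semiring to ℝ-semiring ; *-congˡ to *ᴿ-congˡ )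
  open SemiringSum ℝ-semiring using (sum; *-distribˡ-sum)

  -- The hypothesis is τs ≤ 18T(τ² + s) with τ = 36T + 1. This τ exceeds twice 18T, so the term 18Ts
  -- is absorbed and s ≤ τ² ≤ (37T)² remains. The added 1 lets T = 0 force s = 0.
  final-arith : ∀ T s → (36 ℕ.* T ℕ.+ 1) ℕ.* s ℕ.≤ 18 ℕ.* (T ℕ.* ((36 ℕ.* T ℕ.+ 1) ℕ.* (36 ℕ.* T ℕ.+ 1) ℕ.+ s)) →
    s ℕ.≤ 1369 ℕ.* (T ℕ.* T)
  final-arith zero s h = subst (ℕ._≤ 0) (ℕ.+-identityʳ s) h
  final-arith T@(suc T′) s h = ℕ.≤-trans (ℕ.*-cancelˡ-≤ (18 ℕ.* T ℕ.+ 1) (ℕ.+-cancelʳ-≤ (18 ℕ.* T ℕ.* s) _ _ (begin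
    (18 ℕ.* T ℕ.+ 1) ℕ.* s ℕ.+ 18 ℕ.* T ℕ.* s                       ≡⟨ solve₁ T s ⟩
    τ ℕ.* s                                                         ≤⟨ h ⟩
    18 ℕ.* (T ℕ.* (τ ℕ.* τ ℕ.+ s))                                  ≡⟨ solve₂ T s (τ ℕ.* τ) ⟩
    18 ℕ.* T ℕ.* (τ ℕ.* τ) ℕ.+ 18 ℕ.* T ℕ.* s                       ≤⟨ ℕ.+-monoˡ-≤ (18 ℕ.* T ℕ.* s) (ℕ.*-monoˡ-≤ (τ ℕ.* τ) (ℕ.m≤m+n (18 ℕ.* T) 1)) ⟩
    (18 ℕ.* T ℕ.+ 1) ℕ.* (τ ℕ.* τ) ℕ.+ 18 ℕ.* T ℕ.* s               ∎)))
    (begin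
      τ ℕ.* τ                       ≤⟨ ℕ.*-mono-≤ τ≤ τ≤ ⟩
      (37 ℕ.* T) ℕ.* (37 ℕ.* T)     ≡⟨ solve₃ T ⟩
      1369 ℕ.* (T ℕ.* T)            ∎)
    where
    open ℕ.≤-Reasoning
    τ = 36 ℕ.* T ℕ.+ 1
    τ≤ : τ ℕ.≤ 37 ℕ.* T
    τ≤ = ℕ.≤-trans (ℕ.+-monoʳ-≤ (36 ℕ.* T) (ℕ.s≤s ℕ.z≤n)) (ℕ.≤-reflexive (solve₄ T))
      where
      solve₄ : ∀ T → 36 ℕ.* T ℕ.+ T ≡ 37 ℕ.* T
      solve₄ = solve-∀
    solve₁ : ∀ T s → (18 ℕ.* T ℕ.+ 1) ℕ.* s ℕ.+ 18 ℕ.* T ℕ.* s ≡ (36 ℕ.* T ℕ.+ 1) ℕ.* s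
    solve₁ = solve-∀
    solve₂ : ∀ T s x → 18 ℕ.* (T ℕ.* (x ℕ.+ s)) ≡ 18 ℕ.* T ℕ.* x ℕ.+ 18 ℕ.* T ℕ.* s
    solve₂ = solve-∀
    solve₃ : ∀ T → (37 ℕ.* T) ℕ.* (37 ℕ.* T) ≡ 1369 ℕ.* (T ℕ.* T)
    solve₃ = solve-∀

  module _ {N T : ℕ} (A : Algorithm N T) (f : (Fin N → Bool) → Bool) (computes : ComputesBoundedError A f)
    (x : Fin N → Bool) (S : Fin N → Bool) (sensitive : ∀ i → S i ≡ true → f (flipAt i x) ≡ not (f x)) where

    open Algorithm A using (W; start; U₀; Us; output)

    private
      τ s : ℕ
      τ = 36 ℕ.* T ℕ.+ 1
      s = ∑ λ i → χ (S i)

    open Hybrid {N} {W} τ S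

    ψ₀ : State {N} {W}
    ψ₀ = apply U₀ (ket {N} {W} start)

    end : (Fin N → Bool) → State {N} {W}
    end y = run {N} {W} y Us ψ₀

    ∥ψ₀∥ : normSq ψ₀ ≈ 1ᴿ
    ∥ψ₀∥ = ≈-trans {normSq ψ₀} {normSq (ket {N} {W} start)} {1ᴿ} (normSq-unitary U₀ (ket {N} {W} start)) (normSq-ket start)

    ∥end∥ : ∀ y → normSq (end y) ≈ 1ᴿ
    ∥end∥ y = ≈-trans {normSq (end y)} {normSq ψ₀} {1ᴿ} (normSq-run y Us ψ₀) ∥ψ₀∥

    initial : progress ψ₀ (λ _ → ψ₀) ≈ σ
    initial = sum-≈ (λ i → weigh (S i) (rip ψ₀ ψ₀)) (λ i → weigh (S i) 1ᴿ) λ i → cases (S i)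
      where
      cases : ∀ b → weigh b (rip ψ₀ ψ₀) ≈ weigh b 1ᴿ
      cases true  = ≈-trans {rip ψ₀ ψ₀} {normSq ψ₀} {1ᴿ} (≈-sym (normSq≈rip ψ₀)) ∥ψ₀∥
      cases false = ≈-refl {0ᴿ}

    terminal : fromℕ 36 *ᴿ progress (end x) (λ i → end (flipAt i x)) ≲ fromℕ 34 *ᴿ σ
    terminal = ≲-trans {y = sum before}
      (≈⇒≲ (*-distribˡ-sum (fromℕ 36) (λ i → weigh (S i) (rip (end x) (end (flipAt i x))))))
      (≲-trans {y = sum after} (sum-mono {f = before} {g = after} (λ i → cases i (S i) refl))
        (≈⇒≲ (≈-sym (*-distribˡ-sum (fromℕ 34) (λ i → weigh (S i) 1ᴿ)))))
      where
      before after : Fin N → ℝ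
      before i = fromℕ 36 *ᴿ weigh (S i) (rip (end x) (end (flipAt i x)))
      after i = fromℕ 34 *ᴿ weigh (S i) 1ᴿ
      cases : ∀ i b → S i ≡ b → fromℕ 36 *ᴿ weigh b (rip (end x) (end (flipAt i x))) ≲ fromℕ 34 *ᴿ weigh b 1ᴿ
      cases i false _  = ≗⇒≲ λ _ → ℚ.≤-refl
      cases i true  Si = ≲-trans {y = fromℕ 34}
        (rip-separated output (f x) (end x) (end (flipAt i x)) (∥end∥ x) (∥end∥ (flipAt i x)) (computes x)
          (subst (λ b → fromℚ (ℤ.+ 2 ℚ./ 3) ≤ᴿ outputProb {N} {W} output (end (flipAt i x)) b) (sensitive i Si) (computes (flipAt i x))))
        (≈⇒≲ (≗⇒≈ λ _ → refl))

    times-ι : ∀ k c → times k (fromℚ c) ≈ fromℚ (ι k ℚ.* c)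
    times-ι zero    c = ≗⇒≈ λ _ → sym (ℚ.*-zeroˡ c)
    times-ι (suc k) c = ≈-trans {y = fromℚ c +ᴿ fromℚ (ι k ℚ.* c)} (+ᴿ-cong {fromℚ c} ≈-refl (times-ι k c))
      (≗⇒≈ λ _ → trans (solve 2 (λ c k → c :+ k :* c := (con 1ℚ :+ k) :* c) refl c (ι k)) (cong (ℚ._* c) (sym (ι-+ 1 k))))

    times-cong : ∀ k {r r′} → r ≈ r′ → times k r ≈ times k r′
    times-cong zero    r≈r′ = ≈-refl {0ᴿ}
    times-cong (suc k) r≈r′ = +ᴿ-cong r≈r′ (times-cong k r≈r′)

    private
      q c : ℚ
      q = ι τ
      c = (q ℚ.* q ℚ.+ ι s) ℚ.+ (q ℚ.* q ℚ.+ ι s)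

    0<q : 0ℚ ℚ.< q
    0<q = subst (λ k → 0ℚ ℚ.< ι k) (ℕ.+-comm 1 (36 ℕ.* T)) (ι-pos (36 ℕ.* T))

    σ≈s : σ ≈ fromℕ s
    σ≈s = sum-weigh S

    -- The whole hybrid estimate over ℚ: 36 · 2τs for the initial overlaps, at most 2τ · 34s for the
    -- final ones plus 36 times the loss 2T(τ² + s).
    rational : fromℚ (ι 36 ℚ.* ((q ℚ.+ q) ℚ.* ι s)) ≲ fromℚ ((q ℚ.+ q) ℚ.* (ι 34 ℚ.* ι s) ℚ.+ ι 36 ℚ.* (ι T ℚ.* c))
    rational =
      ≲-trans {y = fromℕ 36 *ᴿ (K *ᴿ progress ψ₀ (λ _ → ψ₀))}
        (≈⇒≲ (≈-trans {y = fromℕ 36 *ᴿ (K *ᴿ fromℕ s)} (≗⇒≈ λ _ → refl)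
          (*ᴿ-congˡ (*ᴿ-congˡ (≈-trans {fromℕ s} {σ} {progress ψ₀ (λ _ → ψ₀)} (≈-sym σ≈s) (≈-sym initial))))))
      (≲-trans {y = fromℕ 36 *ᴿ (K *ᴿ P +ᴿ times T C)}
        (*ᴿ-monoʳ-pos (ι 36) (ι-pos 35) (progress-run x Us ψ₀ (λ _ → ψ₀) ∥ψ₀∥ (λ _ → ∥ψ₀∥)))
      (≲-trans {y = fromℚ (q ℚ.+ q) *ᴿ (fromℕ 36 *ᴿ P) +ᴿ fromℕ 36 *ᴿ times T C}
        (≈⇒≲ (regroup P (times T C)))
      (≲-trans {y = fromℚ (q ℚ.+ q) *ᴿ (fromℕ 34 *ᴿ σ) +ᴿ fromℕ 36 *ᴿ times T C}
        (+ᴿ-mono (*ᴿ-monoʳ-pos (q ℚ.+ q) (ℚ.+-mono-< 0<q 0<q) terminal) (≲-refl {fromℕ 36 *ᴿ times T C}))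
        (≈⇒≲ (≈-trans {y = fromℚ (q ℚ.+ q) *ᴿ (fromℕ 34 *ᴿ fromℕ s) +ᴿ fromℕ 36 *ᴿ fromℚ (ι T ℚ.* c)}
          (+ᴿ-cong (*ᴿ-congˡ (*ᴿ-congˡ σ≈s)) (*ᴿ-congˡ (≈-trans {times T C} {times T (fromℚ c)} {fromℚ (ι T ℚ.* c)}
            (times-cong T C≈c) (times-ι T c))))
          (≗⇒≈ λ _ → refl))))))
      where
      P : ℝ
      P = progress (end x) (λ i → end (flipAt i x))
      regroup : ∀ a b → fromℕ 36 *ᴿ (K *ᴿ a +ᴿ b) ≈ fromℚ (q ℚ.+ q) *ᴿ (fromℕ 36 *ᴿ a) +ᴿ fromℕ 36 *ᴿ b
      regroup a b = ≗⇒≈ λ n → solve 4 (λ h k a b → h :* (k :* a :+ b) := k :* (h :* a) :+ h :* b) refl (ι 36) (q ℚ.+ q) (seq a n) (seq b n)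
      C≈c : C ≈ fromℚ c
      C≈c = ≈-trans {y = (t *ᴿ t +ᴿ fromℕ s) +ᴿ (t *ᴿ t +ᴿ fromℕ s)}
        (+ᴿ-cong (+ᴿ-cong {t *ᴿ t} ≈-refl σ≈s) (+ᴿ-cong {t *ᴿ t} ≈-refl σ≈s)) (≗⇒≈ λ _ → refl)

    sensitivity-bound : s ℕ.≤ 1369 ℕ.* (T ℕ.* T)
    -- Both sides contain 68τs, from 2τ · 34s on the right. After cancellation, four times the
    -- hypothesis of `final-arith` is left.
    sensitivity-bound = final-arith T s (ℕ.*-cancelˡ-≤ 4 (ℕ.+-cancelˡ-≤ (68 ℕ.* (τ ℕ.* s)) _ _ (ι-cancel-≤ _ _
      (subst₂ ℚ._≤_ (sym lhs) (sym rhs) (fromℚ-cancel-≲ rational)))))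
      where
      lhs : ι (68 ℕ.* (τ ℕ.* s) ℕ.+ 4 ℕ.* (τ ℕ.* s)) ≡ ι 36 ℚ.* ((q ℚ.+ q) ℚ.* ι s)
      lhs = trans (ι-+ (68 ℕ.* (τ ℕ.* s)) (4 ℕ.* (τ ℕ.* s))) (trans
        (cong₂ ℚ._+_ (trans (ι-* 68 (τ ℕ.* s)) (cong (ι 68 ℚ.*_) (ι-* τ s))) (trans (ι-* 4 (τ ℕ.* s)) (cong (ι 4 ℚ.*_) (ι-* τ s))))
        (solve 2 (λ q s → con (ι 68) :* (q :* s) :+ con (ι 4) :* (q :* s) := con (ι 36) :* ((q :+ q) :* s)) refl q (ι s)))
      rhs : ι (68 ℕ.* (τ ℕ.* s) ℕ.+ 4 ℕ.* (18 ℕ.* (T ℕ.* (τ ℕ.* τ ℕ.+ s)))) ≡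
        (q ℚ.+ q) ℚ.* (ι 34 ℚ.* ι s) ℚ.+ ι 36 ℚ.* (ι T ℚ.* c)
      rhs = trans (ι-+ (68 ℕ.* (τ ℕ.* s)) _) (trans
        (cong₂ ℚ._+_ (trans (ι-* 68 (τ ℕ.* s)) (cong (ι 68 ℚ.*_) (ι-* τ s)))
          (trans (ι-* 4 (18 ℕ.* (T ℕ.* (τ ℕ.* τ ℕ.+ s)))) (cong (ι 4 ℚ.*_) (trans (ι-* 18 (T ℕ.* (τ ℕ.* τ ℕ.+ s))) (cong (ι 18 ℚ.*_)
            (trans (ι-* T (τ ℕ.* τ ℕ.+ s)) (cong (ι T ℚ.*_) (trans (ι-+ (τ ℕ.* τ) s) (cong (ℚ._+ ι s) (ι-* τ τ))))))))))
        (solve 3 (λ q s T → con (ι 68) :* (q :* s) :+ con (ι 4) :* (con (ι 18) :* (T :* (q :* q :+ s)))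
          := (q :+ q) :* (con (ι 34) :* s) :+ con (ι 36) :* (T :* ((q :* q :+ s) :+ (q :* q :+ s)))) refl q (ι s) (ι T)))

open Sensitivity

-- Symmetric weights on triples, and placing vertices far apart.

module Weights where

  ∑-zero : ∀ {n} → ∑ {n} (λ _ → 0) ≡ 0
  ∑-zero {n} = trans (∑-const n 0) (ℕ.*-zeroʳ n)

  ∑⁵-zero : ∀ {n} → ∑ {n} (λ _ → ∑ {n} λ _ → ∑ {n} λ _ → ∑ {n} λ _ → ∑ {n} λ _ → 0) ≡ 0
  ∑⁵-zero {n} = trans (∑-cong {n} λ _ → trans (∑-cong {n} λ _ → trans (∑-cong {n} λ _ → trans (∑-cong {n} λ _ → ∑-zero {n})
    (∑-zero {n})) (∑-zero {n})) (∑-zero {n})) (∑-zero {n})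

  ⟦_≟_⟧ : ∀ {n} → Fin n → Fin n → ℕ
  ⟦ c ≟ d ⟧ = χ (does (c Fin.≟ d))

  ⟦≟⟧-sym : ∀ {n} (c d : Fin n) → ⟦ c ≟ d ⟧ ≡ ⟦ d ≟ c ⟧
  ⟦≟⟧-sym c d with c Fin.≟ d | d Fin.≟ c
  ... | yes _    | yes _   = refl
  ... | no  _    | no  _   = refl
  ... | yes refl | no c≢c  = contradiction refl c≢c
  ... | no c≢d   | yes d≡c = contradiction (sym d≡c) c≢d

  ⟦≟⟧≡0⇒≢ : ∀ {n} {c d : Fin n} → ⟦ c ≟ d ⟧ ≡ 0 → c ≢ d
  ⟦≟⟧≡0⇒≢ {c = c} {d} eq≡0 c≡d with trans (sym eq≡0) (cong χ (dec-true (c Fin.≟ d) c≡d))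
  ... | ()

  ∑-⟦≟⟧ : ∀ {n} (c : Fin n) → ∑ (λ d → ⟦ c ≟ d ⟧) ≡ 1
  ∑-⟦≟⟧ {suc n} zero    = cong suc (∑-zero {n})
  ∑-⟦≟⟧ {suc n} (suc c) = ∑-⟦≟⟧ c

  ∑-⟦≟⟧ˡ : ∀ {n} (d : Fin n) → ∑ (λ c → ⟦ c ≟ d ⟧) ≡ 1
  ∑-⟦≟⟧ˡ d = trans (∑-cong λ c → ⟦≟⟧-sym c d) (∑-⟦≟⟧ d)

  χ-not≡0⇒true : ∀ {b} → χ (not b) ≡ 0 → b ≡ true
  χ-not≡0⇒true {true} _ = refl

  χ*-≡0 : ∀ {b k} → b ≡ true → χ b * k ≡ 0 → k ≡ 0
  χ*-≡0 {k = k} refl eq = trans (sym (ℕ.*-identityˡ k)) eq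

  χ*≤ : ∀ b k → χ b * k ≤ k
  χ*≤ true  k = ℕ.≤-reflexive (ℕ.*-identityˡ k)
  χ*≤ false k = z≤n

  ∧⁻ : ∀ {a b} → a ∧ b ≡ true → a ≡ true × b ≡ true
  ∧⁻ {true} {true} _ = refl , refl

  ∧⁺ : ∀ {a b} → a ≡ true → b ≡ true → a ∧ b ≡ true
  ∧⁺ refl refl = refl

  does⁻ : ∀ {P : Set} (P? : Dec P) → does P? ≡ true → P
  does⁻ (yes p) _ = p

  not-does⁻ : ∀ {P : Set} (P? : Dec P) → does P? ≡ false → ¬ P
  not-does⁻ (no ¬p) _ = ¬p

  markov : ∀ {n} (b : Fin n → Bool) (F : Fin n → ℕ) k → (∀ i → b i ≡ true → k ≤ F i) → ∑ (λ i → χ (b i)) * k ≤ ∑ F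
  markov b F k k≤F = ℕ.≤-trans (ℕ.≤-reflexive (*-distribʳ-∑ k (λ i → χ (b i)))) (∑-mono λ i → cases i (b i) refl)
    where
    cases : ∀ i c → b i ≡ c → χ c * k ≤ F i
    cases i true  bi = ℕ.≤-trans (ℕ.≤-reflexive (ℕ.*-identityˡ k)) (k≤F i bi)
    cases i false bi = z≤n

  module _ {n : ℕ} where

    -- A hypergraph is treated as a weight on ordered triples with repetitions allowed, so that all
    -- sums run over unrestricted indices. A hyperedge then counts 3³ = 27 times in `total`, the
    -- source of every 27 below.
    Weight : Set
    Weight = Fin n → Fin n → Fin n → ℕ

    record Symmetric (h : Weight) : Set where
      field
        swap₁₂ : ∀ a b c → h a b c ≡ h b a c
        swap₂₃ : ∀ a b c → h a b c ≡ h a c b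

      swap₁₃ : ∀ a b c → h a b c ≡ h c b a
      swap₁₃ a b c = trans (swap₁₂ a b c) (trans (swap₂₃ b a c) (swap₁₂ b c a))

    open Symmetric

    deg : Weight → Fin n → ℕ
    deg h a = ∑ λ b → ∑ λ c → h a b c

    cov : Weight → Fin n → Fin n → ℕ
    cov h a b = ∑ λ c → h a b c

    total : Weight → ℕ
    total h = ∑ (deg h)

    module _ {h : Weight} (h-sym : Symmetric h) where

      cov-sym : ∀ a b → cov h a b ≡ cov h b a
      cov-sym a b = ∑-cong (swap₁₂ h-sym a b)

      cov≤deg : ∀ a b → cov h a b ≤ deg h b
      cov≤deg a b = ℕ.≤-trans (ℕ.≤-reflexive (cov-sym a b)) (term≤∑ (cov h b) a)

      deg-last : ∀ e → ∑ (λ c → ∑ λ d → h c d e) ≡ deg h e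
      deg-last e = trans (∑-comm (λ c d → h c d e)) (∑-cong λ d → ∑-cong λ c → swap₁₃ h-sym c d e)

      cov≡0 : ∀ {a b} c → cov h a b ≡ 0 → h a b c ≡ 0
      cov≡0 c cov≡0 = ∑≡0 _ cov≡0 c

    ∑∑-⟦≟⟧ : ∑ (λ (c : Fin n) → ∑ λ d → ⟦ c ≟ d ⟧) ≡ n
    ∑∑-⟦≟⟧ = trans (∑-cong {n} λ c → ∑-⟦≟⟧ c) (trans (∑-const n 1) (ℕ.*-identityʳ n))

    ∑-pairs : ∀ {m} b (D : Fin m → Bool) →
      ∑ (λ w → ∑ λ (c : Fin n) → ∑ λ (d : Fin n) → χ b * (χ (D w) * ⟦ c ≟ d ⟧)) ≤ ∑ (λ w → χ (D w)) * n
    ∑-pairs {m} b D = ℕ.≤-trans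
      (∑-mono λ w → ℕ.≤-trans
        (∑-mono {n} λ c → ∑-mono {n} λ d → χ*≤ b (χ (D w) * ⟦ c ≟ d ⟧))
        (ℕ.≤-reflexive (trans (∑-cong {n} λ c → sym (*-distribˡ-∑ (χ (D w)) (λ d → ⟦ c ≟ d ⟧)))
          (trans (sym (*-distribˡ-∑ (χ (D w)) (λ (c : Fin n) → ∑ λ d → ⟦ c ≟ d ⟧))) (cong (χ (D w) *_) ∑∑-⟦≟⟧)))))
      (ℕ.≤-reflexive (sym (*-distribʳ-∑ n (λ w → χ (D w)))))

    module Place {h : Weight} (h-sym : Symmetric h) (Y B : Fin n → Bool) where

      private
        P₁ : Fin n → Fin n → ℕ
        P₁ _ c = χ (not (Y c))
        P₂ : Fin n → Fin n → Fin n → Fin n → ℕ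
        P₂ v w c d = χ (B v) * (χ (B w) * (⟦ c ≟ d ⟧ + cov h c d))
        P₂-sym : ∀ v w c d → P₂ v w c d ≡ P₂ w v d c
        P₂-sym v w c d = trans (cong (λ x → χ (B v) * (χ (B w) * x)) (cong₂ _+_ (⟦≟⟧-sym c d) (cov-sym h-sym c d)))
          (exchange (χ (B v)) (χ (B w)) _)
          where
          exchange : ∀ a b c → a * (b * c) ≡ b * (a * c)
          exchange = solve-∀

      open Assignments {n} {n} P₁ P₂ (λ _ _ _ _ _ _ → 0) P₂-sym (λ _ _ _ _ _ _ → refl) (λ _ _ _ _ _ _ → refl)

      -- Only pairs are penalised: positions that coincide or lie in a common triple, which total n
      -- + `total h` for each partner in `B`. Codegree zero excludes every hyperedge through two
      -- placed positions at once, whatever the third vertex.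
      place : ∀ g → 0 < g → ∑ (λ c → χ (not (Y c))) + 3 * g ≤ n → ∑ (λ v → χ (B v)) * (n + total h) ≤ g * g →
        ∃[ x ] ((∀ v → B v ≡ true → Y (x v) ≡ true) ×
                (∀ v w → B v ≡ true → B w ≡ true → v ≢ w → x v ≢ x w × cov h (x v) (x w) ≡ 0))
      place g 0<g h₁ h₂ = lookup φ ,
        (λ v Bv → χ-not≡0⇒true (proj₁ ok v Bv)) ,
        (λ v w Bv Bw v≢w → let z = χ*-≡0 Bw (χ*-≡0 Bv (proj₁ (proj₂ ok) v w Bv Bw v≢w)) in
          ⟦≟⟧≡0⇒≢ (ℕ.m+n≡0⇒m≡0 _ z) , ℕ.m+n≡0⇒n≡0 ⟦ lookup φ v ≟ lookup φ w ⟧ z)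
        where
        A₂-bound : ∀ v → A₂ v ≤ ∑ (λ v → χ (B v)) * (n + total h)
        A₂-bound v = begin
          ∑ (λ w → ∑ λ c → ∑ λ d → χ (B v) * (χ (B w) * (⟦ c ≟ d ⟧ + cov h c d)))
            ≤⟨ ∑-mono (λ w → ∑-mono λ c → ∑-mono λ d → χ*≤ (B v) (χ (B w) * (⟦ c ≟ d ⟧ + cov h c d))) ⟩
          ∑ (λ w → ∑ λ c → ∑ λ d → χ (B w) * (⟦ c ≟ d ⟧ + cov h c d))
            ≡⟨ ∑-cong (λ w → sym (trans (*-distribˡ-∑ (χ (B w)) (λ c → ∑ λ d → ⟦ c ≟ d ⟧ + cov h c d))
                 (∑-cong λ c → *-distribˡ-∑ (χ (B w)) (λ d → ⟦ c ≟ d ⟧ + cov h c d)))) ⟩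
          ∑ (λ w → χ (B w) * ∑ λ c → ∑ λ d → ⟦ c ≟ d ⟧ + cov h c d)
            ≡⟨ sym (*-distribʳ-∑ (∑ λ c → ∑ λ d → ⟦ c ≟ d ⟧ + cov h c d) (λ w → χ (B w))) ⟩
          ∑ (λ w → χ (B w)) * ∑ (λ c → ∑ λ d → ⟦ c ≟ d ⟧ + cov h c d)
            ≡⟨ cong (∑ (λ w → χ (B w)) *_) (trans (∑-cong λ c → ∑-+ (λ d → ⟦ c ≟ d ⟧) (cov h c))
                 (trans (∑-+ (λ (c : Fin n) → ∑ λ d → ⟦ c ≟ d ⟧) (deg h)) (cong (_+ total h) ∑∑-⟦≟⟧))) ⟩
          ∑ (λ w → χ (B w)) * (n + total h) ∎
          where open ℕ.≤-Reasoning
        n-pos : 0 < n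
        n-pos = ℕ.<-≤-trans 0<g (ℕ.≤-trans (ℕ.m≤m+n g (2 * g)) (ℕ.≤-trans (ℕ.m≤n+m (3 * g) (∑ λ c → χ (not (Y c)))) h₁))
        result = penalty-free g 0<g n-pos B (λ _ _ → h₁) (λ v _ → ℕ.≤-trans (A₂-bound v) h₂)
          (λ _ _ → ℕ.≤-trans (ℕ.≤-reflexive (∑⁵-zero {n})) z≤n)
        φ = proj₁ result
        ok = proj₂ result

open Weights

-- Packing two sparse hypergraphs of bounded size.

module Packing where

  open Symmetric

  -- The constants are products of three bounds: 512 from n ≤ 512q, 27 from the totals 27M, and 1728
  -- from `Few`. Thus 884736 = 1728 · 512, 46656 = 1728 · 27 and 13824 = 512 · 27. The factors 2
  -- occur because each constraint has to cover one half of a budget.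
  module Regime (n M q : ℕ) (1≤q : 1 ≤ q) (1≤M : 1 ≤ M) (256q≤n : 256 * q ≤ n) (n≤512q : n ≤ 512 * q)
    (c₁ : 2 * (884736 * (M * M)) ≤ q * q * q * q)
    (c₂ : 2 * (46656 * (M * M * M)) ≤ q * q * q * q * q)
    (c₃ : 2 * (13824 * M) ≤ q * q) where

    private instance
      q-nonZero : ℕ.NonZero q
      q-nonZero = ℕ.>-nonZero 1≤q
      q²-nonZero : ℕ.NonZero (q * q)
      q²-nonZero = ℕ.>-nonZero (ℕ.*-mono-< 1≤q 1≤q)
      q³-nonZero : ℕ.NonZero (q * q * q)
      q³-nonZero = ℕ.>-nonZero (ℕ.*-mono-< (ℕ.*-mono-< 1≤q 1≤q) 1≤q)
      q⁴-nonZero : ℕ.NonZero (q * q * q * q)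
      q⁴-nonZero = ℕ.>-nonZero (ℕ.*-mono-< (ℕ.*-mono-< (ℕ.*-mono-< 1≤q 1≤q) 1≤q) 1≤q)
      27M-nonZero : ℕ.NonZero (27 * M)
      27M-nonZero = ℕ.>-nonZero (ℕ.*-mono-< {0} {27} (s≤s z≤n) 1≤M)

    open ℕ.≤-Reasoning

    -- The bound for the number of heavy vertices. It is dictated by `Large`, where 1728 = 64 · 27;
    -- in `Small`, 27 would do.
    Few : ℕ → Set
    Few b = b * (q * q * q) ≤ 1728 * (M * M)

    -- The budget q² is halved: `c₁` covers the part b · 512q and `c₂` the part b · 27M.
    few-spread : ∀ b → Few b → b * (n + 27 * M) ≤ q * q
    few-spread b few = ℕ.*-cancelˡ-≤ (q * q * q) (ℕ.*-cancelˡ-≤ 2 (begin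
      2 * (q * q * q * (b * (n + 27 * M)))
        ≡⟨ arith₁ b (q * q * q) (n + 27 * M) ⟩
      2 * (b * (q * q * q) * (n + 27 * M))
        ≤⟨ ℕ.*-monoʳ-≤ 2 (ℕ.*-mono-≤ few (ℕ.+-monoˡ-≤ (27 * M) n≤512q)) ⟩
      2 * (1728 * (M * M) * (512 * q + 27 * M))
        ≡⟨ arith₂ 1728 512 27 M q ⟩
      2 * (884736 * (M * M)) * q + 2 * (46656 * (M * M * M))
        ≤⟨ ℕ.+-mono-≤ (ℕ.*-monoˡ-≤ q c₁) c₂ ⟩
      q * q * q * q * q + q * q * q * q * q
        ≡⟨ arith₃ q ⟩
      2 * (q * q * q * (q * q)) ∎))
      where
      arith₁ : ∀ b x y → 2 * (x * (b * y)) ≡ 2 * (b * x * y)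
      arith₁ = solve-∀
      arith₂ : ∀ a b c M q → 2 * (a * (M * M) * (b * q + c * M)) ≡ 2 * (a * b * (M * M)) * q + 2 * (a * c * (M * M * M))
      arith₂ = solve-∀
      arith₃ : ∀ q → q * q * q * q * q + q * q * q * q * q ≡ 2 * (q * q * q * (q * q))
      arith₃ = solve-∀

    few-small : ∀ b → Few b → 2 * b ≤ q
    few-small b few = ℕ.*-cancelˡ-≤ (q * q * q) (begin
      q * q * q * (2 * b)            ≡⟨ arith b (q * q * q) ⟩
      2 * (b * (q * q * q))          ≤⟨ ℕ.*-monoʳ-≤ 2 (ℕ.≤-trans few (ℕ.*-monoˡ-≤ (M * M) (ℕ.≤ᵇ⇒≤ 1728 884736 _))) ⟩
      2 * (884736 * (M * M))         ≤⟨ c₁ ⟩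
      q * q * q * q                  ∎)
      where
      arith : ∀ b x → x * (2 * b) ≡ 2 * (b * x)
      arith = solve-∀

    -- `b` positions of degree at most 27M/q have total degree at most 27Mb/q, which `c₂` makes at
    -- most q/2.
    few-degrees : ∀ b X → Few b → X * q ≤ b * (27 * M) → 2 * X ≤ q
    few-degrees b X few Xq≤ = ℕ.*-cancelˡ-≤ (q * q * q * q) (begin
      q * q * q * q * (2 * X)              ≡⟨ arith₁ q X ⟩
      2 * (X * q * (q * q * q))            ≤⟨ ℕ.*-monoʳ-≤ 2 (ℕ.*-monoˡ-≤ (q * q * q) Xq≤) ⟩
      2 * (b * (27 * M) * (q * q * q))     ≡⟨ arith₂ b M (q * q * q) ⟩
      2 * (27 * M * (b * (q * q * q)))     ≤⟨ ℕ.*-monoʳ-≤ 2 (ℕ.*-monoʳ-≤ (27 * M) few) ⟩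
      2 * (27 * M * (1728 * (M * M)))      ≡⟨ arith₃ 27 1728 M ⟩
      2 * (46656 * (M * M * M))            ≤⟨ c₂ ⟩
      q * q * q * q * q                    ∎)
      where
      arith₁ : ∀ q X → q * q * q * q * (2 * X) ≡ 2 * (X * q * (q * q * q))
      arith₁ = solve-∀
      arith₂ : ∀ b M x → 2 * (b * (27 * M) * x) ≡ 2 * (27 * M * (b * x))
      arith₂ = solve-∀
      arith₃ : ∀ a b M → 2 * (a * M * (b * (M * M))) ≡ 2 * (a * b * (M * M * M))
      arith₃ = solve-∀

    module _ {h ζ : Weight {n}} (h-sym : Symmetric h) (ζ-sym : Symmetric ζ)
      (h-total : total h ≤ 27 * M) (ζ-total : total ζ ≤ 27 * M) where

      -- Admissible positions for heavy vertices. By Markov's inequality at most q positions have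
      -- degree above 27M/q.
      low : Fin n → Bool
      low c = does (deg h c * q ℕ.≤? 27 * M)

      low⁻ : ∀ {c} → low c ≡ true → deg h c * q ≤ 27 * M
      low⁻ {c} = does⁻ (deg h c * q ℕ.≤? 27 * M)

      high-count : ∑ (λ c → χ (not (low c))) ≤ q
      high-count = ℕ.*-cancelʳ-≤ _ q (27 * M) (begin
        ∑ (λ c → χ (not (low c))) * (27 * M)   ≤⟨ markov (not ∘ low) (λ c → deg h c * q) (27 * M) high ⟩
        ∑ (λ c → deg h c * q)                  ≡⟨ sym (*-distribʳ-∑ q (deg h)) ⟩
        total h * q                            ≤⟨ ℕ.*-monoˡ-≤ q h-total ⟩
        27 * M * q                             ≡⟨ ℕ.*-comm (27 * M) q ⟩
        q * (27 * M)                           ∎)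
        where
        high : ∀ c → not (low c) ≡ true → 27 * M ≤ deg h c * q
        high c eq = ℕ.<⇒≤ (ℕ.≰⇒> (not-does⁻ (deg h c * q ℕ.≤? 27 * M) (Bool.not-injective eq)))

      total≤ : ∀ b g → q ≤ g → Few b → b * (n + total h) ≤ g * g
      total≤ b g q≤g few = ℕ.≤-trans (ℕ.*-monoʳ-≤ b (ℕ.+-monoʳ-≤ n h-total)) (ℕ.≤-trans (few-spread b few) (ℕ.*-mono-≤ q≤g q≤g))

      -- Here all of `J` is embedded. Charging injectivity as a penalty on pairs costs |J| n ≤
      -- 2560q², affordable only because |J| ≤ 5q.
      module Small (J : Fin n → Bool) (J-size : ∑ (λ v → χ (J v)) ≤ 5 * q) where

        heavy B T : Fin n → Bool
        -- The threshold is set by triples: for a light vertex they total deg ζ v · 27M ≤ 27q³, well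
        -- below g³.
        heavy v = does (q * q * q ℕ.<? M * deg ζ v)
        B v = J v ∧ heavy v
        T v = J v ∧ not (heavy v)

        light : ∀ {v} → T v ≡ true → M * deg ζ v ≤ q * q * q
        light {v} Tv = ℕ.≮⇒≥ (not-does⁻ (q * q * q ℕ.<? M * deg ζ v) (Bool.not-injective (proj₂ (∧⁻ {J v} Tv))))

        few : Few (∑ λ v → χ (B v))
        few = begin
          ∑ (λ v → χ (B v)) * (q * q * q)   ≤⟨ markov B (λ v → M * deg ζ v) (q * q * q) (λ v Bv → ℕ.<⇒≤ (does⁻ (q * q * q ℕ.<? M * deg ζ v) (proj₂ (∧⁻ {J v} Bv)))) ⟩
          ∑ (λ v → M * deg ζ v)             ≡⟨ sym (*-distribˡ-∑ M (deg ζ)) ⟩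
          M * total ζ                       ≤⟨ ℕ.*-monoʳ-≤ M ζ-total ⟩
          M * (27 * M)                      ≡⟨ arith M ⟩
          27 * (M * M)                      ≤⟨ ℕ.*-monoˡ-≤ (M * M) (ℕ.≤ᵇ⇒≤ 27 1728 _) ⟩
          1728 * (M * M)                    ∎
          where
          arith : ∀ M → M * (27 * M) ≡ 27 * (M * M)
          arith = solve-∀

        g : ℕ
        -- Large enough for pairs, as 64² = 4096 exceeds 2560 + 27, and small enough for single
        -- positions, as 2 + 3 · 64 = 194 is below 256.
        g = 64 * q

        q≤g : q ≤ g
        q≤g = ℕ.m≤n*m q 64

        0<g : 0 < g
        0<g = ℕ.<-≤-trans 1≤q q≤g

        opaque
          placed : ∃ λ (x : Fin n → Fin n) → ((∀ v → B v ≡ true → low (x v) ≡ true) ×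
            (∀ v w → B v ≡ true → B w ≡ true → v ≢ w → x v ≢ x w × cov h (x v) (x w) ≡ 0))
          placed = Place.place h-sym low B g 0<g
            (begin
              ∑ (λ c → χ (not (low c))) + 3 * g     ≤⟨ ℕ.+-monoˡ-≤ (3 * g) high-count ⟩
              q + 3 * (64 * q)                      ≡⟨ arith 64 q ⟩
              193 * q                               ≤⟨ ℕ.*-monoˡ-≤ q (ℕ.≤ᵇ⇒≤ 193 256 _) ⟩
              256 * q                               ≤⟨ 256q≤n ⟩
              n                                     ∎)
            (total≤ (∑ λ v → χ (B v)) g q≤g few)
            where
            arith : ∀ k q → q + 3 * (k * q) ≡ (1 + 3 * k) * q
            arith = solve-∀

        x : Fin n → Fin n
        x = proj₁ placed

        x-low : ∀ {v} → B v ≡ true → deg h (x v) * q ≤ 27 * M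
        x-low {v} Bv = low⁻ (proj₁ (proj₂ placed) v Bv)

        x-apart : ∀ {v w} → B v ≡ true → B w ≡ true → v ≢ w → x v ≢ x w × cov h (x v) (x w) ≡ 0
        x-apart {v} {w} = proj₂ (proj₂ placed) v w

        P₁ : Fin n → Fin n → ℕ
        P₁ _ c = χ (not (low c)) + ∑ λ r → χ (B r) * ⟦ c ≟ x r ⟧

        -- The second summand covers triples with one heavy vertex `r`: its position `x r` is
        -- already fixed, so they restrict only the two light vertices.
        P₂ : Fin n → Fin n → Fin n → Fin n → ℕ
        P₂ v w c d = χ (J v) * (χ (J w) * ⟦ c ≟ d ⟧) + ∑ λ r → χ (B r) * (ζ v w r * h c d (x r))

        P₃ : Fin n → Fin n → Fin n → Fin n → Fin n → Fin n → ℕ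
        P₃ u v w c d e = ζ u v w * h c d e

        P₂-sym : ∀ v w c d → P₂ v w c d ≡ P₂ w v d c
        P₂-sym v w c d = cong₂ _+_
          (trans (cong (λ z → χ (J v) * (χ (J w) * z)) (⟦≟⟧-sym c d)) (exchange (χ (J v)) (χ (J w)) ⟦ d ≟ c ⟧))
          (∑-cong λ r → cong (χ (B r) *_) (cong₂ _*_ (swap₁₂ ζ-sym v w r) (swap₁₂ h-sym c d (x r))))
          where
          exchange : ∀ a b c → a * (b * c) ≡ b * (a * c)
          exchange = solve-∀

        open Assignments P₁ P₂ P₃ P₂-sym
          (λ u v w c d e → cong₂ _*_ (swap₁₂ ζ-sym u v w) (swap₁₂ h-sym c d e))
          (λ u v w c d e → cong₂ _*_ (swap₂₃ ζ-sym u v w) (swap₂₃ h-sym c d e))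

        A₁-bound : ∀ v → A₁ v + 3 * g ≤ n
        A₁-bound v = begin
          A₁ v + 3 * g
            ≡⟨ cong (_+ 3 * g) (trans (∑-+ (λ c → χ (not (low c))) (λ c → ∑ λ r → χ (B r) * ⟦ c ≟ x r ⟧))
                 (cong (∑ (λ c → χ (not (low c))) +_) (trans (∑-comm (λ c r → χ (B r) * ⟦ c ≟ x r ⟧))
                   (∑-cong λ r → trans (sym (*-distribˡ-∑ (χ (B r)) (λ c → ⟦ c ≟ x r ⟧))) (trans (cong (χ (B r) *_) (∑-⟦≟⟧ˡ (x r))) (ℕ.*-identityʳ _)))))) ⟩
          ∑ (λ c → χ (not (low c))) + ∑ (λ r → χ (B r)) + 3 * g
            ≤⟨ ℕ.+-monoˡ-≤ (3 * g) (ℕ.+-mono-≤ high-count (ℕ.≤-trans (ℕ.m≤m+n b (b + 0)) (few-small b few))) ⟩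
          q + q + 3 * (64 * q)     ≡⟨ arith 64 q ⟩
          194 * q                  ≤⟨ ℕ.*-monoˡ-≤ q (ℕ.≤ᵇ⇒≤ 194 256 _) ⟩
          256 * q                  ≤⟨ 256q≤n ⟩
          n                        ∎
          where
          b = ∑ λ v → χ (B v)
          arith : ∀ k q → q + q + 3 * (k * q) ≡ (2 + 3 * k) * q
          arith = solve-∀

        inj-bound : ∀ v → ∑ (λ w → ∑ λ (c : Fin n) → ∑ λ d → χ (J v) * (χ (J w) * ⟦ c ≟ d ⟧)) ≤ 2560 * (q * q)
        inj-bound v = ℕ.≤-trans (∑-pairs (J v) J) (begin
          ∑ (λ w → χ (J w)) * n    ≤⟨ ℕ.*-mono-≤ J-size n≤512q ⟩
          5 * q * (512 * q)        ≡⟨ arith 5 512 q ⟩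
          2560 * (q * q)           ∎)
          where
          arith : ∀ a b q → a * q * (b * q) ≡ a * b * (q * q)
          arith = solve-∀

        -- Summing over the positions of both light vertices gives deg h (x r), at most 27M/q
        -- because `x r` is low. Summing ζ over `w` and `r` gives deg ζ v, bounded because `v` is
        -- light.
        mixed-bound : ∀ v → M * deg ζ v ≤ q * q * q →
          ∑ (λ w → ∑ λ c → ∑ λ d → ∑ λ r → χ (B r) * (ζ v w r * h c d (x r))) ≤ 27 * (q * q)
        mixed-bound v Mdeg≤ = ℕ.*-cancelʳ-≤ _ _ q (begin
          ∑ (λ w → ∑ λ c → ∑ λ d → ∑ λ r → χ (B r) * (ζ v w r * h c d (x r))) * q
            ≡⟨ cong (_* q) (∑-cong λ w → collapse w) ⟩
          ∑ (λ w → ∑ λ r → χ (B r) * (ζ v w r * deg h (x r))) * q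
            ≡⟨ trans (*-distribʳ-∑ q (λ w → ∑ λ r → χ (B r) * (ζ v w r * deg h (x r)))) (∑-cong λ w → *-distribʳ-∑ q (λ r → χ (B r) * (ζ v w r * deg h (x r)))) ⟩
          ∑ (λ w → ∑ λ r → χ (B r) * (ζ v w r * deg h (x r)) * q)
            ≤⟨ ∑-mono (λ w → ∑-mono λ r → each w r (B r) refl) ⟩
          ∑ (λ w → ∑ λ r → ζ v w r * (27 * M))
            ≡⟨ sym (trans (*-distribʳ-∑ (27 * M) (λ w → ∑ λ r → ζ v w r)) (∑-cong λ w → *-distribʳ-∑ (27 * M) (λ r → ζ v w r))) ⟩
          deg ζ v * (27 * M)     ≡⟨ arith₁ (deg ζ v) M ⟩
          27 * (M * deg ζ v)     ≤⟨ ℕ.*-monoʳ-≤ 27 Mdeg≤ ⟩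
          27 * (q * q * q)       ≡⟨ arith₂ q ⟩
          27 * (q * q) * q       ∎)
          where
          arith₁ : ∀ d M → d * (27 * M) ≡ 27 * (M * d)
          arith₁ = solve-∀
          arith₂ : ∀ q → 27 * (q * q * q) ≡ 27 * (q * q) * q
          arith₂ = solve-∀
          collapse : ∀ w → ∑ (λ c → ∑ λ d → ∑ λ r → χ (B r) * (ζ v w r * h c d (x r))) ≡ ∑ λ r → χ (B r) * (ζ v w r * deg h (x r))
          collapse w = trans (∑-cong λ c → ∑-comm (λ d r → χ (B r) * (ζ v w r * h c d (x r))))
            (trans (∑-comm (λ c r → ∑ λ d → χ (B r) * (ζ v w r * h c d (x r))))
              (∑-cong λ r → sym (trans (cong (λ z → χ (B r) * (ζ v w r * z)) (sym (deg-last h-sym (x r))))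
                (trans (cong (χ (B r) *_) (*-distribˡ-∑ (ζ v w r) (λ c → ∑ λ d → h c d (x r))))
                (trans (*-distribˡ-∑ (χ (B r)) (λ c → ζ v w r * ∑ λ d → h c d (x r)))
                  (∑-cong λ c → trans (cong (χ (B r) *_) (*-distribˡ-∑ (ζ v w r) (λ d → h c d (x r)))) (*-distribˡ-∑ (χ (B r)) (λ d → ζ v w r * h c d (x r)))))))))
          each : ∀ w r b → B r ≡ b → χ b * (ζ v w r * deg h (x r)) * q ≤ ζ v w r * (27 * M)
          each w r false Br = z≤n
          each w r true  Br = ℕ.≤-trans (ℕ.≤-reflexive (trans (cong (_* q) (ℕ.*-identityˡ (ζ v w r * deg h (x r)))) (ℕ.*-assoc (ζ v w r) (deg h (x r)) q)))
            (ℕ.*-monoʳ-≤ (ζ v w r) (x-low Br))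

        A₂-bound : ∀ v → T v ≡ true → A₂ v ≤ g * g
        A₂-bound v Tv = begin
          A₂ v
            ≡⟨ trans (∑-cong λ w → trans (∑-cong λ c → ∑-+ (λ d → χ (J v) * (χ (J w) * ⟦ c ≟ d ⟧)) (λ d → ∑ λ r → χ (B r) * (ζ v w r * h c d (x r))))
                 (∑-+ (λ (c : Fin n) → ∑ λ d → χ (J v) * (χ (J w) * ⟦ c ≟ d ⟧)) (λ c → ∑ λ d → ∑ λ r → χ (B r) * (ζ v w r * h c d (x r)))))
                 (∑-+ (λ w → ∑ λ (c : Fin n) → ∑ λ d → χ (J v) * (χ (J w) * ⟦ c ≟ d ⟧)) (λ w → ∑ λ c → ∑ λ d → ∑ λ r → χ (B r) * (ζ v w r * h c d (x r)))) ⟩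
          ∑ (λ w → ∑ λ (c : Fin n) → ∑ λ d → χ (J v) * (χ (J w) * ⟦ c ≟ d ⟧)) + ∑ (λ w → ∑ λ c → ∑ λ d → ∑ λ r → χ (B r) * (ζ v w r * h c d (x r)))
            ≤⟨ ℕ.+-mono-≤ (inj-bound v) (mixed-bound v (light Tv)) ⟩
          2560 * (q * q) + 27 * (q * q)   ≡⟨ sym (ℕ.*-distribʳ-+ (q * q) 2560 27) ⟩
          2587 * (q * q)                  ≤⟨ ℕ.*-monoˡ-≤ (q * q) (ℕ.≤ᵇ⇒≤ 2587 4096 _) ⟩
          4096 * (q * q)                  ≡⟨ arith 64 q ⟩
          64 * q * (64 * q)               ∎
          where
          arith : ∀ k q → k * k * (q * q) ≡ k * q * (k * q)
          arith = solve-∀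

        A₃-bound : ∀ v → T v ≡ true → A₃ v ≤ g * g * g
        A₃-bound v Tv = begin
          A₃ v
            ≡⟨ ∑-cong (λ a → ∑-cong λ b → sym (trans (*-distribˡ-∑ (ζ v a b) (deg h)) (∑-cong λ c →
                 trans (*-distribˡ-∑ (ζ v a b) (λ d → ∑ λ e → h c d e)) (∑-cong λ d → *-distribˡ-∑ (ζ v a b) (h c d))))) ⟩
          ∑ (λ a → ∑ λ b → ζ v a b * total h)
            ≡⟨ sym (trans (*-distribʳ-∑ (total h) (λ a → ∑ (ζ v a))) (∑-cong λ a → *-distribʳ-∑ (total h) (ζ v a))) ⟩
          deg ζ v * total h                    ≤⟨ ℕ.*-monoʳ-≤ (deg ζ v) h-total ⟩
          deg ζ v * (27 * M)                   ≡⟨ arith₁ (deg ζ v) M ⟩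
          27 * (M * deg ζ v)                   ≤⟨ ℕ.*-monoʳ-≤ 27 (light Tv) ⟩
          27 * (q * q * q)                     ≤⟨ ℕ.*-monoˡ-≤ (q * q * q) (ℕ.≤ᵇ⇒≤ 27 262144 _) ⟩
          262144 * (q * q * q)                 ≡⟨ arith₂ 64 q ⟩
          64 * q * (64 * q) * (64 * q)         ∎
          where
          arith₁ : ∀ d M → d * (27 * M) ≡ 27 * (M * d)
          arith₁ = solve-∀
          arith₂ : ∀ k q → k * k * k * (q * q * q) ≡ k * q * (k * q) * (k * q)
          arith₂ = solve-∀

        opaque
          assigned : ∃[ φ ] Valid T φ
          assigned = penalty-free g 0<g (ℕ.<-≤-trans 1≤q (ℕ.≤-trans (ℕ.m≤n*m q 256) 256q≤n)) T (λ v _ → A₁-bound v) A₂-bound A₃-bound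

        y φ : Fin n → Fin n
        y = lookup (proj₁ assigned)
        φ v = if heavy v then x v else y v

        y-avoids-x : ∀ {v r} → T v ≡ true → B r ≡ true → y v ≢ x r
        y-avoids-x {v} {r} Tv Br = ⟦≟⟧≡0⇒≢ (χ*-≡0 Br (∑≡0 _ (ℕ.m+n≡0⇒n≡0 (χ (not (low (y v)))) (proj₁ (proj₂ assigned) v Tv)) r))

        P₂-zero : ∀ {v w} → T v ≡ true → T w ≡ true → v ≢ w → P₂ v w (y v) (y w) ≡ 0
        P₂-zero {v} {w} = proj₁ (proj₂ (proj₂ assigned)) v w

        data Kind (v : Fin n) : Set where
          isB : B v ≡ true → φ v ≡ x v → Kind v
          isT : T v ≡ true → φ v ≡ y v → Kind v

        kind : ∀ v → J v ≡ true → Kind v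
        kind v Jv = cases (heavy v) refl
          where
          cases : ∀ b → heavy v ≡ b → Kind v
          cases true  eq = isB (∧⁺ Jv eq) (cong (λ b → if b then x v else y v) eq)
          cases false eq = isT (∧⁺ Jv (cong not eq)) (cong (λ b → if b then x v else y v) eq)

        φ-injective : ∀ v w → J v ≡ true → J w ≡ true → v ≢ w → φ v ≢ φ w
        φ-injective v w Jv Jw v≢w φ≡ with kind v Jv | kind w Jw
        ... | isB Bv ev | isB Bw ew = proj₁ (x-apart Bv Bw v≢w) (trans (sym ev) (trans φ≡ ew))
        ... | isB Bv ev | isT Tw ew = y-avoids-x Tw Bv (trans (sym ew) (trans (sym φ≡) ev))
        ... | isT Tv ev | isB Bw ew = y-avoids-x Tv Bw (trans (sym ev) (trans φ≡ ew))
        ... | isT Tv ev | isT Tw ew = ⟦≟⟧≡0⇒≢ (χ*-≡0 Jw (χ*-≡0 Jv (ℕ.m+n≡0⇒m≡0 _ (P₂-zero Tv Tw v≢w)))) (trans (sym ev) (trans φ≡ ew))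

        Packed : Fin n → Fin n → Fin n → Set
        Packed u v w = ζ u v w * h (φ u) (φ v) (φ w) ≡ 0

        packed₁₂ : ∀ {u v w} → Packed v u w → Packed u v w
        packed₁₂ {u} {v} {w} = trans (cong₂ _*_ (swap₁₂ ζ-sym u v w) (swap₁₂ h-sym (φ u) (φ v) (φ w)))

        packed₂₃ : ∀ {u v w} → Packed u w v → Packed u v w
        packed₂₃ {u} {v} {w} = trans (cong₂ _*_ (swap₂₃ ζ-sym u v w) (swap₂₃ h-sym (φ u) (φ v) (φ w)))

        packedBB : ∀ {u v} w → B u ≡ true → B v ≡ true → φ u ≡ x u → φ v ≡ x v → u ≢ v → Packed u v w
        packedBB {u} {v} w Bu Bv eu ev u≢v = trans (cong (ζ u v w *_) (trans (cong₂ (λ c d → h c d (φ w)) eu ev)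
          (cov≡0 h-sym (φ w) (proj₂ (x-apart Bu Bv u≢v))))) (ℕ.*-zeroʳ (ζ u v w))

        packedTTB : ∀ {u v w} → T u ≡ true → T v ≡ true → B w ≡ true → φ u ≡ y u → φ v ≡ y v → φ w ≡ x w → u ≢ v → Packed u v w
        packedTTB {u} {v} {w} Tu Tv Bw eu ev ew u≢v = trans (cong (ζ u v w *_) (trans (cong₂ (λ c d → h c d (φ w)) eu ev) (cong (h (y u) (y v)) ew)))
          (χ*-≡0 Bw (∑≡0 _ (ℕ.m+n≡0⇒n≡0 (χ (J u) * (χ (J v) * ⟦ y u ≟ y v ⟧)) (P₂-zero Tu Tv u≢v)) w))

        -- By the number of heavy vertices: two or three are excluded by codegree zero, one by `P₂`,
        -- none by `P₃`. Symmetry of both weights reduces each order to one of these.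
        packed : ∀ u v w → J u ≡ true → J v ≡ true → J w ≡ true → u ≢ v → u ≢ w → v ≢ w → Packed u v w
        packed u v w Ju Jv Jw u≢v u≢w v≢w with kind u Ju | kind v Jv | kind w Jw
        ... | isB Bu eu | isB Bv ev | _         = packedBB w Bu Bv eu ev u≢v
        ... | isB Bu eu | isT _ _   | isB Bw ew = packed₂₃ (packedBB v Bu Bw eu ew u≢w)
        ... | isT _ _   | isB Bv ev | isB Bw ew = packed₁₂ (packed₂₃ (packedBB u Bv Bw ev ew v≢w))
        ... | isT Tu eu | isT Tv ev | isB Bw ew = packedTTB Tu Tv Bw eu ev ew u≢v
        ... | isT Tu eu | isB Bv ev | isT Tw ew = packed₂₃ (packedTTB Tu Tw Bv eu ew ev u≢w)
        ... | isB Bu eu | isT Tv ev | isT Tw ew = packed₁₂ (packed₂₃ (packedTTB Tv Tw Bu ev ew eu v≢w))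
        ... | isT Tu eu | isT Tv ev | isT Tw ew = trans (cong (ζ u v w *_) (trans (cong₂ (λ c d → h c d (φ w)) eu ev) (cong (h (y u) (y v)) ew)))
          (proj₂ (proj₂ (proj₂ assigned)) u v w Tu Tv Tw u≢v u≢w v≢w)

      -- Only the triples of ζ through a pivot p are packed, with p destined for `v₀`: the link of p
      -- becomes a graph to be embedded in `A` edge-disjointly from the link of `v₀` in h. All
      -- penalties are thus on single vertices and pairs.
      module Large (A J : Fin n → Bool) (v₀ : Fin n) (A-size : 5 * q ≤ ∑ (λ v → χ (A v))) (J-size : 5 * q ≤ ∑ (λ v → χ (J v))) where

        opaque
          -- Were all vertices of `J` of degree above 27M/q, any q of them would already exceed the
          -- total of ζ.
          pivot : ∃[ p ] (J p ≡ true × deg ζ p * q ≤ 27 * M)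
          pivot with Fin.any? (λ p → (J p Bool.≟ true) ×-dec (deg ζ p * q ℕ.≤? 27 * M))
          ... | yes found = found
          ... | no ∄p = contradiction (begin
              suc (27 * M * q)                   ≤⟨ s≤s (ℕ.≤-reflexive (ℕ.*-comm (27 * M) q)) ⟩
              suc (q * (27 * M))                 ≤⟨ ℕ.+-monoˡ-≤ (q * (27 * M)) 1≤q ⟩
              q + q * (27 * M)                   ≡⟨ sym (ℕ.*-suc q (27 * M)) ⟩
              q * suc (27 * M)                   ≤⟨ ℕ.*-monoˡ-≤ (suc (27 * M)) (ℕ.≤-trans (ℕ.m≤n*m q 5) J-size) ⟩
              ∑ (λ p → χ (J p)) * suc (27 * M)   ≤⟨ markov J (λ p → deg ζ p * q) (suc (27 * M)) (λ p Jp → ℕ.≰⇒> λ le → ∄p (p , Jp , le)) ⟩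
              ∑ (λ p → deg ζ p * q)              ≡⟨ sym (*-distribʳ-∑ q (deg ζ)) ⟩
              total ζ * q                        ≤⟨ ℕ.*-monoˡ-≤ q ζ-total ⟩
              27 * M * q                         ∎) (ℕ.<-irrefl refl)

        p : Fin n
        p = proj₁ pivot

        κ : Fin n → ℕ
        κ = cov ζ p

        D heavy B T Y : Fin n → Bool
        -- The neighbours of p. The remaining vertices of `J` lie in no triple with p and may go
        -- anywhere in `A`, so only `D` has to be embedded with care; it has at most deg ζ p ≤ 27M/q
        -- elements.
        D s = (J s ∧ not (does (s Fin.≟ p))) ∧ not (does (κ s ℕ.≟ 0))
        -- 64 is the power of two above 2 · 27 = 54, the factor that `link-bound` needs.
        heavy s = does (q * q ℕ.<? 64 * (M * κ s))
        B s = D s ∧ heavy s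
        T s = D s ∧ not (heavy s)
        Y c = A c ∧ low c

        light : ∀ {s} → T s ≡ true → 64 * (M * κ s) ≤ q * q
        light {s} Ts = ℕ.≮⇒≥ (not-does⁻ (q * q ℕ.<? 64 * (M * κ s)) (Bool.not-injective (proj₂ (∧⁻ {D s} Ts))))

        few : Few (∑ λ s → χ (B s))
        few = begin
          ∑ (λ s → χ (B s)) * (q * q * q)       ≡⟨ sym (ℕ.*-assoc (∑ λ s → χ (B s)) (q * q) q) ⟩
          ∑ (λ s → χ (B s)) * (q * q) * q       ≤⟨ ℕ.*-monoˡ-≤ q (markov B (λ s → 64 * (M * κ s)) (q * q)
            (λ s Bs → ℕ.<⇒≤ (does⁻ (q * q ℕ.<? 64 * (M * κ s)) (proj₂ (∧⁻ {D s} Bs))))) ⟩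
          ∑ (λ s → 64 * (M * κ s)) * q          ≡⟨ cong (_* q) (sym (trans (cong (64 *_) (*-distribˡ-∑ M κ)) (*-distribˡ-∑ 64 (λ s → M * κ s)))) ⟩
          64 * (M * deg ζ p) * q                ≡⟨ arith₁ 64 M (deg ζ p) q ⟩
          64 * M * (deg ζ p * q)                ≤⟨ ℕ.*-monoʳ-≤ (64 * M) (proj₂ (proj₂ pivot)) ⟩
          64 * M * (27 * M)                     ≡⟨ arith₂ 64 27 M ⟩
          1728 * (M * M)                        ∎
          where
          arith₁ : ∀ k M d q → k * (M * d) * q ≡ k * M * (d * q)
          arith₁ = solve-∀
          arith₂ : ∀ a b M → a * M * (b * M) ≡ a * b * (M * M)
          arith₂ = solve-∀

        excluded : ℕ
        excluded = ∑ λ c → χ (not (Y c))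

        -- `A` has at least 5q vertices, of which at most q are not low. The 4q that remain provide
        -- the 3g of the counting argument with g = q, and q for avoiding the placed heavy vertices.
        excluded-bound : excluded + 4 * q ≤ n
        excluded-bound = ℕ.+-cancelʳ-≤ q _ n (begin
          excluded + 4 * q + q
            ≡⟨ arith excluded q ⟩
          excluded + 5 * q
            ≤⟨ ℕ.+-mono-≤ (ℕ.≤-trans (∑-mono λ c → split (A c) (low c)) (ℕ.≤-reflexive (∑-+ (λ c → χ (not (A c))) (λ c → χ (not (low c)))))) A-size ⟩
          ∑ (λ c → χ (not (A c))) + ∑ (λ c → χ (not (low c))) + ∑ (λ c → χ (A c))
            ≡⟨ rotate (∑ (λ c → χ (not (A c)))) (∑ (λ c → χ (not (low c)))) (∑ (λ c → χ (A c))) ⟩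
          ∑ (λ c → χ (not (A c))) + ∑ (λ c → χ (A c)) + ∑ (λ c → χ (not (low c)))
            ≡⟨ cong (_+ ∑ (λ c → χ (not (low c)))) (trans (sym (∑-+ (λ c → χ (not (A c))) (λ c → χ (A c))))
                 (trans (∑-cong λ c → complement (A c)) (trans (∑-const n 1) (ℕ.*-identityʳ n)))) ⟩
          n + ∑ (λ c → χ (not (low c)))
            ≤⟨ ℕ.+-monoʳ-≤ n high-count ⟩
          n + q ∎)
          where
          arith : ∀ e q → e + 4 * q + q ≡ e + 5 * q
          arith = solve-∀
          rotate : ∀ a b c → a + b + c ≡ a + c + b
          rotate = solve-∀
          split : ∀ a b → χ (not (a ∧ b)) ≤ χ (not a) + χ (not b)
          split true  b = ℕ.≤-refl
          split false b = ℕ.m≤m+n 1 (χ (not b))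
          complement : ∀ a → χ (not a) + χ a ≡ 1
          complement true  = refl
          complement false = refl

        opaque
          placed : ∃ λ (x : Fin n → Fin n) → ((∀ s → B s ≡ true → Y (x s) ≡ true) ×
            (∀ s t → B s ≡ true → B t ≡ true → s ≢ t → x s ≢ x t × cov h (x s) (x t) ≡ 0))
          placed = Place.place h-sym Y B q 1≤q
            (ℕ.≤-trans (ℕ.+-monoʳ-≤ excluded (ℕ.*-monoˡ-≤ q (ℕ.n≤1+n 3))) excluded-bound) (total≤ (∑ λ s → χ (B s)) q ℕ.≤-refl few)

        x : Fin n → Fin n
        x = proj₁ placed

        x-Y : ∀ {s} → B s ≡ true → Y (x s) ≡ true
        x-Y {s} = proj₁ (proj₂ placed) s

        x-apart : ∀ {s t} → B s ≡ true → B t ≡ true → s ≢ t → x s ≢ x t × cov h (x s) (x t) ≡ 0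
        x-apart {s} {t} = proj₂ (proj₂ placed) s t

        -- Since both `v₀` and `x r` are fixed, a link edge between a heavy and a light vertex
        -- restricts the light vertex alone.
        P₁ : Fin n → Fin n → ℕ
        P₁ _ c = χ (not (Y c)) + ∑ λ r → χ (B r) * (⟦ c ≟ x r ⟧ + h v₀ (x r) c)

        P₂ : Fin n → Fin n → Fin n → Fin n → ℕ
        P₂ s t c d = χ (D s) * (χ (D t) * ⟦ c ≟ d ⟧) + ζ p s t * h v₀ c d

        P₂-sym : ∀ s t c d → P₂ s t c d ≡ P₂ t s d c
        P₂-sym s t c d = cong₂ _+_
          (trans (cong (λ z → χ (D s) * (χ (D t) * z)) (⟦≟⟧-sym c d)) (exchange (χ (D s)) (χ (D t)) ⟦ d ≟ c ⟧))
          (cong₂ _*_ (swap₂₃ ζ-sym p s t) (swap₂₃ h-sym v₀ c d))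
          where
          exchange : ∀ a b c → a * (b * c) ≡ b * (a * c)
          exchange = solve-∀

        open Assignments {n} {n} P₁ P₂ (λ _ _ _ _ _ _ → 0) P₂-sym (λ _ _ _ _ _ _ → refl) (λ _ _ _ _ _ _ → refl)

        linked : ℕ
        linked = ∑ λ r → χ (B r) * cov h v₀ (x r)

        linked-small : 2 * linked ≤ q
        linked-small = few-degrees (∑ λ s → χ (B s)) linked few (begin
          linked * q                                    ≡⟨ *-distribʳ-∑ q (λ r → χ (B r) * cov h v₀ (x r)) ⟩
          ∑ (λ r → χ (B r) * cov h v₀ (x r) * q)         ≤⟨ ∑-mono (λ r → each r (B r) refl) ⟩
          ∑ (λ r → χ (B r) * (27 * M))                  ≡⟨ sym (*-distribʳ-∑ (27 * M) (λ r → χ (B r))) ⟩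
          ∑ (λ r → χ (B r)) * (27 * M)                  ∎)
          where
          each : ∀ r b → B r ≡ b → χ b * cov h v₀ (x r) * q ≤ χ b * (27 * M)
          each r false Br = z≤n
          each r true  Br = ℕ.≤-trans (ℕ.≤-reflexive (cong (_* q) (ℕ.*-identityˡ (cov h v₀ (x r))))) (ℕ.≤-trans
            (ℕ.*-monoˡ-≤ q (cov≤deg h-sym v₀ (x r))) (ℕ.≤-trans (low⁻ (proj₂ (∧⁻ {A (x r)} (x-Y Br)))) (ℕ.≤-reflexive (sym (ℕ.*-identityˡ (27 * M))))))

        A₁-bound : ∀ s → A₁ s + 3 * q ≤ n
        A₁-bound s = begin
          A₁ s + 3 * q
            ≡⟨ cong (_+ 3 * q) (trans (∑-+ (λ c → χ (not (Y c))) (λ c → ∑ λ r → χ (B r) * (⟦ c ≟ x r ⟧ + h v₀ (x r) c)))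
                 (cong (excluded +_) (trans (∑-comm (λ c r → χ (B r) * (⟦ c ≟ x r ⟧ + h v₀ (x r) c)))
                   (trans (∑-cong λ r → perSpot r) (∑-+ (λ r → χ (B r)) (λ r → χ (B r) * cov h v₀ (x r))))))) ⟩
          excluded + (∑ (λ r → χ (B r)) + linked) + 3 * q
            ≤⟨ ℕ.+-monoˡ-≤ (3 * q) (ℕ.+-monoʳ-≤ excluded both) ⟩
          excluded + q + 3 * q     ≡⟨ arith excluded q ⟩
          excluded + 4 * q         ≤⟨ excluded-bound ⟩
          n                        ∎
          where
          arith : ∀ e q → e + q + 3 * q ≡ e + 4 * q
          arith = solve-∀
          double : ∀ a b → 2 * (a + b) ≡ 2 * a + 2 * b
          double = solve-∀
          twice : ∀ q → q + q ≡ 2 * q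
          twice = solve-∀
          both : ∑ (λ r → χ (B r)) + linked ≤ q
          both = ℕ.*-cancelˡ-≤ 2 (ℕ.≤-trans (ℕ.≤-reflexive (double (∑ λ r → χ (B r)) linked))
            (ℕ.≤-trans (ℕ.+-mono-≤ (few-small (∑ λ s → χ (B s)) few) linked-small) (ℕ.≤-reflexive (twice q))))
          perSpot : ∀ r → ∑ (λ c → χ (B r) * (⟦ c ≟ x r ⟧ + h v₀ (x r) c)) ≡ χ (B r) + χ (B r) * cov h v₀ (x r)
          perSpot r = trans (sym (*-distribˡ-∑ (χ (B r)) (λ c → ⟦ c ≟ x r ⟧ + h v₀ (x r) c)))
            (trans (cong (χ (B r) *_) (trans (∑-+ (λ c → ⟦ c ≟ x r ⟧) (h v₀ (x r))) (cong (_+ cov h v₀ (x r)) (∑-⟦≟⟧ˡ (x r)))))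
              (trans (ℕ.*-distribˡ-+ (χ (B r)) 1 (cov h v₀ (x r))) (cong (_+ χ (B r) * cov h v₀ (x r)) (ℕ.*-identityʳ _))))

        D≤κ : ∀ s → χ (D s) ≤ κ s
        D≤κ s = cases (D s) refl
          where
          cases : ∀ b → D s ≡ b → χ b ≤ κ s
          cases false _  = z≤n
          cases true  Ds = ℕ.n≢0⇒n>0 (not-does⁻ (κ s ℕ.≟ 0) (Bool.not-injective (proj₂ (∧⁻ {J s ∧ not (does (s Fin.≟ p))} Ds))))

        -- The low degree of the pivot pays for injectivity: |D| n ≤ (27M/q) · 512q is of order M,
        -- and `c₃` compares it with q²/2.
        inj-bound : ∀ s → 2 * ∑ (λ w → ∑ λ (c : Fin n) → ∑ λ d → χ (D s) * (χ (D w) * ⟦ c ≟ d ⟧)) ≤ q * q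
        inj-bound s = ℕ.≤-trans (ℕ.*-monoʳ-≤ 2 (∑-pairs (D s) D)) (begin
          2 * (∑ (λ w → χ (D w)) * n)     ≤⟨ ℕ.*-monoʳ-≤ 2 (ℕ.*-mono-≤ (∑-mono D≤κ) n≤512q) ⟩
          2 * (deg ζ p * (512 * q))       ≡⟨ arith₁ 512 (deg ζ p) q ⟩
          2 * (512 * (deg ζ p * q))       ≤⟨ ℕ.*-monoʳ-≤ 2 (ℕ.*-monoʳ-≤ 512 (proj₂ (proj₂ pivot))) ⟩
          2 * (512 * (27 * M))            ≡⟨ cong (2 *_) (sym (ℕ.*-assoc 512 27 M)) ⟩
          2 * (13824 * M)                 ≤⟨ c₃ ⟩
          q * q                           ∎)
          where
          arith₁ : ∀ k d q → 2 * (d * (k * q)) ≡ 2 * (k * (d * q))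
          arith₁ = solve-∀

        -- `v₀` is prescribed and may have high degree, so deg h v₀ is bounded only by the total
        -- 27M. Lightness of `s` has to compensate for this.
        link-bound : ∀ s → T s ≡ true → 2 * ∑ (λ w → ∑ λ c → ∑ λ d → ζ p s w * h v₀ c d) ≤ q * q
        link-bound s Ts = begin
          2 * ∑ (λ w → ∑ λ c → ∑ λ d → ζ p s w * h v₀ c d)
            ≡⟨ cong (2 *_) (trans (∑-cong λ w → sym (trans (*-distribˡ-∑ (ζ p s w) (λ c → ∑ (h v₀ c))) (∑-cong λ c → *-distribˡ-∑ (ζ p s w) (h v₀ c))))
                 (sym (*-distribʳ-∑ (deg h v₀) (ζ p s)))) ⟩
          2 * (κ s * deg h v₀)       ≤⟨ ℕ.*-monoʳ-≤ 2 (ℕ.*-monoʳ-≤ (κ s) (ℕ.≤-trans (term≤∑ (deg h) v₀) h-total)) ⟩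
          2 * (κ s * (27 * M))       ≡⟨ arith 27 (κ s) M ⟩
          2 * 27 * (M * κ s)         ≤⟨ ℕ.*-monoˡ-≤ (M * κ s) (ℕ.≤ᵇ⇒≤ 54 64 _) ⟩
          64 * (M * κ s)             ≤⟨ light Ts ⟩
          q * q                      ∎
          where
          arith : ∀ k κ M → 2 * (κ * (k * M)) ≡ 2 * k * (M * κ)
          arith = solve-∀

        A₂-bound : ∀ s → T s ≡ true → A₂ s ≤ q * q
        A₂-bound s Ts = ℕ.*-cancelˡ-≤ 2 (begin
          2 * A₂ s
            ≡⟨ cong (2 *_) (trans (∑-cong λ w → trans (∑-cong λ c → ∑-+ (λ d → χ (D s) * (χ (D w) * ⟦ c ≟ d ⟧)) (λ d → ζ p s w * h v₀ c d))
                 (∑-+ (λ (c : Fin n) → ∑ λ d → χ (D s) * (χ (D w) * ⟦ c ≟ d ⟧)) (λ c → ∑ λ d → ζ p s w * h v₀ c d)))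
                 (∑-+ (λ w → ∑ λ (c : Fin n) → ∑ λ d → χ (D s) * (χ (D w) * ⟦ c ≟ d ⟧)) (λ w → ∑ λ c → ∑ λ d → ζ p s w * h v₀ c d))) ⟩
          2 * (X₁ + X₂)              ≡⟨ double X₁ X₂ ⟩
          2 * X₁ + 2 * X₂            ≤⟨ ℕ.+-mono-≤ (inj-bound s) (link-bound s Ts) ⟩
          q * q + q * q              ≡⟨ twice (q * q) ⟩
          2 * (q * q)                ∎)
          where
          X₁ = ∑ (λ w → ∑ λ (c : Fin n) → ∑ λ d → χ (D s) * (χ (D w) * ⟦ c ≟ d ⟧))
          X₂ = ∑ (λ w → ∑ λ c → ∑ λ d → ζ p s w * h v₀ c d)
          double : ∀ a b → 2 * (a + b) ≡ 2 * a + 2 * b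
          double = solve-∀
          twice : ∀ q → q + q ≡ 2 * q
          twice = solve-∀

        opaque
          assigned : ∃[ φ ] Valid T φ
          assigned = penalty-free q 1≤q (ℕ.<-≤-trans 1≤q (ℕ.≤-trans (ℕ.m≤n*m q 256) 256q≤n)) T (λ s _ → A₁-bound s) A₂-bound
            (λ s _ → ℕ.≤-trans (ℕ.≤-reflexive (∑⁵-zero {n})) z≤n)

        y φ : Fin n → Fin n
        y = lookup (proj₁ assigned)
        φ s = if heavy s then x s else y s

        P₁-zero : ∀ {s} → T s ≡ true → P₁ s (y s) ≡ 0
        P₁-zero {s} = proj₁ (proj₂ assigned) s

        P₂-zero : ∀ {s t} → T s ≡ true → T t ≡ true → s ≢ t → P₂ s t (y s) (y t) ≡ 0
        P₂-zero {s} {t} = proj₁ (proj₂ (proj₂ assigned)) s t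

        spot-zero : ∀ {s r} → T s ≡ true → B r ≡ true → ⟦ y s ≟ x r ⟧ + h v₀ (x r) (y s) ≡ 0
        spot-zero {s} {r} Ts Br = χ*-≡0 Br (∑≡0 _ (ℕ.m+n≡0⇒n≡0 (χ (not (Y (y s)))) (P₁-zero Ts)) r)

        data Kind (s : Fin n) : Set where
          isB : B s ≡ true → φ s ≡ x s → Kind s
          isT : T s ≡ true → φ s ≡ y s → Kind s

        kind : ∀ s → D s ≡ true → Kind s
        kind s Ds = cases (heavy s) refl
          where
          cases : ∀ b → heavy s ≡ b → Kind s
          cases true  eq = isB (∧⁺ Ds eq) (cong (λ b → if b then x s else y s) eq)
          cases false eq = isT (∧⁺ Ds (cong not eq)) (cong (λ b → if b then x s else y s) eq)

        φ-A : ∀ s → D s ≡ true → A (φ s) ≡ true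
        φ-A s Ds with kind s Ds
        ... | isB Bs es = subst (λ c → A c ≡ true) (sym es) (proj₁ (∧⁻ (x-Y Bs)))
        ... | isT Ts es = subst (λ c → A c ≡ true) (sym es) (proj₁ (∧⁻ (χ-not≡0⇒true (ℕ.m+n≡0⇒m≡0 _ (P₁-zero Ts)))))

        φ-injective : ∀ s t → D s ≡ true → D t ≡ true → s ≢ t → φ s ≢ φ t
        φ-injective s t Ds Dt s≢t φ≡ with kind s Ds | kind t Dt
        ... | isB Bs es | isB Bt et = proj₁ (x-apart Bs Bt s≢t) (trans (sym es) (trans φ≡ et))
        ... | isB Bs es | isT Tt et = ⟦≟⟧≡0⇒≢ (ℕ.m+n≡0⇒m≡0 _ (spot-zero Tt Bs)) (trans (sym et) (trans (sym φ≡) es))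
        ... | isT Ts es | isB Bt et = ⟦≟⟧≡0⇒≢ (ℕ.m+n≡0⇒m≡0 _ (spot-zero Ts Bt)) (trans (sym es) (trans φ≡ et))
        ... | isT Ts es | isT Tt et = ⟦≟⟧≡0⇒≢ (χ*-≡0 Dt (χ*-≡0 Ds (ℕ.m+n≡0⇒m≡0 _ (P₂-zero Ts Tt s≢t)))) (trans (sym es) (trans φ≡ et))

        -- Two heavy vertices are apart by codegree zero, a mixed pair is excluded by `P₁`, and two
        -- light vertices by `P₂`.
        packed : ∀ s t → D s ≡ true → D t ≡ true → s ≢ t → ζ p s t * h v₀ (φ s) (φ t) ≡ 0
        packed s t Ds Dt s≢t with kind s Ds | kind t Dt
        ... | isB Bs es | isB Bt et = vanish (trans (cong₂ (h v₀) es et) (trans (swap₁₂ h-sym v₀ (x s) (x t)) (trans (swap₂₃ h-sym (x s) v₀ (x t))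
          (cov≡0 h-sym v₀ (proj₂ (x-apart Bs Bt s≢t))))))
          where
          vanish : h v₀ (φ s) (φ t) ≡ 0 → ζ p s t * h v₀ (φ s) (φ t) ≡ 0
          vanish eq = trans (cong (ζ p s t *_) eq) (ℕ.*-zeroʳ (ζ p s t))
        ... | isB Bs es | isT Tt et = trans (cong (ζ p s t *_) (trans (cong₂ (h v₀) es et) (ℕ.m+n≡0⇒n≡0 ⟦ y t ≟ x s ⟧ (spot-zero Tt Bs)))) (ℕ.*-zeroʳ (ζ p s t))
        ... | isT Ts es | isB Bt et = trans (cong (ζ p s t *_) (trans (cong₂ (h v₀) es et) (trans (swap₂₃ h-sym v₀ (y s) (x t))
          (ℕ.m+n≡0⇒n≡0 ⟦ y s ≟ x t ⟧ (spot-zero Ts Bt))))) (ℕ.*-zeroʳ (ζ p s t))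
        ... | isT Ts es | isT Tt et = trans (cong (ζ p s t *_) (cong₂ (h v₀) es et)) (ℕ.m+n≡0⇒n≡0 (χ (D s) * (χ (D t) * ⟦ y s ≟ y t ⟧)) (P₂-zero Ts Tt s≢t))

open Packing

-- Extending partial injections to permutations, and critical inputs.

module Extremal where

  transpose-≡ : ∀ {n} (i j : Fin n) → PC.transpose i j i ≡ j
  transpose-≡ i j with i Fin.≟ i
  ... | yes _  = refl
  ... | no i≢i = contradiction refl i≢i

  transpose-≢ : ∀ {n} {i j k : Fin n} → k ≢ i → k ≢ j → PC.transpose i j k ≡ k
  transpose-≢ {i = i} {j} {k} k≢i k≢j with k Fin.≟ i
  ... | yes k≡i = contradiction k≡i k≢i
  ... | no _ with k Fin.≟ j
  ...   | yes k≡j = contradiction k≡j k≢j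
  ...   | no _    = refl

  transpose-≡ʳ : ∀ {n} {i j : Fin n} → j ≢ i → PC.transpose i j j ≡ i
  transpose-≡ʳ {i = i} {j} j≢i with j Fin.≟ i
  ... | yes j≡i = contradiction j≡i j≢i
  ... | no _ with j Fin.≟ j
  ...   | yes _  = refl
  ...   | no j≢j = contradiction refl j≢j

  transpose-closed : ∀ {n} (A : Fin n → Bool) {i j : Fin n} k → A i ≡ true → A j ≡ true → A k ≡ true → A (PC.transpose i j k) ≡ true
  transpose-closed A {i} {j} k Ai Aj Ak with k Fin.≟ i
  ... | yes _ = Aj
  ... | no _ with k Fin.≟ j
  ...   | yes _ = Ai
  ...   | no _  = Ak

  -- σ is corrected by one transposition for each element of `D`. Every transposition exchanges two
  -- elements of `A`, so `A` is preserved and the values of σ outside `A` never change.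
  extend-injection : ∀ {n} (σ : Permutation′ n) (A D : Fin n → Bool) (φ : Fin n → Fin n) →
    (∀ i → D i ≡ true → A (σ ⟨$⟩ʳ i) ≡ true) → (∀ i → D i ≡ true → A (φ i) ≡ true) →
    (∀ i j → D i ≡ true → D j ≡ true → i ≢ j → φ i ≢ φ j) →
    ∃[ ρ ] ((∀ i → D i ≡ true → ρ ⟨$⟩ʳ i ≡ φ i) ×
            (∀ i → A (σ ⟨$⟩ʳ i) ≡ true → A (ρ ⟨$⟩ʳ i) ≡ true) ×
            (∀ i → A (σ ⟨$⟩ʳ i) ≡ false → ρ ⟨$⟩ʳ i ≡ σ ⟨$⟩ʳ i))
  extend-injection {n} σ A D φ σD∈A φD∈A φ-inj with stage n
    where
    Good : ℕ → Permutation′ n → Set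
    Good k ρ = (∀ i → toℕ i < k → D i ≡ true → ρ ⟨$⟩ʳ i ≡ φ i) ×
      (∀ i → A (σ ⟨$⟩ʳ i) ≡ true → A (ρ ⟨$⟩ʳ i) ≡ true) × (∀ i → A (σ ⟨$⟩ʳ i) ≡ false → ρ ⟨$⟩ʳ i ≡ σ ⟨$⟩ʳ i)
    stage : ∀ k → ∃ (Good k)
    stage zero = σ , (λ _ ()) , (λ _ Aσi → Aσi) , (λ _ _ → refl)
    stage (suc k) with stage k | k ℕ.<? n
    ... | ρ , agree , inside , outside | no k≮n =
      ρ , (λ i _ → agree i (ℕ.<-≤-trans (Fin.toℕ<n i) (ℕ.≮⇒≥ k≮n))) , inside , outside
    ... | ρ , agree , inside , outside | yes k<n with D (fromℕ< k<n) in eq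
    ...   | false = ρ , agree′ , inside , outside
      where
      agree′ : ∀ i → toℕ i < suc k → D i ≡ true → ρ ⟨$⟩ʳ i ≡ φ i
      agree′ i i≤k Di with ℕ.m≤n⇒m<n∨m≡n (ℕ.s≤s⁻¹ i≤k)
      ... | inj₁ i<k = agree i i<k Di
      ... | inj₂ i≡k = contradiction (trans (sym Di) (trans (cong D (Fin.toℕ-injective (trans i≡k (sym (Fin.toℕ-fromℕ< k<n))))) eq)) λ ()
    -- The current value at `i₀` is exchanged with the desired one. Values already corrected differ
    -- from both, the former by bijectivity of ρ and the latter by injectivity of φ.
    ...   | true = ρ ∘ₚ Perm.transpose (ρ ⟨$⟩ʳ i₀) (φ i₀) , agree′ , inside′ , outside′
      where
      i₀ = fromℕ< k<n
      agree′ : ∀ i → toℕ i < suc k → D i ≡ true → PC.transpose (ρ ⟨$⟩ʳ i₀) (φ i₀) (ρ ⟨$⟩ʳ i) ≡ φ i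
      agree′ i i≤k Di with ℕ.m≤n⇒m<n∨m≡n (ℕ.s≤s⁻¹ i≤k)
      ... | inj₁ i<k = trans (transpose-≢ (i≢i₀ ∘ Perm-injective) λ e → φ-inj i i₀ Di eq i≢i₀ (trans (sym (agree i i<k Di)) e)) (agree i i<k Di)
        where
        i≢i₀ : i ≢ i₀
        i≢i₀ refl = ℕ.<-irrefl (Fin.toℕ-fromℕ< k<n) i<k
        Perm-injective : ρ ⟨$⟩ʳ i ≡ ρ ⟨$⟩ʳ i₀ → i ≡ i₀
        Perm-injective e = trans (sym (inverseˡ ρ)) (trans (cong (ρ ⟨$⟩ˡ_) e) (inverseˡ ρ))
      ... | inj₂ i≡k with Fin.toℕ-injective {i = i} {i₀} (trans i≡k (sym (Fin.toℕ-fromℕ< k<n)))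
      ...   | refl = transpose-≡ (ρ ⟨$⟩ʳ i₀) (φ i₀)
      inside′ : ∀ i → A (σ ⟨$⟩ʳ i) ≡ true → A (PC.transpose (ρ ⟨$⟩ʳ i₀) (φ i₀) (ρ ⟨$⟩ʳ i)) ≡ true
      inside′ i Aσi = transpose-closed A (ρ ⟨$⟩ʳ i) (inside i₀ (σD∈A i₀ eq)) (φD∈A i₀ eq) (inside i Aσi)
      outside′ : ∀ i → A (σ ⟨$⟩ʳ i) ≡ false → PC.transpose (ρ ⟨$⟩ʳ i₀) (φ i₀) (ρ ⟨$⟩ʳ i) ≡ σ ⟨$⟩ʳ i
      outside′ i Aσi = trans (transpose-≢ (avoid (inside i₀ (σD∈A i₀ eq))) (avoid (φD∈A i₀ eq))) (outside i Aσi)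
        where
        avoid : ∀ {c} → A c ≡ true → ρ ⟨$⟩ʳ i ≢ c
        avoid Ac refl = contradiction (trans (sym Ac) (trans (cong A (outside i Aσi)) Aσi)) λ ()
  ... | ρ , agree , inside , outside = ρ , (λ i → agree i (Fin.toℕ<n i)) , inside , outside

  -- Starting from f x ≡ b, flip entries equal to b as long as the value of f is unchanged.
  critical : ∀ {N} (f : (Fin N → Bool) → Bool) b x → f x ≡ b →
    ∃[ y ] (f y ≡ b × (∀ i → x i ≡ not b → y i ≡ not b) × (∀ i → y i ≡ b → f (flipAt i y) ≡ not b))
  critical {N} f b x = go (measure x) x ℕ.≤-refl
    where
    measure : (Fin N → Bool) → ℕ
    measure x = ∑ λ i → χ (does (x i Bool.≟ b))
    go : ∀ k x → measure x ≤ k → f x ≡ b →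
      ∃[ y ] (f y ≡ b × (∀ i → x i ≡ not b → y i ≡ not b) × (∀ i → y i ≡ b → f (flipAt i y) ≡ not b))
    go k x x≤k fx with Fin.any? (λ i → (x i Bool.≟ b) ×-dec (f (flipAt i x) Bool.≟ b))
    ... | no ∄i = x , fx , (λ _ p → p) , λ i xi → Bool.¬-not (λ e → ∄i (i , xi , e))
    ... | yes (i , xi , fi) = step k x≤k
      where
      x′ = flipAt i x
      x′i : x′ i ≡ not (x i)
      x′i = cong (λ c → if c then not (x i) else x i) (dec-true (i Fin.≟ i) refl)
      keep : ∀ j → i ≢ j → x′ j ≡ x j
      keep j i≢j = cong (λ c → if c then not (x j) else x j) (dec-false (i Fin.≟ j) i≢j)
      smaller : measure x′ < measure x
      smaller = ∑-mono-< le i lt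
        where
        at-i : does (x′ i Bool.≟ b) ≡ false
        at-i = dec-false (x′ i Bool.≟ b) λ e → Bool.not-¬ refl (trans (sym e) (trans x′i (cong not xi)))
        lt : χ (does (x′ i Bool.≟ b)) < χ (does (x i Bool.≟ b))
        lt = subst₂ (λ c d → χ c < χ d) (sym at-i) (sym (dec-true (x i Bool.≟ b) xi)) (s≤s z≤n)
        le : ∀ j → χ (does (x′ j Bool.≟ b)) ≤ χ (does (x j Bool.≟ b))
        le j with i Fin.≟ j
        ... | yes refl = ℕ.<⇒≤ (subst (λ c → χ (does (c Bool.≟ b)) < χ (does (x i Bool.≟ b))) x′i lt)
        ... | no _     = ℕ.≤-refl
      step : ∀ k → measure x ≤ k → ∃[ y ] (f y ≡ b × (∀ j → x j ≡ not b → y j ≡ not b) × (∀ j → y j ≡ b → f (flipAt j y) ≡ not b))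
      step zero    x≤0 = contradiction (ℕ.<-≤-trans smaller x≤0) λ ()
      step (suc k) x≤k with go k x′ (ℕ.s≤s⁻¹ (ℕ.<-≤-trans smaller x≤k)) fi
      ... | y , fy , below , crit = y , fy , (λ j xj → below j (trans (keep j (λ { refl → Bool.not-¬ refl (trans (sym xi) xj) })) xj)) , crit

open Extremal

-- Inputs as hypergraphs, and the threshold α.

module Hypergraphs where

  open import Data.Nat.Combinatorics using (_C_)

  remove : ∀ {n} → (Fin n → Bool) → Fin n → Fin n → Bool
  remove g a v = g v ∧ not (does (v Fin.≟ a))

  remove⁻ : ∀ {n} (g : Fin n → Bool) {a v} → remove g a v ≡ true → g v ≡ true × v ≢ a
  remove⁻ g {a} {v} p = proj₁ (∧⁻ p) , not-does⁻ (v Fin.≟ a) (Bool.not-injective (proj₂ (∧⁻ {g v} p)))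

  ∑-remove : ∀ {n} (g : Fin n → Bool) a → ∑ (λ v → χ (g v)) ≤ suc (∑ λ v → χ (remove g a v))
  ∑-remove g a = ℕ.≤-trans (∑-mono λ v → le (g v) (does (v Fin.≟ a)))
    (ℕ.≤-reflexive (trans (∑-+ (λ v → ⟦ v ≟ a ⟧) (λ v → χ (remove g a v))) (cong (_+ ∑ (λ v → χ (remove g a v))) (∑-⟦≟⟧ˡ a))))
    where
    le : ∀ b c → χ b ≤ χ c + χ (b ∧ not c)
    le true  true  = s≤s z≤n
    le true  false = s≤s z≤n
    le false c     = z≤n

  pick : ∀ {n} (g : Fin n → Bool) → 0 < ∑ (λ v → χ (g v)) → ∃[ a ] g a ≡ true
  pick g 0<∑ with ∑-pos _ 0<∑
  ... | a , 0<χ = a , pos (g a) 0<χ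
    where
    pos : ∀ b → 0 < χ b → b ≡ true
    pos true _ = refl

  two-others : ∀ {n} (g : Fin n → Bool) → 3 ≤ ∑ (λ v → χ (g v)) → ∀ p →
    ∃[ s ] ∃[ t ] ((g s ≡ true × s ≢ p) × (g t ≡ true × t ≢ p) × s ≢ t)
  two-others g 3≤ p with pick (remove g p) (ℕ.<-≤-trans (s≤s z≤n) 2≤)
    where
    2≤ : 2 ≤ ∑ (λ v → χ (remove g p v))
    2≤ = ℕ.s≤s⁻¹ (ℕ.≤-trans 3≤ (∑-remove g p))
  ... | s , s∈ with pick (remove (remove g p) s) (ℕ.s≤s⁻¹ (ℕ.≤-trans (ℕ.s≤s⁻¹ (ℕ.≤-trans 3≤ (∑-remove g p))) (∑-remove (remove g p) s)))
  ...   | t , t∈ = s , t , remove⁻ g s∈ , remove⁻ g (proj₁ (remove⁻ (remove g p) t∈)) , (λ s≡t → proj₂ (remove⁻ (remove g p) t∈) (sym s≡t))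

  ∣∣≡∑ : ∀ {n} (e : Vec Bool n) → ∣ e ∣ ≡ ∑ (λ v → χ (lookup e v))
  ∣∣≡∑ []          = refl
  ∣∣≡∑ (true  ∷ e) = cong suc (∣∣≡∑ e)
  ∣∣≡∑ (false ∷ e) = ∣∣≡∑ e

  ∑-<ᵇ : ∀ n m → m ≤ n → ∑ {n} (λ v → χ (toℕ v ℕ.<ᵇ m)) ≡ m
  ∑-<ᵇ n       zero    _   = ∑-zero {n}
  ∑-<ᵇ (suc n) (suc m) m≤n = cong suc (∑-<ᵇ n m (ℕ.s≤s⁻¹ m≤n))

  <ᵇ⁻ : ∀ {a b} → (a ℕ.<ᵇ b) ≡ true → a < b
  <ᵇ⁻ {a} {b} e = ℕ.<ᵇ⇒< a b (Equivalence.from Bool.T-≡ e)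

  <ᵇ⁺ : ∀ {a b} → a < b → (a ℕ.<ᵇ b) ≡ true
  <ᵇ⁺ {a} {b} a<b = Equivalence.to Bool.T-≡ (ℕ.<⇒<ᵇ a<b)

  <ᵇ-strengthen : ∀ {a m} → (a ℕ.<ᵇ suc m) ≡ true → a ≢ m → (a ℕ.<ᵇ m) ≡ true
  <ᵇ-strengthen a≤m a≢m = <ᵇ⁺ (ℕ.≤∧≢⇒< (ℕ.s≤s⁻¹ (<ᵇ⁻ a≤m)) a≢m)

  module Edges (n : ℕ) where

    Input : Set
    Input = Fin (n C 3) → Bool

    edge : Fin (n C 3) → KSubset n 3
    edge = Inverse.from (index n 3)

    number : KSubset n 3 → Fin (n C 3)
    number = Inverse.to (index n 3)

    edge-number : ∀ e → edge (number e) ≡ e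
    edge-number = Inverse.strictlyInverseʳ (index n 3)

    mem : Fin (n C 3) → Fin n → Bool
    mem i a = lookup (proj₁ (edge i)) a

    mem-size : ∀ i → ∑ (λ a → χ (mem i a)) ≡ 3
    mem-size i = trans (sym (∣∣≡∑ (proj₁ (edge i)))) (proj₂ (edge i))

    image : Permutation′ n → Fin (n C 3) → Fin (n C 3)
    image π i = number (π ⟪ edge i ⟫)

    mem-image : ∀ π i v → mem (image π i) v ≡ mem i (π ⟨$⟩ˡ v)
    mem-image π i v = trans (cong (λ e → lookup (proj₁ e) v) (edge-number (π ⟪ edge i ⟫)))
      (lookup∘tabulate (λ u → lookup (proj₁ (edge i)) (π ⟨$⟩ˡ u)) v)

    -- At most one if a, b and c are distinct.
    tri : Input → Weight {n}
    tri x a b c = ∑ λ i → χ (x i) * (χ (mem i a) * (χ (mem i b) * χ (mem i c)))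

    tri-sym : ∀ x → Symmetric (tri x)
    tri-sym x = record
      { swap₁₂ = λ a b c → ∑-cong λ i → cong (χ (x i) *_) (exchange (χ (mem i a)) (χ (mem i b)) (χ (mem i c)))
      ; swap₂₃ = λ a b c → ∑-cong λ i → cong (λ z → χ (x i) * (χ (mem i a) * z)) (ℕ.*-comm (χ (mem i b)) (χ (mem i c))) }
      where
      exchange : ∀ a b c → a * (b * c) ≡ b * (a * c)
      exchange = solve-∀

    -- For each hyperedge the three sums over its members separate, each with value 3.
    tri-total : ∀ x → total (tri x) ≡ 27 * ∑ (λ i → χ (x i))
    tri-total x = begin
      ∑ (λ a → ∑ λ b → ∑ λ c → ∑ λ i → F i a b c)
        ≡⟨ ∑-cong (λ a → trans (∑-cong λ b → ∑-comm (λ c i → F i a b c)) (∑-comm (λ b i → ∑ λ c → F i a b c))) ⟩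
      ∑ (λ a → ∑ λ i → ∑ λ b → ∑ λ c → F i a b c)
        ≡⟨ ∑-comm (λ a i → ∑ λ b → ∑ λ c → F i a b c) ⟩
      ∑ (λ i → ∑ λ a → ∑ λ b → ∑ λ c → F i a b c)
        ≡⟨ ∑-cong each ⟩
      ∑ (λ i → 27 * χ (x i))
        ≡⟨ sym (*-distribˡ-∑ 27 (λ i → χ (x i))) ⟩
      27 * ∑ (λ i → χ (x i)) ∎
      where
      open ≡.≡-Reasoning
      F : Fin (n C 3) → Fin n → Fin n → Fin n → ℕ
      F i a b c = χ (x i) * (χ (mem i a) * (χ (mem i b) * χ (mem i c)))
      μ : Fin (n C 3) → Fin n → ℕ
      μ i a = χ (mem i a)
      cube : ∀ i → ∑ (λ a → ∑ λ b → ∑ λ c → μ i a * (μ i b * μ i c)) ≡ 27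
      cube i = trans (∑-cong λ a → trans (∑-cong λ b → trans (sym (*-distribˡ-∑ (μ i a) (λ c → μ i b * μ i c)))
          (cong (μ i a *_) (trans (sym (*-distribˡ-∑ (μ i b) (μ i))) (cong (μ i b *_) (mem-size i)))))
        (trans (sym (*-distribˡ-∑ (μ i a) (λ b → μ i b * 3))) (cong (μ i a *_) (trans (sym (*-distribʳ-∑ 3 (μ i))) (cong (_* 3) (mem-size i))))))
        (trans (sym (*-distribʳ-∑ 9 (μ i))) (cong (_* 9) (mem-size i)))
      each : ∀ i → ∑ (λ a → ∑ λ b → ∑ λ c → F i a b c) ≡ 27 * χ (x i)
      each i = trans (sym (trans (*-distribˡ-∑ (χ (x i)) (λ a → ∑ λ b → ∑ λ c → μ i a * (μ i b * μ i c)))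
          (∑-cong λ a → trans (*-distribˡ-∑ (χ (x i)) (λ b → ∑ λ c → μ i a * (μ i b * μ i c)))
            (∑-cong λ b → *-distribˡ-∑ (χ (x i)) (λ c → μ i a * (μ i b * μ i c))))))
        (trans (cong (χ (x i) *_) (cube i)) (ℕ.*-comm (χ (x i)) 27))

    tri-pos : ∀ x i {a b c} → x i ≡ true → mem i a ≡ true → mem i b ≡ true → mem i c ≡ true → tri x a b c ≢ 0
    tri-pos x i {a} {b} {c} xi ia ib ic ≡0 = contradiction (trans (sym one) (∑≡0 _ ≡0 i)) λ ()
      where
      one : χ (x i) * (χ (mem i a) * (χ (mem i b) * χ (mem i c))) ≡ 1
      one rewrite xi | ia | ib | ic = refl

    module _ (H : Hypergraph n) where

      f-true : ∀ {x} → H ⊑ decode x → f H x ≡ true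
      f-true {x} H⊑x = trans (isYes≗does (H ⊑? decode x)) (dec-true (H ⊑? decode x) H⊑x)

      f-true⁻ : ∀ {x} → f H x ≡ true → H ⊑ decode x
      f-true⁻ {x} fx = does⁻ (H ⊑? decode x) (trans (sym (isYes≗does (H ⊑? decode x))) fx)

      -- Monotonicity and invariance under relabelling in one statement: a copy of `H` in `x` is
      -- composed with π.
      f-embed : ∀ {x y} (π : Permutation′ n) → f H x ≡ true → (∀ i → x i ≡ true → y (image π i) ≡ true) → f H y ≡ true
      f-embed {x} {y} π fx x⊑y = f-true {y} (σ ∘ₚ π , λ e He → subst (λ e′ → y (number e′) ≡ true) (sym (compose e))
          (subst (λ e′ → y (number (π ⟪ e′ ⟫)) ≡ true) (edge-number (σ ⟪ e ⟫)) (x⊑y (number (σ ⟪ e ⟫)) (proj₂ H⊑x e He))))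
        where
        H⊑x : H ⊑ decode x
        H⊑x = f-true⁻ {x} fx
        σ : Permutation′ n
        σ = proj₁ H⊑x
        compose : ∀ e → (σ ∘ₚ π) ⟪ e ⟫ ≡ π ⟪ σ ⟪ e ⟫ ⟫
        compose e = KSubset-≡ (tabulate-cong λ v → sym (lookup∘tabulate (λ u → lookup (proj₁ e) (σ ⟨$⟩ˡ u)) (π ⟨$⟩ˡ v)))

      inside? : ∀ m i → Dec (∀ a → mem i a ≡ true → toℕ a < m)
      inside? m i = Fin.all? λ a → (mem i a Bool.≟ true) →-dec (toℕ a ℕ.<? m)

      hole : ℕ → Input
      hole m i = not (does (inside? m i))

      hole-false : ∀ m i → hole m i ≡ false → ∀ a → mem i a ≡ true → toℕ a < m
      hole-false m i e = does⁻ (inside? m i) (Bool.not-injective e)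

      hole-0 : f H (hole 0) ≡ true
      hole-0 = f-true {hole 0} (Perm.id , λ e _ → nonempty (number (Perm.id ⟪ e ⟫)))
        where
        nonempty : ∀ i → hole 0 i ≡ true
        nonempty i = cong not (dec-false (inside? 0 i) λ all → contradiction (all (proj₁ someone) (proj₂ someone)) λ ())
          where
          someone : ∃[ a ] mem i a ≡ true
          someone = pick (mem i) (subst (0 <_) (sym (mem-size i)) (s≤s z≤n))

      hole-n : HasHyperedge H → f H (hole n) ≡ false
      hole-n (e , He) = Bool.¬-not λ fh → let H⊑ = f-true⁻ {hole n} fh in
        contradiction (proj₂ H⊑ e He) (Bool.not-¬ (full (number (proj₁ H⊑ ⟪ e ⟫))))
        where
        full : ∀ i → hole n i ≡ false
        full i = cong not (dec-true (inside? n i) λ a _ → Fin.toℕ<n a)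

      -- `hole 0` is complete and contains `H`, whereas `hole n` is empty and does not, as `H` has a
      -- hyperedge. Descending from n must meet a change.
      threshold : HasHyperedge H → ∃[ α ] (α < n × f H (hole α) ≡ true × f H (hole (suc α)) ≡ false)
      threshold H≢∅ = go n ℕ.≤-refl (hole-n H≢∅)
        where
        Threshold = ∃[ α ] (α < n × f H (hole α) ≡ true × f H (hole (suc α)) ≡ false)
        go : ∀ k → k ≤ n → f H (hole k) ≡ false → Threshold
        go zero    _   f0 = contradiction (trans (sym hole-0) f0) λ ()
        go (suc k) k<n fk = cases (f H (hole k)) refl
          where
          cases : ∀ b → f H (hole k) ≡ b → Threshold
          cases true  eq = k , k<n , eq , fk
          cases false eq = go k (ℕ.<⇒≤ k<n) eq

open Hypergraphs

-- Few sensitive bits lead to a contradiction.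

module Dichotomy where

  open import Data.Nat.Combinatorics using (_C_)

  m*n≢0 : ∀ {a b} → a ≢ 0 → b ≢ 0 → a * b ≢ 0
  m*n≢0 {a} a≢0 b≢0 ab≡0 with ℕ.m*n≡0⇒m≡0∨n≡0 a ab≡0
  ... | inj₁ a≡0 = a≢0 a≡0
  ... | inj₂ b≡0 = b≢0 b≡0

  module _ (n M q : ℕ) (1≤q : 1 ≤ q) (1≤M : 1 ≤ M) (256q≤n : 256 * q ≤ n) (n≤512q : n ≤ 512 * q)
    (c₁ : 2 * (884736 * (M * M)) ≤ q * q * q * q)
    (c₂ : 2 * (46656 * (M * M * M)) ≤ q * q * q * q * q)
    (c₃ : 2 * (13824 * M) ≤ q * q)
    (H : Hypergraph n) (H≢∅ : HasHyperedge H)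
    (sensitivity≤M : ∀ (x S : Fin (n C 3) → Bool) → (∀ i → S i ≡ true → f H (flipAt i x) ≡ not (f H x)) → ∑ (λ i → χ (S i)) ≤ M) where

    open Edges n
    open Regime n M q 1≤q 1≤M 256q≤n n≤512q c₁ c₂ c₃

    module Clash (α : ℕ) (α<n : α < n) (x y : Input)
      (fx : f H x ≡ true) (fy : f H y ≡ false)
      (x⊑hole : ∀ i → hole H α i ≡ false → x i ≡ false) (hole⊑y : ∀ i → hole H (suc α) i ≡ true → y i ≡ true)
      (x-count : ∑ (λ i → χ (x i)) ≤ M) (z-count : ∑ (λ i → χ (not (y i))) ≤ M) where

      z : Input
      z i = not (y i)

      h ζ : Weight {n}
      h = tri x
      ζ = tri z

      h-total : total h ≤ 27 * M
      h-total = ℕ.≤-trans (ℕ.≤-reflexive (tri-total x)) (ℕ.*-monoʳ-≤ 27 x-count)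

      ζ-total : total ζ ≤ 27 * M
      ζ-total = ℕ.≤-trans (ℕ.≤-reflexive (tri-total z)) (ℕ.*-monoʳ-≤ 27 z-count)

      A J : Fin n → Bool
      A v = toℕ v ℕ.<ᵇ α
      J v = toℕ v ℕ.<ᵇ suc α

      z⊆J : ∀ j v → z j ≡ true → mem j v ≡ true → J v ≡ true
      z⊆J j v zj jv = <ᵇ⁺ (hole-false H (suc α) j (Bool.¬-not λ hj → contradiction (trans (sym zj) (cong not (hole⊑y j hj))) λ ()) v jv)

      x⊈A : ∀ i → x i ≡ true → ¬ (∀ v → mem i v ≡ true → A v ≡ true)
      x⊈A i xi i⊆A = contradiction (trans (sym xi) (x⊑hole i (cong not (dec-true (inside? H α i) λ v iv → <ᵇ⁻ (i⊆A v iv))))) λ ()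

      3≤ : ∀ j → 3 ≤ ∑ (λ v → χ (mem j v))
      3≤ j = ℕ.≤-reflexive (sym (mem-size j))

      -- The inverse of ρ embeds `x` into `y` unless some hyperedge of `x` is the image under ρ of a
      -- non-hyperedge of `y`.
      packing⇒⊥ : ∀ (ρ : Permutation′ n) →
        (∀ i j → x i ≡ true → z j ≡ true → (∀ v → mem j v ≡ mem i (ρ ⟨$⟩ʳ v)) → ⊥) → ⊥
      packing⇒⊥ ρ clash = contradiction (trans (sym fy) (f-embed H {x} {y} (flip ρ) fx λ i xi → Bool.¬-not λ yj≡false →
        clash i (image (flip ρ) i) xi (cong not yj≡false) (mem-image (flip ρ) i))) λ ()

      small : suc α ≤ 5 * q → ⊥
      small α<5q = packing⇒⊥ ρ clash
        where
        module S = Small (tri-sym x) (tri-sym z) h-total ζ-total J (ℕ.≤-trans (ℕ.≤-reflexive (∑-<ᵇ n (suc α) α<n)) α<5q)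
        -- With `A` everything there is no region to respect, so the injection on `J` is extended
        -- arbitrarily.
        extended = extend-injection Perm.id (λ _ → true) J S.φ (λ _ _ → refl) (λ _ _ → refl) S.φ-injective
        ρ = proj₁ extended
        agree = proj₁ (proj₂ extended)
        clash : ∀ i j → x i ≡ true → z j ≡ true → (∀ v → mem j v ≡ mem i (ρ ⟨$⟩ʳ v)) → ⊥
        clash i j xi zj same =
          let p , jp = pick (mem j) (ℕ.<-≤-trans (s≤s z≤n) (3≤ j))
              s , t , (js , s≢p) , (jt , t≢p) , s≢t = two-others (mem j) (3≤ j) p
          in m*n≢0 (tri-pos z j zj jp js jt) (tri-pos x i xi (moved p jp) (moved s js) (moved t jt))
            (S.packed p s t (z⊆J j p zj jp) (z⊆J j s zj js) (z⊆J j t zj jt) (s≢p ∘ sym) (t≢p ∘ sym) s≢t)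
          where
          moved : ∀ v → mem j v ≡ true → mem i (S.φ v) ≡ true
          moved v jv = trans (cong (mem i) (sym (agree v (z⊆J j v zj jv)))) (trans (sym (same v)) jv)

      v₀ : Fin n
      v₀ = fromℕ< α<n

      large : 5 * q ≤ α → ⊥
      large 5q≤α = packing⇒⊥ ρ clash
        where
        module L = Large (tri-sym x) (tri-sym z) h-total ζ-total A J v₀
          (ℕ.≤-trans 5q≤α (ℕ.≤-reflexive (sym (∑-<ᵇ n α (ℕ.<⇒≤ α<n)))))
          (ℕ.≤-trans (ℕ.m≤n⇒m≤1+n 5q≤α) (ℕ.≤-reflexive (sym (∑-<ᵇ n (suc α) α<n))))

        σ : Permutation′ n
        σ = Perm.transpose L.p v₀

        -- `v₀` is the only vertex of `J` outside `A`, so exchanging it with p carries the rest of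
        -- `J` into `A`. This also shows that all of `D` lies in the region where `extend-injection`
        -- may change σ.
        σ-A : ∀ v → J v ≡ true → v ≢ L.p → A (σ ⟨$⟩ʳ v) ≡ true
        σ-A v Jv v≢p = cases (v Fin.≟ v₀)
          where
          A-unless : ∀ w → J w ≡ true → w ≢ v₀ → A w ≡ true
          A-unless w Jw w≢v₀ = <ᵇ-strengthen Jw λ w≡α → w≢v₀ (Fin.toℕ-injective (trans w≡α (sym (Fin.toℕ-fromℕ< α<n))))
          cases : Dec (v ≡ v₀) → A (σ ⟨$⟩ʳ v) ≡ true
          cases (no v≢v₀) = subst (λ w → A w ≡ true) (sym (transpose-≢ v≢p v≢v₀)) (A-unless v Jv v≢v₀)
          cases (yes refl) = subst (λ w → A w ≡ true) (sym (transpose-≡ʳ v≢p)) (A-unless L.p (proj₁ (proj₂ L.pivot)) (v≢p ∘ sym))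

        D⁻ : ∀ {s} → L.D s ≡ true → J s ≡ true × s ≢ L.p
        D⁻ {s} Ds = let Js , s≢p = ∧⁻ {J s} (proj₁ (∧⁻ Ds)) in Js , not-does⁻ (s Fin.≟ L.p) (Bool.not-injective s≢p)

        D⁺ : ∀ {s} → J s ≡ true → s ≢ L.p → L.κ s ≢ 0 → L.D s ≡ true
        D⁺ {s} Js s≢p κ≢0 = ∧⁺ (∧⁺ Js (cong not (dec-false (s Fin.≟ L.p) s≢p))) (cong not (dec-false (L.κ s ℕ.≟ 0) κ≢0))

        extended = extend-injection σ A L.D L.φ (λ s Ds → σ-A s (proj₁ (D⁻ Ds)) (proj₂ (D⁻ Ds))) L.φ-A L.φ-injective
        ρ = proj₁ extended
        agree = proj₁ (proj₂ extended)
        ρ-A = proj₁ (proj₂ (proj₂ extended))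

        σp≡v₀ : σ ⟨$⟩ʳ L.p ≡ v₀
        σp≡v₀ = transpose-≡ L.p v₀

        ρp≡v₀ : ρ ⟨$⟩ʳ L.p ≡ v₀
        ρp≡v₀ = trans (proj₂ (proj₂ (proj₂ extended)) L.p (trans (cong A σp≡v₀) v₀∉A)) σp≡v₀
          where
          v₀∉A : A v₀ ≡ false
          v₀∉A = Bool.¬-not λ Av₀ → ℕ.<-irrefl (Fin.toℕ-fromℕ< α<n) (<ᵇ⁻ Av₀)

        clash : ∀ i j → x i ≡ true → z j ≡ true → (∀ v → mem j v ≡ mem i (ρ ⟨$⟩ʳ v)) → ⊥
        clash i j xi zj same = cases (mem j L.p) refl
          where
          moved : ∀ v → L.D v ≡ true → mem j v ≡ true → mem i (L.φ v) ≡ true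
          moved v Dv jv = trans (cong (mem i) (sym (agree v Dv))) (trans (sym (same v)) jv)
          back : ∀ v → mem i v ≡ true → mem j (ρ ⟨$⟩ˡ v) ≡ true
          back v iv = trans (same (ρ ⟨$⟩ˡ v)) (trans (cong (mem i) (inverseʳ ρ)) iv)
          -- A non-hyperedge of `y` that avoids the pivot lies in `J` and is carried into `A`, where
          -- `x` has no hyperedge.
          avoiding : mem j L.p ≡ false → ⊥
          avoiding jp = x⊈A i xi λ v iv → subst (λ w → A w ≡ true) (inverseʳ ρ)
            (ρ-A (ρ ⟨$⟩ˡ v) (σ-A (ρ ⟨$⟩ˡ v) (z⊆J j (ρ ⟨$⟩ˡ v) zj (back v iv))
              λ e → contradiction (trans (sym (back v iv)) (trans (cong (mem j) e) jp)) λ ()))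
          through : mem j L.p ≡ true → ∀ s t → mem j s ≡ true → s ≢ L.p → mem j t ≡ true → t ≢ L.p → s ≢ t → ⊥
          through jp s t js s≢p jt t≢p s≢t = m*n≢0 ζ≢0
            (tri-pos x i xi (trans (cong (mem i) (sym ρp≡v₀)) (trans (sym (same L.p)) jp)) (moved s Ds js) (moved t Dt jt))
            (L.packed s t Ds Dt s≢t)
            where
            ζ≢0 : ζ L.p s t ≢ 0
            ζ≢0 = tri-pos z j zj jp js jt
            Ds : L.D s ≡ true
            Ds = D⁺ (z⊆J j s zj js) s≢p λ κ≡0 → ζ≢0 (∑≡0 _ κ≡0 t)
            Dt : L.D t ≡ true
            Dt = D⁺ (z⊆J j t zj jt) t≢p λ κ≡0 → tri-pos z j zj jp jt js (∑≡0 _ κ≡0 s)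
          cases : ∀ b → mem j L.p ≡ b → ⊥
          cases false jp = avoiding jp
          cases true  jp = let s , t , (js , s≢p) , (jt , t≢p) , s≢t = two-others (mem j) (3≤ j) L.p
            in through jp s t js s≢p jt t≢p s≢t

      impossible : ⊥
      impossible = cases (suc α ℕ.≤? 5 * q)
        where
        cases : Dec (suc α ≤ 5 * q) → ⊥
        -- The cut at 5q serves both sides: `Large` needs q vertices of `A` for high degrees and 4q
        -- for its own choices, and `Small` can pay 5 · 512q² for injectivity out of 4096q².
        cases (yes α<5q) = small α<5q
        cases (no α≮5q)  = large (ℕ.s≤s⁻¹ (ℕ.≰⇒> α≮5q))

    few-sensitive⇒⊥ : ⊥
    few-sensitive⇒⊥ =
      let α , α<n , fα , fα+1 = threshold H H≢∅
          x , fx , x⊑hole , x-critical = critical (f H) true (hole H α) fα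
          y , fy , hole⊑y , y-critical = critical (f H) false (hole H (suc α)) fα+1
      in Clash.impossible α α<n x y fx fy x⊑hole hole⊑y
        (sensitivity≤M x x λ i xi → trans (x-critical i xi) (cong not (sym fx)))
        (sensitivity≤M y (not ∘ y) λ i yi → trans (y-critical i (Bool.not-injective yi)) (cong not (sym fy)))

open Dichotomy

-- Exponents, constants and the fifth root.

module Arithmetic where

  open import Data.Nat.Combinatorics using (_C_)

  ^-distrib-* : ∀ a b k → (a * b) ^ k ≡ a ^ k * b ^ k
  ^-distrib-* a b zero    = refl
  ^-distrib-* a b (suc k) = trans (cong (a * b *_) (^-distrib-* a b k)) (ℕ.[m*n]*[o*p]≡[m*o]*[n*p] a b (a ^ k) (b ^ k))

  ^-cancel-≤ : ∀ {a b} k .{{_ : ℕ.NonZero k}} → a ^ k ≤ b ^ k → a ≤ b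
  ^-cancel-≤ {a} {b} k aᵏ≤bᵏ with a ℕ.≤? b
  ... | yes a≤b = a≤b
  ... | no a≰b  = contradiction aᵏ≤bᵏ (ℕ.<⇒≱ (ℕ.^-monoˡ-< k (ℕ.≰⇒> a≰b)))

  -- The hypothesis X⁵<q⁸ says that M is at most of order q ^ (8/5).
  module Powers (γ M q : ℕ) (1≤γ : 1 ≤ γ) (1≤q : 1 ≤ q) (X⁵<q⁸ : (γ * M) ^ 5 < q ^ 8) where

    private instance
      q-nonZero : ℕ.NonZero q
      q-nonZero = ℕ.>-nonZero 1≤q

    open ℕ.≤-Reasoning

    1≤γ^ : ∀ k → 1 ≤ γ ^ k
    1≤γ^ k = subst (_≤ γ ^ k) (ℕ.^-zeroˡ k) (ℕ.^-monoˡ-≤ k 1≤γ)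

    lhs≤ : ∀ i → 1 ≤ i → (γ * M ^ i) ^ 5 ≤ ((γ * M) ^ 5) ^ i
    lhs≤ i@(suc i′) _ = begin
      (γ * M ^ i) ^ 5              ≡⟨ ^-distrib-* γ (M ^ i) 5 ⟩
      γ ^ 5 * (M ^ i) ^ 5          ≡⟨ cong (γ ^ 5 *_) (trans (ℕ.^-*-assoc M i 5) (trans (cong (M ^_) (ℕ.*-comm i 5)) (sym (ℕ.^-*-assoc M 5 i)))) ⟩
      γ ^ 5 * (M ^ 5) ^ i          ≤⟨ ℕ.*-monoˡ-≤ ((M ^ 5) ^ i) (ℕ.m≤m*n (γ ^ 5) ((γ ^ 5) ^ i′) {{ℕ.>-nonZero (subst (1 ≤_) (sym (ℕ.^-*-assoc γ 5 i′)) (1≤γ^ (5 * i′)))}}) ⟩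
      (γ ^ 5) ^ i * (M ^ 5) ^ i    ≡⟨ sym (^-distrib-* (γ ^ 5) (M ^ 5) i) ⟩
      (γ ^ 5 * M ^ 5) ^ i          ≡⟨ cong (_^ i) (sym (^-distrib-* γ M 5)) ⟩
      ((γ * M) ^ 5) ^ i            ∎

    -- In fifth powers, (γM)^5 < q^8 raised to the power i leaves the comparison 8i ≤ 5j of
    -- exponents of q; the surplus powers of γ are discarded.
    bound : ∀ i j → 1 ≤ i → 8 * i ≤ j * 5 → γ * M ^ i ≤ q ^ j
    bound i j 1≤i 8i≤5j = ^-cancel-≤ 5 (begin
      (γ * M ^ i) ^ 5        ≤⟨ lhs≤ i 1≤i ⟩
      ((γ * M) ^ 5) ^ i      ≤⟨ ℕ.^-monoˡ-≤ i (ℕ.<⇒≤ X⁵<q⁸) ⟩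
      (q ^ 8) ^ i            ≡⟨ ℕ.^-*-assoc q 8 i ⟩
      q ^ (8 * i)            ≤⟨ ℕ.^-monoʳ-≤ q 8i≤5j ⟩
      q ^ (j * 5)            ≡⟨ sym (ℕ.^-*-assoc q j 5) ⟩
      (q ^ j) ^ 5            ∎)

  module _ {n : ℕ} (H : Hypergraph n) (H≢∅ : HasHyperedge H) (M : ℕ)
    (sensitivity≤M : ∀ (x S : Fin (n C 3) → Bool) → (∀ i → S i ≡ true → f H (flipAt i x) ≡ not (f H x)) → ∑ (λ i → χ (S i)) ≤ M) where

    open Edges n

    -- A minimal input that contains `H` has a hyperedge because `H` has one, and that bit is
    -- sensitive.
    1≤M : 1 ≤ M
    1≤M =
      let x , fx , _ , crit = critical (f H) true (hole H 0) (hole-0 H)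
          π , h = f-true⁻ H {x} fx
          e , He = H≢∅
      in ℕ.≤-trans (subst (λ b → χ b ≤ ∑ (λ i → χ (x i))) (h e He) (term≤∑ (λ i → χ (x i)) (number (π ⟪ e ⟫))))
        (sensitivity≤M x x λ i xi → trans (crit i xi) (cong not (sym fx)))

    q⁸≤ : ∀ γ → 2 * 884736 ≤ γ → 2 * 46656 ≤ γ → 2 * 13824 ≤ γ → 1 ≤ γ →
      ∀ q → 1 ≤ q → 256 * q ≤ n → n ≤ 512 * q → q ^ 8 ≤ (γ * M) ^ 5
    q⁸≤ γ C₁ C₂ C₃ 1≤γ q 1≤q 256q≤n n≤512q = ℕ.≮⇒≥ λ X⁵<q⁸ →
      let open Powers γ M q 1≤γ 1≤q X⁵<q⁸ in
      few-sensitive⇒⊥ n M q 1≤q 1≤M 256q≤n n≤512q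
        -- The constraints on M², M³ and M need 16 ≤ 20, 24 ≤ 25 and 8 ≤ 10 respectively; the cubic
        -- one is the tightest.
        (ℕ.≤-trans (weaken 2 884736 (M * M) C₁) (subst₂ _≤_ (pow₂ γ M) (pow₄ q) (bound 2 4 (s≤s z≤n) (ℕ.≤ᵇ⇒≤ 16 20 _))))
        (ℕ.≤-trans (weaken 2 46656 (M * M * M) C₂) (subst₂ _≤_ (pow₃ γ M) (pow₅ q) (bound 3 5 (s≤s z≤n) (ℕ.≤ᵇ⇒≤ 24 25 _))))
        (ℕ.≤-trans (weaken 2 13824 M C₃) (subst₂ _≤_ (pow₁ γ M) (cong (q *_) (ℕ.*-identityʳ q)) (bound 1 2 (s≤s z≤n) (ℕ.≤ᵇ⇒≤ 8 10 _))))
        H H≢∅ sensitivity≤M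
      where
      weaken : ∀ a b x → a * b ≤ γ → a * (b * x) ≤ γ * x
      weaken a b x ab≤γ = subst (_≤ γ * x) (ℕ.*-assoc a b x) (ℕ.*-monoˡ-≤ x ab≤γ)
      pow₁ : ∀ c x → c * (x * 1) ≡ c * x
      pow₁ = solve-∀
      pow₂ : ∀ c x → c * (x * (x * 1)) ≡ c * (x * x)
      pow₂ = solve-∀
      pow₃ : ∀ c x → c * (x * (x * (x * 1))) ≡ c * (x * x * x)
      pow₃ = solve-∀
      pow₄ : ∀ x → x * (x * (x * (x * 1))) ≡ x * x * x * x
      pow₄ = solve-∀
      pow₅ : ∀ x → x * (x * (x * (x * (x * 1)))) ≡ x * x * x * x * x
      pow₅ = solve-∀

  -- Both sides are squared: then n appears to the power 8, as q does in the hypothesis, and T to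
  -- the power 10, as in the fifth power of T².
  root-bound : ∀ n q k γ D R T → n ≤ k * q → q ^ 8 ≤ (γ * (D * (T * T))) ^ 5 → k ^ 8 * (γ * D) ^ 5 ≤ R ^ 10 → n ^ 4 ≤ (R * T) ^ 5
  root-bound n q k γ D R T n≤kq q⁸≤ R-large = ^-cancel-≤ 2 (begin
    (n ^ 4) ^ 2                            ≡⟨ ℕ.^-*-assoc n 4 2 ⟩
    n ^ 8                                  ≤⟨ ℕ.^-monoˡ-≤ 8 n≤kq ⟩
    (k * q) ^ 8                            ≡⟨ ^-distrib-* k q 8 ⟩
    k ^ 8 * q ^ 8                          ≤⟨ ℕ.*-monoʳ-≤ (k ^ 8) q⁸≤ ⟩
    k ^ 8 * (γ * (D * (T * T))) ^ 5        ≡⟨ cong (λ x → k ^ 8 * x ^ 5) (sym (ℕ.*-assoc γ D (T * T))) ⟩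
    k ^ 8 * ((γ * D) * (T * T)) ^ 5        ≡⟨ cong (k ^ 8 *_) (trans (^-distrib-* (γ * D) (T * T) 5) (cong ((γ * D) ^ 5 *_) squares)) ⟩
    k ^ 8 * ((γ * D) ^ 5 * T ^ 10)         ≡⟨ sym (ℕ.*-assoc (k ^ 8) ((γ * D) ^ 5) (T ^ 10)) ⟩
    k ^ 8 * (γ * D) ^ 5 * T ^ 10           ≤⟨ ℕ.*-monoˡ-≤ (T ^ 10) R-large ⟩
    R ^ 10 * T ^ 10                        ≡⟨ sym (^-distrib-* R T 10) ⟩
    (R * T) ^ 10                           ≡⟨ sym (ℕ.^-*-assoc (R * T) 5 2) ⟩
    ((R * T) ^ 5) ^ 2                      ∎)
    where
    open ℕ.≤-Reasoning
    squares : (T * T) ^ 5 ≡ T ^ 10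
    squares = trans (^-distrib-* T T 5) (sym (ℕ.^-distribˡ-+-* T 5 5))

  n⁴≤ : ∀ {n} (H : Hypergraph n) → HasHyperedge H → ∀ D T →
    (∀ (x S : Fin (n C 3) → Bool) → (∀ i → S i ≡ true → f H (flipAt i x) ≡ not (f H x)) → ∑ (λ i → χ (S i)) ≤ D * (T * T)) →
    ∀ γ R → 2 * 884736 ≤ γ → 2 * 46656 ≤ γ → 2 * 13824 ≤ γ → 1 ≤ γ →
    512 ^ 8 * (γ * D) ^ 5 ≤ R ^ 10 → 256 ^ 4 ≤ R ^ 5 → n ^ 4 ≤ (R * T) ^ 5
  n⁴≤ {n} H H≢∅ D T sens γ R C₁ C₂ C₃ 1≤γ R-large 256⁴≤R⁵ = cases (n / 256) refl
    where
    open ℕ.≤-Reasoning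
    q = n / 256
    split : n ≡ n % 256 + q * 256
    split = m≡m%n+[m/n]*n n 256
    -- Without queries the sensitivity bound would be 0, whereas a sensitive bit exists by `1≤M`.
    1≤T : 1 ≤ T
    1≤T = ℕ.n≢0⇒n>0 λ T≡0 → contradiction
      (subst (1 ≤_) (trans (cong (λ T → D * (T * T)) T≡0) (ℕ.*-zeroʳ D)) (1≤M H H≢∅ (D * (T * T)) sens)) λ ()
    cases : ∀ k → q ≡ k → n ^ 4 ≤ (R * T) ^ 5
    cases zero q≡0 = begin
      n ^ 4        ≤⟨ ℕ.^-monoˡ-≤ 4 (subst (_≤ 256) (sym (trans split (trans (cong (λ q → n % 256 + q * 256) q≡0) (ℕ.+-identityʳ _)))) (ℕ.<⇒≤ (m%n<n n 256))) ⟩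
      256 ^ 4      ≤⟨ 256⁴≤R⁵ ⟩
      R ^ 5        ≤⟨ ℕ.^-monoˡ-≤ 5 (ℕ.m≤m*n R T {{ℕ.>-nonZero 1≤T}}) ⟩
      (R * T) ^ 5  ∎
    cases (suc k) q≡ = root-bound n q 512 γ D R T n≤512q
      (q⁸≤ H H≢∅ (D * (T * T)) sens γ C₁ C₂ C₃ 1≤γ q 1≤q 256q≤n n≤512q) R-large
      where
      1≤q : 1 ≤ q
      1≤q = subst (1 ≤_) (sym q≡) (s≤s z≤n)
      256q≤n : 256 * q ≤ n
      256q≤n = subst₂ _≤_ (ℕ.*-comm q 256) (sym split) (ℕ.m≤n+m (q * 256) (n % 256))
      n≤512q : n ≤ 512 * q
      n≤512q = begin
        n                    ≡⟨ split ⟩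
        n % 256 + q * 256    ≤⟨ ℕ.+-monoˡ-≤ (q * 256) (ℕ.≤-trans (ℕ.<⇒≤ (m%n<n n 256)) (ℕ.m≤n*m 256 q {{ℕ.>-nonZero 1≤q}})) ⟩
        q * 256 + q * 256    ≡⟨ sym (ℕ.*-distribˡ-+ q 256 256) ⟩
        q * 512              ≡⟨ ℕ.*-comm q 512 ⟩
        512 * q              ∎

  -- The approximants are integer roots rounded down, so each of them, and not only their limit, is
  -- at most b.
  nthRoot-≤ : ∀ a b → a ≤ b ^ 5 → ∀ k → seq (nthRoot 5 a) k ℚ.≤ ι b
  nthRoot-≤ a b a≤b⁵ k = ℚ.toℚᵘ-cancel-≤ (ℚᵘ.≤-respˡ-≃ (ℚᵘ.≃-sym (ℚ.toℚᵘ-fromℚᵘ (ℚᵘ.mkℚᵘ (ℤ.+ r) k)))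
    (ℚᵘ.≤-respʳ-≃ (ℚᵘ.≃-sym (ι-toℚᵘ b)) (ℚᵘ.*≤* (subst₂ ℤ._≤_ (sym (ℤ.*-identityʳ (ℤ.+ r))) (ℤ.pos-* b (suc k)) (ℤ.+≤+ r≤)))))
    where
    open ℕ.≤-Reasoning
    r = iroot 5 (a * suc k ^ 5)
    r≤ : r ≤ b * suc k
    r≤ = ^-cancel-≤ 5 (begin
      r ^ 5                ≤⟨ iroot-lower 5 (a * suc k ^ 5) ⟩
      a * suc k ^ 5        ≤⟨ ℕ.*-monoˡ-≤ (suc k ^ 5) a≤b⁵ ⟩
      b ^ 5 * suc k ^ 5    ≡⟨ sym (^-distrib-* b (suc k) 5) ⟩
      (b * suc k) ^ 5      ∎)

  scaled-root-≤ : ∀ R r → 0ℚ ℚ.< r → ι R ℚ.* r ≡ 1ℚ → ∀ a T → a ≤ (R * T) ^ 5 → fromℚ r *ᴿ nthRoot 5 a ≤ᴿ fromℕ T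
  scaled-root-≤ R r 0<r Rr≡1 a T a≤ = _≲_.un≲ {fromℚ r *ᴿ nthRoot 5 a} {fromℕ T} (≗⇒≲ λ k → begin
    r ℚ.* seq (nthRoot 5 a) k   ≤⟨ ℚ.*-monoˡ-≤-nonNeg r {{ℚ.pos⇒nonNeg r {{ℚ.positive 0<r}}}} (nthRoot-≤ a (R * T) a≤ k) ⟩
    r ℚ.* ι (R * T)             ≡⟨ cong (r ℚ.*_) (ι-* R T) ⟩
    r ℚ.* (ι R ℚ.* ι T)         ≡⟨ sym (ℚ.*-assoc r (ι R) (ι T)) ⟩
    r ℚ.* ι R ℚ.* ι T           ≡⟨ cong (ℚ._* ι T) (trans (ℚ.*-comm r (ι R)) Rr≡1) ⟩
    1ℚ ℚ.* ι T                  ≡⟨ ℚ.*-identityˡ (ι T) ⟩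
    ι T                         ∎)
    where open ℚ.≤-Reasoning

open Arithmetic

theorem4 : ∃[ c ] (0ᴿ <ᴿ c ×
    (∀ (n : ℕ) → 3 ≤ n → (H : Hypergraph n) → HasHyperedge H →
    c *ᴿ nthRoot 5 (n ^ 4) ≤Q f H))
theorem4 =
  -- γ = 2 · 884736 is the largest of the three constants in the regime. R is a power of ten with
  -- 512⁸ (1369γ)⁵, about 4 · 10⁶⁸, below R¹⁰ = 10⁷⁰, and c is its reciprocal.
  let R = 10000000
      γ = 1769472
      r , 0<r , Rr≡1 = reciprocal (ι-pos 9999999)
  in fromℚ r , (r , 0<r , 0 , λ _ _ → ℚ.≤-reflexive (ℚ.+-identityˡ r)) ,
     λ n _ H H≢∅ T 𝒜 computes → scaled-root-≤ R r 0<r Rr≡1 (n ^ 4) T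
       (n⁴≤ H H≢∅ 1369 T (sensitivity-bound 𝒜 (f H) computes) γ R
         (ℕ.≤ᵇ⇒≤ (2 * 884736) γ _) (ℕ.≤ᵇ⇒≤ (2 * 46656) γ _) (ℕ.≤ᵇ⇒≤ (2 * 13824) γ _) (s≤s z≤n)
         (ℕ.≤ᵇ⇒≤ (512 ^ 8 * (γ * 1369) ^ 5) (R ^ 10) _) (ℕ.≤ᵇ⇒≤ (256 ^ 4) (R ^ 5) _))
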